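{- The BC labeling of a connected undirected graph with $n$ vertices and $m$ edges can be computed in $O(m)$ operations and $O(n+m/\omega)$ writes on the Asymmetric RAM model. Queries about bridges, articulation points, or biconnected components can be answered in no writes and $O(1)$ operations given a BC labeling on a rooted spanning tree.
   Context: The BC (biconnected-component) labeling of a connected graph $G=(V,E)$ with respect to a rooted spanning tree stores a vertex label $l:V\setminus\{\text{root}\}\to[C]$, where $C$ is the number of biconnected components of $G$ and $[C]=\{1,\dots,C\}$, and a component head $r:[C]\to V$ of each biconnected component. Each set of vertices sharing a label $i$, together with its head $r(i)$, is the vertex set of a biconnected component; the head of a component is the vertex that is the parent, in the spanning tree, of the set of vertices with that label. Queries: whether a given edge is a bridge; whether a given vertex is an articulation point; the label of the biconnected component containing a given edge. Asymmetric RAM model: an infinitely large asymmetric memory and a small symmetric memory (cache). Each write to the asymmetric memory costs $\omega\gg1$; every other operation has unit cost. "Writes" counts only writes to the asymmetric memory.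
   Formalization: For the queries, the stored BC labeling also includes the size of each label class and the number of components headed by each vertex (built within the same bounds), since bridge and articulation queries cannot be answered in O(1) operations from the labels and heads alone. -}

module Defs where

open import Data.Bool using (Bool; true; false; if_then_else_)
open import Data.Fin using (Fin; toℕ; _≟_; _<?_)
open import Data.Fin.Subset using (Subset; Side; outside; _∈_; _∉_; _⊆_; ⊤; _∪_; _-_; ⁅_⁆; ∣_∣)
open import Data.List using (List; length; lookup; map; filter; sum; allFin)
import Data.List.Membership.Propositional as List
open import Data.List.Relation.Unary.Unique.Propositional using (Unique)
open import Data.Nat using (ℕ; _+_; _*_; _∸_; _<_; _<ᵇ_; _≡ᵇ_)
open import Data.Product using (Σ-syntax; ∃-syntax; ∃₂; _×_)
open import Data.Sum using (_⊎_)
open import Data.Vec using (tabulate)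
open import Function.Definitions using (Injective)
open import Level using (0ℓ)
open import Relation.Binary.Core using (Rel)
open import Relation.Binary.Construct.Closure.ReflexiveTransitive using (Star)
open import Relation.Binary.PropositionalEquality using (_≡_; _≢_)
open import Relation.Nullary using (¬_; does; yes; no)

------------------------------------------------------------------------
-- Graphs

-- A finite simple undirected graph on the vertices Fin n, together with an
-- (arbitrary) ordering of each neighbourhood: the adjacency lists.
record Graph (n : ℕ) : Set where
  field
    adj         : Fin n → List (Fin n)
    symmetric   : ∀ {u v} → v List.∈ adj u → u List.∈ adj v
    irreflexive : ∀ {v} → ¬ (v List.∈ adj v)
    unique      : ∀ v → Unique (adj v)

open Graph public

Edge : ∀ {n} → Graph n → Rel (Fin n) 0ℓ
Edge G u v = v List.∈ adj G u

degree : ∀ {n} → Graph n → Fin n → ℕ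
degree G v = length (adj G v)

-- Each undirected edge is counted once, at its smaller endpoint.
#edges : ∀ {n} → Graph n → ℕ
#edges {n} G = sum (map (λ u → length (filter (u <?_) (adj G u))) (allFin n))

-- The subgraph induced on S by the edge relation E is connected.  The empty
-- graph and the one-vertex graph count as connected.
ConnectedOn : ∀ {n} → Rel (Fin n) 0ℓ → Subset n → Set
ConnectedOn E S = ∀ {u v} → u ∈ S → v ∈ S → Star (λ a b → a ∈ S × b ∈ S × E a b) u v

Connected : ∀ {n} → Graph n → Set
Connected G = ConnectedOn (Edge G) ⊤

-- The two predicates below are meant for connected G.

IsArticulationPoint : ∀ {n} → Graph n → Fin n → Set
IsArticulationPoint G v = ¬ ConnectedOn (Edge G) (⊤ - v)

IsBridge : ∀ {n} → Graph n → Fin n → Fin n → Set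
IsBridge G u v = ¬ ConnectedOn E∖uv ⊤
  where
  E∖uv : Rel _ 0ℓ
  E∖uv a b = Edge G a b × ¬ (a ≡ u × b ≡ v) × ¬ (a ≡ v × b ≡ u)

-- A single edge is biconnected; a single vertex is not, so that the
-- one-vertex graph has no biconnected component.
record IsBiconnected {n} (G : Graph n) (S : Subset n) : Set where
  field
    nontrivial      : ∃₂ λ u v → u ∈ S × v ∈ S × u ≢ v
    connected       : ConnectedOn (Edge G) S
    connected-minus : ∀ x → x ∈ S → ConnectedOn (Edge G) (S - x)

-- Maximal biconnected subgraphs are induced, hence given by vertex sets.
record IsBiconnectedComponent {n} (G : Graph n) (S : Subset n) : Set where
  field
    biconnected : IsBiconnected G S
    maximal     : ∀ {S′} → IsBiconnected G S′ → S ⊆ S′ → S′ ⊆ S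

record RootedSpanningTree {n} (G : Graph n) : Set where
  field
    root        : Fin n
    parent      : ∀ v → .(v ≢ root) → Fin n
    parent-edge : ∀ v (v≢root : v ≢ root) → Edge G v (parent v v≢root)
    to-root     : ∀ v → Star (λ a b → Σ[ a≢root ∈ a ≢ root ] parent a a≢root ≡ b) v root

------------------------------------------------------------------------
-- BC labelings

record Labels {n} {G : Graph n} (T : RootedSpanningTree G) : Set where
  open RootedSpanningTree T
  field
    C     : ℕ
    label : ∀ v → .(v ≢ root) → Fin C
    head  : Fin C → Fin n

  has-label : Fin C → Fin n → Side
  has-label i v with v ≟ root
  ... | yes _      = outside
  ... | no  v≢root = does (label v v≢root ≟ i)

  class : Fin C → Subset n
  class i = tabulate (has-label i)

  component : Fin C → Subset n
  component i = class i ∪ ⁅ head i ⁆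

  headed : Fin n → Subset C
  headed v = tabulate (λ i → does (head i ≟ v))

record BCLabeling {n} (G : Graph n) (T : RootedSpanningTree G) : Set where
  open RootedSpanningTree T
  field
    labels : Labels T
  open Labels labels public
  field
    -- The components indexed by Fin C are exactly the biconnected components
    -- of G, without repetition; so C is their number.
    component-sound     : ∀ i → IsBiconnectedComponent G (component i)
    component-injective : Injective _≡_ _≡_ component
    component-complete  : ∀ S → IsBiconnectedComponent G S → ∃[ i ] component i ≡ S

    -- head i is the parent of the set class i: the parent of some member of
    -- the set, and the only vertex outside the set that is one.
    head-outside   : ∀ i → head i ∉ class i
    head-is-parent : ∀ i → ∃[ v ] Σ[ v≢root ∈ v ≢ root ] (v ∈ class i × parent v v≢root ≡ head i)
    head-only      : ∀ i v (v≢root : v ≢ root) → v ∈ class i →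
                     parent v v≢root ∈ class i ⊎ parent v v≢root ≡ head i

------------------------------------------------------------------------
-- The Asymmetric RAM

-- Registers (the cache) are named only by constants in the program text, so
-- a program uses a constant number of words of symmetric memory.
Reg : Set
Reg = ℕ

data Op : Set where
  add sub mul : Op

data Test : Set where
  lt eq : Reg → Reg → Test

infixr 5 _⨾_

data Program : Set where
  skip  : Program
  const : (r : Reg) (k : ℕ) → Program
  alu   : Op → (r s t : Reg) → Program
  load  : (r a : Reg) → Program            -- r := memory[a]
  store : (a r : Reg) → Program            -- memory[a] := r
  _⨾_   : Program → Program → Program
  cond  : Test → Program → Program → Program
  while : Test → Program → Program

record State : Set where
  constructor ⟨_,_⟩
  field
    cache  : Reg → ℕ
    memory : ℕ → ℕ

open State public

infixl 6 _[_]≔_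

_[_]≔_ : (ℕ → ℕ) → ℕ → ℕ → (ℕ → ℕ)
(f [ i ]≔ x) j = if j ≡ᵇ i then x else f j

evalOp : Op → ℕ → ℕ → ℕ
evalOp add = _+_
evalOp sub = _∸_
evalOp mul = _*_

evalTest : Test → State → Bool
evalTest (lt r s) σ = cache σ r <ᵇ cache σ s
evalTest (eq r s) σ = cache σ r ≡ᵇ cache σ s

-- Run W p σ τ t w: on a machine whose words are the numbers below W, the
-- program p started in σ halts in τ after t operations, of which w are writes
-- to the asymmetric memory.  (With write cost ω, its total cost is
-- (t ∸ w) + ω * w.)  A program whose arithmetic leaves the word range is stuck.
data Run (W : ℕ) : Program → State → State → ℕ → ℕ → Set where
  skip        : ∀ {σ} → Run W skip σ σ 0 0
  const       : ∀ {r k c m} → k < W →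
                Run W (const r k) ⟨ c , m ⟩ ⟨ c [ r ]≔ k , m ⟩ 1 0
  alu         : ∀ {⊙ r s t c m} → evalOp ⊙ (c s) (c t) < W →
                Run W (alu ⊙ r s t) ⟨ c , m ⟩ ⟨ c [ r ]≔ evalOp ⊙ (c s) (c t) , m ⟩ 1 0
  load        : ∀ {r a c m} →
                Run W (load r a) ⟨ c , m ⟩ ⟨ c [ r ]≔ m (c a) , m ⟩ 1 0
  store       : ∀ {a r c m} →
                Run W (store a r) ⟨ c , m ⟩ ⟨ c , m [ c a ]≔ c r ⟩ 1 1
  _⨾_         : ∀ {p q ρ σ τ t t′ w w′} →
                Run W p ρ σ t w → Run W q σ τ t′ w′ →
                Run W (p ⨾ q) ρ τ (t + t′) (w + w′)
  cond-true   : ∀ {b p q σ τ t w} → evalTest b σ ≡ true → Run W p σ τ t w →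
                Run W (cond b p q) σ τ (1 + t) w
  cond-false  : ∀ {b p q σ τ t w} → evalTest b σ ≡ false → Run W q σ τ t w →
                Run W (cond b p q) σ τ (1 + t) w
  while-true  : ∀ {b p ρ σ τ t t′ w w′} → evalTest b ρ ≡ true →
                Run W p ρ σ t w → Run W (while b p) σ τ t′ w′ →
                Run W (while b p) ρ τ (1 + (t + t′)) (w + w′)
  while-false : ∀ {b p σ} → evalTest b σ ≡ false →
                Run W (while b p) σ σ 1 0

IsWordState : ℕ → State → Set
IsWordState W σ = (∀ r → cache σ r < W) × (∀ a → memory σ a < W)

------------------------------------------------------------------------
-- Data in memory

-- The input: n, ω, then n + 1 offsets, then the adjacency lists one after
-- another.  The rest of the memory is unspecified.
record GraphInMemory {n} (G : Graph n) (ω : ℕ) (mem : ℕ → ℕ) : Set where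
  field
    vertex-count : mem 0 ≡ n
    write-cost   : mem 1 ≡ ω
    first-offset : mem 2 ≡ 3 + n
    next-offset  : ∀ v → mem (3 + toℕ v) ≡ mem (2 + toℕ v) + degree G v
    neighbours   : ∀ v (j : Fin (degree G v)) →
                   mem (mem (2 + toℕ v) + toℕ j) ≡ toℕ (lookup (adj G v) j)

-- The cell at address a exists on a W-word machine and contains x.
Cell : ℕ → (ℕ → ℕ) → ℕ → ℕ → Set
Cell W mem a x = a < W × mem a ≡ x

-- Registers 0 and 1 are left for the arguments of queries.  Besides the tree,
-- l and r, the stored form has two tables of derived counts: the size of each
-- label class, and the number of components headed by each vertex.  Without
-- them, bridge and articulation-point queries would need a search through the
-- arrays for l and r.
record LabelingInMemory (W : ℕ) {n} {G : Graph n} {T : RootedSpanningTree G}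
                        (L : BCLabeling G T) (σ : State) : Set where
  open RootedSpanningTree T
  open BCLabeling L
  field
    root-word    : cache σ 2 ≡ toℕ root
    count-word   : cache σ 3 ≡ C
    parent-array : ∀ v (v≢root : v ≢ root) →
                   Cell W (memory σ) (cache σ 4 + toℕ v) (toℕ (parent v v≢root))
    label-array  : ∀ v (v≢root : v ≢ root) →
                   Cell W (memory σ) (cache σ 5 + toℕ v) (toℕ (label v v≢root))
    head-array   : ∀ i → Cell W (memory σ) (cache σ 6 + toℕ i) (toℕ (head i))
    size-array   : ∀ i → Cell W (memory σ) (cache σ 7 + toℕ i) ∣ class i ∣
    headed-array : ∀ v → Cell W (memory σ) (cache σ 8 + toℕ v) ∣ headed v ∣

-- The truth value of P, as a machine word.
IsAnswer : Set → ℕ → Set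
IsAnswer P x = (x ≡ 1 × P) ⊎ (x ≡ 0 × ¬ P)

{-# OPTIONS --safe #-}
module Submission where

-- A depth-first search needs only O(n) writes, since the scan position of a
-- vertex has to be saved in memory only when the search descends from it; and
-- every edge then joins an ancestor and a descendant.  Let low v be the least
-- number of a vertex adjacent to a descendant of v.  A vertex v joins the class
-- of its parent p if low v < num p, and otherwise opens a new class with head p.
-- A class and its head are biconnected, because below every vertex of the class
-- that is not its top a back edge jumps over the parent.  They form a maximal
-- biconnected set, because every edge leaving the part of the graph that hangs
-- below a class ends at the head of that class.  The last property holds for
-- every BC labeling; hence an edge is a bridge iff its class is a singleton, and
-- a vertex is an articulation point iff it belongs to two components.

open import Defs
open import Data.Bool using (Bool; T; false; if_then_else_; true)
open import Data.Bool.Properties using (¬-not)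
open import Data.Empty using (⊥)
open import Data.Fin using (#_; Fin; _≟_; combine; fromℕ<; inject≤; suc; toℕ; zero) renaming (_<?_ to _<ᶠ?_)
open import Data.Fin.Properties using (<-cmp; any?; combine-injective; injective⇒≤; toℕ-combine; toℕ-fromℕ<;
         toℕ-injective; toℕ-inject≤; toℕ<n) renaming (suc-injective to sucᶠ-injective)
open import Data.Fin.Subset using (Subset; _-_; _∈_; _∉_; _∪_; _⊃_; _⊆_; ⁅_⁆; ∣_∣; ⊤)
open import Data.Fin.Subset.Induction using (⊃-wellFounded)
open import Data.Fin.Subset.Properties using (Empty-unique; _∈?_; nonempty?; p⊆p∪q; p⊆q⇒∣p∣≤∣q∣; p─q⊆p;
         p─q─q≡p─q; q⊆p∪q; x∈p⇒∣p-x∣<∣p∣; x∈p∧x≢y⇒x∈p-y; x∈p∪q⁻; x∈⁅x⁆; x∈⁅y⁆⇒x≡y; ∈⊤; ∣p∣≤n; ∣⁅x⁆∣≡1;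
         ∣⊥∣≡0; ⊆-antisym; ⊆-refl; ⊆-trans)
open import Data.List using (List; []; _∷_; allFin; filter; length; lookup; map) renaming (tabulate to
         List-tabulate)
open import Data.List.Membership.Propositional using () renaming (_∈_ to _∈ᴸ_)
open import Data.List.Membership.Propositional.Properties using (∈-filter⁺; ∈-filter⁻; ∈-length; ∈-lookup)
open import Data.List.Properties using (map-tabulate)
open import Data.List.Relation.Unary.All using (All; []; _∷_) renaming (tabulate to All-tabulate; lookup to
         All-lookup)
open import Data.List.Relation.Unary.AllPairs using ([]; _∷_)
open import Data.List.Relation.Unary.Any using (here; index; there)
open import Data.List.Relation.Unary.Any.Properties using (lookup-index)
open import Data.List.Relation.Unary.Unique.Propositional using (Unique)
open import Data.List.Relation.Unary.Unique.Propositional.Properties using (filter⁺)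
open import Data.Nat using (NonZero; _*_; _+_; _/_; _<?_; _<_; _∸_; _≡ᵇ_; _≤_; _⊔_; suc; s≤s; s≤s⁻¹; zero;
         z≤n; ℕ) renaming (_≟_ to _≟ℕ_)
open import Data.Nat.Induction using (<-wellFounded)
open import Data.Nat.ListAction using () renaming (sum to List-sum)
open import Data.Nat.Properties using (*-assoc; *-comm; *-distribʳ-+; *-distribˡ-+; *-identityʳ;
         *-identityˡ; *-monoʳ-<; *-monoʳ-≤; *-monoˡ-≤; *-suc; *-zeroʳ; +-0-commutativeMonoid; +-assoc;
         +-cancelˡ-≡; +-comm; +-identityʳ; +-mono-<-≤; +-mono-≤; +-monoʳ-<; +-monoʳ-≤; +-monoˡ-≤; +-suc;
         +-∸-assoc; <-asym; <-irrefl; <-trans; <-≤-trans; <ᵇ⇒<; <⇒<ᵇ; <⇒≢; <⇒≤; <⇒≱; m<n⇒m<1+n; module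
         ≤-Reasoning; m≤m+n; m≤m⊔n; m≤n*m; m≤n+m; m≤n⇒m<n∨m≡n; m≤n⇒m≤1+n; m≤n⊔m; n<1+n; n≤1+n; n≮0;
         suc-injective; ≡ᵇ⇒≡; ≡⇒≡ᵇ; ≤-<-trans; ≤-antisym; ≤-refl; ≤-reflexive; ≤-trans; ≤ᵇ⇒≤; ≤∧≢⇒<; ≮⇒≥)
open import Data.Product using (_,_; _×_; proj₁; proj₂; Σ-syntax; ∃-syntax; ∃₂)
open import Data.Sum using ([_,_]′; _⊎_; inj₁; inj₂) renaming (map to ⊎-map)
open import Data.Unit using (tt)
open import Data.Vec using () renaming (tabulate to Vec-tabulate)
open import Data.Vec.Functional using (updateAt)
open import Data.Vec.Functional.Properties using (updateAt-minimal; updateAt-updates)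
open import Data.Vec.Properties using ([]=⇒lookup; lookup⇒[]=; lookup∘tabulate) renaming (tabulate-cong to
         Vec-tabulate-cong)
open import Function using (_∘_; mk⇔)
open import Induction.WellFounded using (Acc; acc)
open import Level using (0ℓ)
open import Relation.Binary.Construct.Closure.ReflexiveTransitive using (Star; _⋆; _◅_; _◅◅_; fold; reverse;
         ε) renaming (map to Star-map)
open import Relation.Binary.Definitions using (tri<; tri>; tri≈)
open import Relation.Binary.PropositionalEquality using (_≡_; _≢_; cong; cong-app; cong₂; module
         ≡-Reasoning; refl; subst; subst₂; sym; trans)
open import Relation.Nullary using (Dec; contradiction; does; no; yes; ¬_)
open import Relation.Nullary.Decidable using (_×-dec_; dec-false; dec-true; decidable-stable; does-⇔; ¬?)
open import Relation.Unary using (Decidable; Pred)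
open import Algebra.Properties.CommutativeMonoid.Sum +-0-commutativeMonoid using (sum; sum-cong-≗; ∑-comm;
         ∑-distrib-+)

-- Connectivity and biconnected components

-- What has to be avoided is a write per edge. The search needs no stack: the parent pointers are
-- the stack, and a saved scan position is restored when a child is left. Low points are not updated
-- edge by edge either: the minimum over an adjacency list is kept in a register, written once per
-- vertex, and then pushed to the parents in decreasing order of search numbers. Labels are given
-- out in increasing order, when the label of the parent is already there. Maximality is proved on
-- the block tree, described by the heads alone (`Below`). The argument asks only that every edge
-- lie in a component and that some rank grow from a head to its class. The rank is the search
-- number for the labeling that is built, and the depth for a labeling on an arbitrary rooted
-- spanning tree, where no search numbers exist. A maximal biconnected set around an edge is
-- obtained only under a double negation; this suffices, because it is decidable whether some
-- component contains both ends.

x∈p-y⇒x∈p : ∀ {n} {x y : Fin n} {p} → x ∈ p - y → x ∈ p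
x∈p-y⇒x∈p {p = p} = p─q⊆p p _

-- If `x` were in `p - x`, removing it once more would shrink the set, but removal is idempotent.
x∈p-y⇒x≢y : ∀ {n} {x y : Fin n} {p} → x ∈ p - y → x ≢ y
x∈p-y⇒x≢y {x = x} {p = p} x∈ refl =
  <-irrefl (cong ∣_∣ (p─q─q≡p─q p ⁅ x ⁆)) (x∈p⇒∣p-x∣<∣p∣ x∈)

-⁺ˡ : ∀ {n} {x y : Fin n} {p q} → (x ∈ p → x ∈ q) → x ∈ p - y → x ∈ q - y
-⁺ˡ f x∈ = x∈p∧x≢y⇒x∈p-y (f (x∈p-y⇒x∈p x∈)) (x∈p-y⇒x≢y x∈)

Path : ∀ {n} → Graph n → Subset n → Fin n → Fin n → Set
Path G S = Star (λ a b → a ∈ S × b ∈ S × Edge G a b)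

module _ {n} (G : Graph n) where

  Path-mono : ∀ {S S′ u v} → S ⊆ S′ → Path G S u v → Path G S′ u v
  Path-mono S⊆S′ = Star-map (λ (a∈ , b∈ , e) → S⊆S′ a∈ , S⊆S′ b∈ , e)

  Path-sym : ∀ {S u v} → Path G S u v → Path G S v u
  Path-sym = reverse (λ (a∈ , b∈ , e) → b∈ , a∈ , symmetric G e)

  hub-connected : ∀ {S} h → (∀ {u} → u ∈ S → Path G S u h) → ConnectedOn (Edge G) S
  hub-connected h to-h u∈ v∈ = to-h u∈ ◅◅ Path-sym (to-h v∈)

  module _ {S} (B : IsBiconnected G S) where
    open IsBiconnected B

    connected-minus′ : ∀ x → ConnectedOn (Edge G) (S - x)
    connected-minus′ x with x ∈? S
    ... | yes x∈S = connected-minus x x∈S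
    ... | no  x∉S = λ u∈ v∈ → Path-mono (λ y∈ → x∈p∧x≢y⇒x∈p-y y∈ λ { refl → x∉S y∈ })
                                (connected (x∈p-y⇒x∈p u∈) (x∈p-y⇒x∈p v∈))

    biconnected-edge : ∃₂ λ u v → u ∈ S × v ∈ S × Edge G u v
    biconnected-edge with nontrivial
    ... | u , v , u∈ , v∈ , u≢v with connected u∈ v∈
    ...   | ε                     = contradiction refl u≢v
    ...   | (_ , w∈ , e) ◅ _      = u , _ , u∈ , w∈ , e

  -- The union is described by inclusions and a case split, so that the lemma also applies to
  -- `(S ∪ S′) - x`.
  ∪-connected : ∀ {S S′ U z} → S ⊆ U → S′ ⊆ U → (∀ {x} → x ∈ U → x ∈ S ⊎ x ∈ S′) →
                z ∈ S → z ∈ S′ → ConnectedOn (Edge G) S → ConnectedOn (Edge G) S′ →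
                ConnectedOn (Edge G) U
  ∪-connected S⊆U S′⊆U split z∈S z∈S′ conn conn′ = hub-connected _ λ u∈ →
    [ (λ u∈S → Path-mono S⊆U (conn u∈S z∈S)) , (λ u∈S′ → Path-mono S′⊆U (conn′ u∈S′ z∈S′)) ]′
    (split u∈)

  -- Whichever vertex is deleted, `u` or `v` survives and links the two connected remainders.
  ∪-biconnected : ∀ {S S′ u v} → IsBiconnected G S → IsBiconnected G S′ → u ≢ v →
                  u ∈ S → u ∈ S′ → v ∈ S → v ∈ S′ → IsBiconnected G (S ∪ S′)
  ∪-biconnected {S} {S′} {u} {v} B B′ u≢v u∈ u∈′ v∈ v∈′ = record
    { nontrivial      = u , v , p⊆p∪q S′ u∈ , p⊆p∪q S′ v∈ , u≢v
    ; connected       = ∪-connected (p⊆p∪q S′) (q⊆p∪q S S′) (x∈p∪q⁻ S S′) u∈ u∈′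
                          (IsBiconnected.connected B) (IsBiconnected.connected B′)
    ; connected-minus = λ x _ → minus x
    }
    where
    shared : ∀ x → ∃[ z ] z ∈ S - x × z ∈ S′ - x
    shared x with u ≟ x
    ... | no  u≢x  = u , x∈p∧x≢y⇒x∈p-y u∈ u≢x , x∈p∧x≢y⇒x∈p-y u∈′ u≢x
    ... | yes refl = v , x∈p∧x≢y⇒x∈p-y v∈ v≢u , x∈p∧x≢y⇒x∈p-y v∈′ v≢u
      where v≢u = λ v≡u → u≢v (sym v≡u)

    split : ∀ x {y} → y ∈ (S ∪ S′) - x → y ∈ S - x ⊎ y ∈ S′ - x
    split x y∈ with x∈p∪q⁻ S S′ (x∈p-y⇒x∈p y∈)
    ... | inj₁ y∈S  = inj₁ (x∈p∧x≢y⇒x∈p-y y∈S (x∈p-y⇒x≢y y∈))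
    ... | inj₂ y∈S′ = inj₂ (x∈p∧x≢y⇒x∈p-y y∈S′ (x∈p-y⇒x≢y y∈))

    minus : ∀ x → ConnectedOn (Edge G) ((S ∪ S′) - x)
    minus x with shared x
    ... | z , z∈ , z∈′ = ∪-connected (-⁺ˡ (p⊆p∪q S′)) (-⁺ˡ (q⊆p∪q S S′)) (split x) z∈ z∈′
                           (connected-minus′ B x) (connected-minus′ B′ x)

  -- The union is biconnected, so each set absorbs it by maximality. In particular a component is
  -- determined by any one of its edges.
  component-unique : ∀ {S S′ u v} → IsBiconnectedComponent G S → IsBiconnectedComponent G S′ →
                     u ≢ v → u ∈ S → u ∈ S′ → v ∈ S → v ∈ S′ → S ≡ S′
  component-unique {S} {S′} M M′ u≢v u∈ u∈′ v∈ v∈′ = ⊆-antisym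
    (λ x∈ → IsBiconnectedComponent.maximal M′ U (q⊆p∪q S S′) (p⊆p∪q S′ x∈))
    (λ x∈ → IsBiconnectedComponent.maximal M U (p⊆p∪q S′) (q⊆p∪q S S′ x∈))
    where
    U = ∪-biconnected (IsBiconnectedComponent.biconnected M) (IsBiconnectedComponent.biconnected M′)
          u≢v u∈ u∈′ v∈ v∈′

  edge-≢ : ∀ {u v} → Edge G u v → u ≢ v
  edge-≢ e refl = irreflexive G e

-- Labels and the separation property of component heads

module LabelProperties {n} {G : Graph n} {T : RootedSpanningTree G} (L : Labels T) where
  open RootedSpanningTree T
  open Labels L

  ∈class⁺ : ∀ {i v} (v≢root : v ≢ root) → label v v≢root ≡ i → v ∈ class i
  ∈class⁺ {i} {v} v≢root eq′ = lookup⇒[]= v _ (trans (lookup∘tabulate (has-label i) v) labelled)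
    where
    labelled : has-label i v ≡ true
    labelled with v ≟ root
    ... | yes v≡root = contradiction v≡root v≢root
    ... | no  _      = dec-true (label v _ ≟ i) eq′

  ∈class⁻ : ∀ {i v} → v ∈ class i → Σ[ v≢root ∈ v ≢ root ] label v v≢root ≡ i
  ∈class⁻ {i} {v} v∈ = go (trans (sym (lookup∘tabulate (has-label i) v)) ([]=⇒lookup v∈))
    where
    go : has-label i v ≡ true → Σ[ v≢root ∈ v ≢ root ] label v v≢root ≡ i
    go eq′ with v ≟ root
    ... | no v≢root with label v v≢root ≟ i
    ...   | yes l≡i = v≢root , l≡i

  class-unique : ∀ {i j v} → v ∈ class i → v ∈ class j → i ≡ j
  class-unique v∈i v∈j with ∈class⁻ v∈i | ∈class⁻ v∈j
  ... | _ , refl | _ , refl = refl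

  ∈component⁻ : ∀ {i v} → v ∈ component i → v ∈ class i ⊎ v ≡ head i
  ∈component⁻ {i} v∈ with x∈p∪q⁻ (class i) ⁅ head i ⁆ v∈
  ... | inj₁ v∈class = inj₁ v∈class
  ... | inj₂ v∈head  = inj₂ (x∈⁅y⁆⇒x≡y _ v∈head)

  class⊆component : ∀ {i v} → v ∈ class i → v ∈ component i
  class⊆component {i} = p⊆p∪q ⁅ head i ⁆

  head∈component : ∀ {i} → head i ∈ component i
  head∈component {i} = q⊆p∪q (class i) _ (x∈⁅x⁆ (head i))

  Covering : Set
  Covering = ∀ {u v} → Edge G u v → ∃[ i ] u ∈ component i × v ∈ component i

  -- Starting at `v`, pass repeatedly from a vertex to the head of its class; `v` is below `i` if
  -- this chain meets `class i`. No tree parent is mentioned, only labels and heads.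
  data Below (i : Fin C) : Fin n → Set where
    here  : ∀ {v} → v ∈ class i → Below i v
    there : ∀ {v j} → v ∈ class j → Below i (head j) → Below i v

  below-class : ∀ {i v} → Below i v → ∃[ j ] v ∈ class j
  below-class (here v∈)    = _ , v∈
  below-class (there v∈ _) = _ , v∈

  root-not-below : ∀ {i} → ¬ Below i root
  root-not-below b = proj₁ (∈class⁻ (proj₂ (below-class b))) refl

  -- A rank that grows from head to class makes the chain of heads acyclic. It is kept abstract
  -- because it is instantiated twice: by the depth in the tree and by the search number.
  module Separation (cover : Covering) (rank : Fin n → ℕ)
                    (rank-head : ∀ {i v} → v ∈ class i → rank (head i) < rank v) where

    below-rank : ∀ {i v} → Below i v → rank (head i) < rank v
    below-rank (here v∈)    = rank-head v∈
    below-rank (there v∈ b) = <-trans (below-rank b) (rank-head v∈)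

    head-not-below : ∀ {i} → ¬ Below i (head i)
    head-not-below b = <-irrefl refl (below-rank b)

    head∉class : ∀ {i} → head i ∉ class i
    head∉class h∈ = head-not-below (here h∈)

    below-pred : ∀ {i j u} → Below i u → u ∈ class j → i ≡ j ⊎ Below i (head j)
    below-pred (here u∈i) u∈j = inj₁ (class-unique u∈i u∈j)
    below-pred (there u∈k b) u∈j with class-unique u∈k u∈j
    ... | refl = inj₂ b

    -- Below i is a union of subtrees of the block tree, hung from head i.
    below-step : ∀ {i u v} → Below i u → Edge G u v → Below i v ⊎ (v ≡ head i × u ∈ class i)
    below-step b e with cover e
    ... | j , u∈ , v∈ with ∈component⁻ u∈ | ∈component⁻ v∈
    ...   | inj₂ refl | inj₁ v∈j  = inj₁ (there v∈j b)
    ...   | inj₂ refl | inj₂ refl = inj₁ b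
    ...   | inj₁ u∈j  | v∈ with below-pred b u∈j | v∈
    ...     | inj₁ refl | inj₁ v∈j  = inj₁ (here v∈j)
    ...     | inj₁ refl | inj₂ refl = inj₂ (refl , u∈j)
    ...     | inj₂ b′   | inj₁ v∈j  = inj₁ (there v∈j b′)
    ...     | inj₂ b′   | inj₂ refl = inj₁ b′

    below-path : ∀ {i S u v} → Below i u → Path G (S - head i) u v → Below i v
    below-path b ε = b
    below-path b ((_ , w∈ , e) ◅ path) with below-step b e
    ... | inj₁ b′         = below-path b′ path
    ... | inj₂ (refl , _) = contradiction refl (x∈p-y⇒x≢y w∈)

    -- Cuts the chain of heads at its other end, where it enters `class i`; `component-maximal`
    -- deletes that entrance.
    below-last : ∀ {i v} → Below i v → v ∈ class i ⊎ ∃[ j ] Below j v × head j ∈ class i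
    below-last (here v∈)     = inj₁ v∈
    below-last (there v∈ b) with below-last b
    ... | inj₁ h∈             = inj₂ (_ , here v∈ , h∈)
    ... | inj₂ (j , b′ , hj∈) = inj₂ (j , there v∈ b′ , hj∈)

    -- A path in `S` from `class i` to `x` that avoids `head i` stays below `i`. If `x` is not in
    -- the class, it is below some `j` whose head is in the class. Then a path in `S` from `x` to
    -- `head i` that avoids `head j` would stay below `j`, although `head i` has smaller rank than
    -- `head j`.
    component-maximal : ∀ {i} → ∃[ v ] v ∈ class i → ∀ {S} → IsBiconnected G S →
                        component i ⊆ S → S ⊆ component i
    component-maximal {i} (t , t∈) {S} B comp⊆S {x} x∈S with x ≟ head i
    ... | yes refl = head∈component
    ... | no x≢h with below-last (below-path (here t∈) (minus (head i) t∈S-h (x∈p∧x≢y⇒x∈p-y x∈S x≢h)))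
      where
      minus = connected-minus′ G B
      t∈S-h = x∈p∧x≢y⇒x∈p-y (comp⊆S (class⊆component t∈)) λ { refl → head∉class t∈ }
    ...   | inj₁ x∈class          = class⊆component x∈class
    ...   | inj₂ (j , x<j , hj∈i) = contradiction (rank-head hj∈i) λ hi<hj →
            <-irrefl refl (<-trans hi<hj (below-rank (below-path x<j
              (connected-minus′ G B (head j)
                (x∈p∧x≢y⇒x∈p-y x∈S λ { refl → head-not-below x<j })
                (x∈p∧x≢y⇒x∈p-y (comp⊆S head∈component) λ hi≡hj → <-irrefl (cong rank hi≡hj) hi<hj)))))

    -- If the heads differ, each lies in the class of the other component and so has greater rank
    -- than the other. If they agree, `v` cannot be the head and must carry both labels.
    component-injective : ∀ {i j v} → v ∈ class i → component i ≡ component j → i ≡ j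
    component-injective {i} {j} {v} v∈i same with head i ≟ head j
    ... | no hi≢hj = contradiction (below same hi≢hj) (<-asym (below (sym same) λ h → hi≢hj (sym h)))
      where
      below : ∀ {i j} → component i ≡ component j → head i ≢ head j → rank (head j) < rank (head i)
      below same h≢h with ∈component⁻ (subst (_ ∈_) same head∈component)
      ... | inj₁ hi∈j  = rank-head hi∈j
      ... | inj₂ hi≡hj = contradiction hi≡hj h≢h
    ... | yes hi≡hj with ∈component⁻ {j} (subst (v ∈_) same (class⊆component v∈i))
    ...   | inj₁ v∈j  = class-unique v∈i v∈j
    ...   | inj₂ v≡hj = contradiction (subst (_∈ class i) (trans v≡hj (sym hi≡hj)) v∈i) head∉class

-- Small cardinalities of finite subsets

∣p∣≤1⇒≡ : ∀ {n} {p : Subset n} {x y} → ∣ p ∣ ≤ 1 → x ∈ p → y ∈ p → x ≡ y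
∣p∣≤1⇒≡ {x = x} {y} ∣p∣≤1 x∈ y∈ = decidable-stable (x ≟ y) λ x≢y →
  n≮0 (<-≤-trans (x∈p⇒∣p-x∣<∣p∣ (x∈p∧x≢y⇒x∈p-y x∈ x≢y))
        (s≤s⁻¹ (≤-trans (x∈p⇒∣p-x∣<∣p∣ y∈) ∣p∣≤1)))

p⊆⁅x⁆⇒∣p∣≤1 : ∀ {n} {p : Subset n} x → p ⊆ ⁅ x ⁆ → ∣ p ∣ ≤ 1
p⊆⁅x⁆⇒∣p∣≤1 x p⊆ = ≤-trans (p⊆q⇒∣p∣≤∣q∣ p⊆) (≤-reflexive (∣⁅x⁆∣≡1 x))

x∈p⇒1≤∣p∣ : ∀ {n} {p : Subset n} {x} → x ∈ p → 1 ≤ ∣ p ∣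
x∈p⇒1≤∣p∣ x∈ = ≤-trans (s≤s z≤n) (x∈p⇒∣p-x∣<∣p∣ x∈)

1≤∣p∣⇒∃ : ∀ {n} (p : Subset n) → 1 ≤ ∣ p ∣ → ∃[ x ] x ∈ p
1≤∣p∣⇒∃ {n} p 1≤ = decidable-stable (nonempty? p) λ empty →
  <⇒≢ 1≤ (sym (trans (cong ∣_∣ (Empty-unique empty)) (∣⊥∣≡0 n)))

2≤∣p∣⇒∃≢ : ∀ {n} {p : Subset n} {x} → x ∈ p → 2 ≤ ∣ p ∣ → ∃[ y ] y ∈ p × y ≢ x
2≤∣p∣⇒∃≢ {p = p} {x} x∈ 2≤ = decidable-stable (any? λ y → (y ∈? p) ×-dec ¬? (y ≟ x)) λ none →
  <⇒≱ 2≤ (p⊆⁅x⁆⇒∣p∣≤1 x λ {y} y∈ → subst (_∈ ⁅ x ⁆)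
    (sym (decidable-stable (y ≟ x) λ y≢x → none (y , y∈ , y≢x))) (x∈⁅x⁆ x))

-- Single edges, maximal biconnected sets, and depth in a rooted tree

module _ {n} (G : Graph n) where

  edge-biconnected : ∀ {u v} → Edge G u v → IsBiconnected G (⁅ u ⁆ ∪ ⁅ v ⁆)
  edge-biconnected {u} {v} e = record
    { nontrivial      = u , v , u∈ , v∈ , edge-≢ G e
    ; connected       = hub-connected G v to-v
    ; connected-minus = minus
    }
    where
    u∈ = p⊆p∪q ⁅ v ⁆ (x∈⁅x⁆ u)
    v∈ = q⊆p∪q ⁅ u ⁆ ⁅ v ⁆ (x∈⁅x⁆ v)

    either : ∀ {x} → x ∈ ⁅ u ⁆ ∪ ⁅ v ⁆ → x ≡ u ⊎ x ≡ v
    either x∈ with x∈p∪q⁻ ⁅ u ⁆ ⁅ v ⁆ x∈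
    ... | inj₁ x∈u = inj₁ (x∈⁅y⁆⇒x≡y _ x∈u)
    ... | inj₂ x∈v = inj₂ (x∈⁅y⁆⇒x≡y _ x∈v)

    to-v : ∀ {x} → x ∈ ⁅ u ⁆ ∪ ⁅ v ⁆ → Path G (⁅ u ⁆ ∪ ⁅ v ⁆) x v
    to-v x∈ with either x∈
    ... | inj₁ refl = (u∈ , v∈ , e) ◅ ε
    ... | inj₂ refl = ε

    minus : ∀ x → x ∈ ⁅ u ⁆ ∪ ⁅ v ⁆ → ConnectedOn (Edge G) ((⁅ u ⁆ ∪ ⁅ v ⁆) - x)
    minus x x∈ y∈ z∈ with either x∈ | either (x∈p-y⇒x∈p y∈) | either (x∈p-y⇒x∈p z∈)
    ... | inj₁ refl | inj₁ refl | _         = contradiction refl (x∈p-y⇒x≢y y∈)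
    ... | inj₁ refl | inj₂ refl | inj₁ refl = contradiction refl (x∈p-y⇒x≢y z∈)
    ... | inj₁ refl | inj₂ refl | inj₂ refl = ε
    ... | inj₂ refl | inj₂ refl | _         = contradiction refl (x∈p-y⇒x≢y y∈)
    ... | inj₂ refl | inj₁ refl | inj₂ refl = contradiction refl (x∈p-y⇒x≢y z∈)
    ... | inj₂ refl | inj₁ refl | inj₁ refl = ε

  -- Growing `S` must stop, but whether a proper biconnected superset exists is not decided here,
  -- hence the double negation.
  ¬¬-maximal : ∀ {S} → IsBiconnected G S → ¬ ¬ (∃[ S′ ] S ⊆ S′ × IsBiconnectedComponent G S′)
  ¬¬-maximal {S} = go (⊃-wellFounded S)
    where
    go : ∀ {S} → Acc _⊃_ S → IsBiconnected G S → ¬ ¬ (∃[ S′ ] S ⊆ S′ × IsBiconnectedComponent G S′)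
    go {S} (acc rec) B none = none (S , ⊆-refl , record
      { biconnected = B
      ; maximal     = λ B′ S⊆S′ {x} x∈S′ → decidable-stable (x ∈? S) λ x∉S →
          go (rec (S⊆S′ , x , x∈S′ , x∉S)) B′ λ (S″ , S′⊆S″ , M) →
            none (S″ , ⊆-trans S⊆S′ S′⊆S″ , M)
      })

module _ {n} {G : Graph n} (T : RootedSpanningTree G) where
  open RootedSpanningTree T

  private
    Up : Fin n → Fin n → Set
    Up a b = Σ[ a≢root ∈ a ≢ root ] parent a a≢root ≡ b

    height : ∀ {a b} → Star Up a b → ℕ
    height = fold (λ _ _ → ℕ) (λ _ → suc) 0

    -- A parent chain is determined by its start, since `parent` ignores the proof that the vertex
    -- is not the root. So `depth` can be read off the chain that comes with the tree.
    height-unique : ∀ {a} (p q : Star Up a root) → height p ≡ height q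
    height-unique ε ε = refl
    height-unique ε ((r≢r , _) ◅ _) = contradiction refl r≢r
    height-unique ((r≢r , _) ◅ _) ε = contradiction refl r≢r
    height-unique ((_ , refl) ◅ p) ((_ , refl) ◅ q) = cong suc (height-unique p q)

  depth : Fin n → ℕ
  depth v = height (to-root v)

  depth-parent : ∀ v (v≢root : v ≢ root) → depth (parent v v≢root) < depth v
  depth-parent v v≢root =
    ≤-reflexive (height-unique ((v≢root , refl) ◅ to-root (parent v v≢root)) (to-root v))

-- Bridges and articulation points in terms of an arbitrary BC labeling

module QueryFacts {n} {G : Graph n} (conn : Connected G) {T : RootedSpanningTree G} (L : BCLabeling G T) where
  open RootedSpanningTree T
  open BCLabeling L
  open LabelProperties labels

  -- By `head-only`, climbing the tree from a vertex of the class can leave the class only at the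
  -- head, and each step lowers the depth.
  depth-head : ∀ {i v} → v ∈ class i → depth T (head i) < depth T v
  depth-head {i} = go (<-wellFounded _)
    where
    go : ∀ {v} → Acc _<_ (depth T v) → v ∈ class i → depth T (head i) < depth T v
    go {v} (acc rec) v∈ with ∈class⁻ v∈
    ... | v≢root , _ with head-only i v v≢root v∈
    ...   | inj₁ p∈   = <-trans (go (rec (depth-parent T v v≢root)) p∈) (depth-parent T v v≢root)
    ...   | inj₂ p≡hd = subst (λ h → depth T h < depth T v) p≡hd (depth-parent T v v≢root)

  -- The two ends of an edge form a biconnected set, a maximal one around it is listed by
  -- `component-complete`, and decidability removes the double negation.
  covering : Covering
  covering {u} {v} e = decidable-stable (any? λ i → (u ∈? component i) ×-dec (v ∈? component i))
    λ none → ¬¬-maximal G (edge-biconnected G e) λ (S , uv⊆S , M) →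
      let i , comp≡S = component-complete S M
          ⊆comp = λ {x} x∈ → subst (x ∈_) (sym comp≡S) (uv⊆S x∈)
      in none (i , ⊆comp (p⊆p∪q ⁅ v ⁆ (x∈⁅x⁆ u)) , ⊆comp (q⊆p∪q ⁅ u ⁆ ⁅ v ⁆ (x∈⁅x⁆ v)))

  open Separation covering (depth T) depth-head

  class-nonempty : ∀ i → ∃[ v ] v ∈ class i
  class-nonempty i with head-is-parent i
  ... | v , _ , v∈ , _ = v , v∈

  -- The root has no label, so it can only be the head of the component of the edge, and the label
  -- comes from the other end.
  edge-at-root : ∀ {v} → Edge G root v → (v≢root : v ≢ root) →
                 root ∈ component (label v v≢root) × v ∈ component (label v v≢root)
  edge-at-root e v≢root with covering e
  ... | i , r∈ , v∈ with ∈component⁻ r∈ | ∈component⁻ v∈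
  ...   | inj₁ r∈class | _           = contradiction (here r∈class) root-not-below
  ...   | inj₂ r≡h     | inj₂ v≡h    = contradiction (trans v≡h (sym r≡h)) v≢root
  ...   | inj₂ _       | inj₁ v∈class with ∈class⁻ v∈class
  ...     | _ , refl = r∈ , v∈

  edge-to-head : ∀ {u v} (u≢root : u ≢ root) → head (label u u≢root) ≡ v →
                 u ∈ component (label u u≢root) × v ∈ component (label u u≢root)
  edge-to-head u≢root refl = class⊆component (∈class⁺ u≢root refl) , head∈component

  -- If `v` were only the head of the component of the edge, `u` would carry its label, and `head`
  -- at the label of `u` would be `v`. So `v` carries the label, whether `u` is in the class or is
  -- the head.
  edge-elsewhere : ∀ {u v} (u≢root : u ≢ root) (v≢root : v ≢ root) → Edge G u v →
                   head (label u u≢root) ≢ v →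
                   u ∈ component (label v v≢root) × v ∈ component (label v v≢root)
  edge-elsewhere u≢root v≢root e h≢v with covering e
  ... | i , u∈ , v∈ with ∈component⁻ u∈ | ∈component⁻ v∈
  ...   | inj₂ refl | inj₂ refl = contradiction e (irreflexive G)
  ...   | inj₁ u∈class | inj₂ refl with ∈class⁻ u∈class
  ...     | _ , refl = contradiction refl h≢v
  edge-elsewhere u≢root v≢root e h≢v | i , u∈ , v∈ | _ | inj₁ v∈class with ∈class⁻ v∈class
  ...     | _ , refl = u∈ , v∈

  module _ {u v i} (e : Edge G u v) (u∈ : u ∈ component i) (v∈ : v ∈ component i) where

    private
      Rest : Fin n → Fin n → Set
      Rest a b = Edge G a b × ¬ (a ≡ u × b ≡ v) × ¬ (a ≡ v × b ≡ u)

      Rest-path : Fin n → Fin n → Set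
      Rest-path = Star (λ a b → a ∈ ⊤ × b ∈ ⊤ × Rest a b)

    -- Every edge out of the part below `i` goes from a vertex of `class i` to `head i`. With a
    -- one-element class the given edge is the only such edge, so without it the head is cut off.
    bridge : ∣ class i ∣ ≤ 1 → IsBridge G u v
    bridge ∣class∣≤1 rest-conn with ∈component⁻ u∈ | ∈component⁻ v∈
    ... | inj₂ refl | inj₂ refl = irreflexive G e
    ... | inj₁ u∈class | inj₁ v∈class = edge-≢ G e (∣p∣≤1⇒≡ ∣class∣≤1 u∈class v∈class)
    ... | inj₁ u∈class | inj₂ refl = head-not-below (go (here u∈class) (rest-conn ∈⊤ ∈⊤))
      where
      go : ∀ {x y} → Below i x → Rest-path x y → Below i y
      go b ε = b
      go b ((_ , _ , f , ¬uv , _) ◅ path) with below-step b f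
      ... | inj₁ b′           = go b′ path
      ... | inj₂ (refl , x∈) = contradiction (∣p∣≤1⇒≡ ∣class∣≤1 x∈ u∈class , refl) ¬uv
    ... | inj₂ refl | inj₁ v∈class = head-not-below (go (here v∈class) (rest-conn ∈⊤ ∈⊤))
      where
      go : ∀ {x y} → Below i x → Rest-path x y → Below i y
      go b ε = b
      go b ((_ , _ , f , _ , ¬vu) ◅ path) with below-step b f
      ... | inj₁ b′           = go b′ path
      ... | inj₂ (refl , x∈) = contradiction (∣p∣≤1⇒≡ ∣class∣≤1 x∈ v∈class , refl) ¬vu

    third-vertex : 1 < ∣ class i ∣ → ∃[ z ] z ∈ component i × z ≢ u × z ≢ v
    third-vertex 1<∣class∣ with ∈component⁻ u∈ | ∈component⁻ v∈
    ... | inj₂ refl | inj₂ refl = contradiction e (irreflexive G)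
    ... | inj₁ u∈class | inj₁ v∈class = head i , head∈component ,
          (λ { refl → head∉class u∈class }) , (λ { refl → head∉class v∈class })
    ... | inj₁ u∈class | inj₂ refl with 2≤∣p∣⇒∃≢ u∈class 1<∣class∣
    ...   | z , z∈ , z≢u = z , class⊆component z∈ , z≢u , λ { refl → head∉class z∈ }
    third-vertex 1<∣class∣ | inj₂ refl | inj₁ v∈class with 2≤∣p∣⇒∃≢ v∈class 1<∣class∣
    ...   | z , z∈ , z≢v = z , class⊆component z∈ , (λ { refl → head∉class z∈ }) , z≢v

    -- With a third vertex `z`, the edge is bypassed by going from `u` to `z` without `v` and from
    -- `z` to `v` without `u`.
    not-bridge : 1 < ∣ class i ∣ → ¬ IsBridge G u v
    not-bridge 1<∣class∣ is-bridge with third-vertex 1<∣class∣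
    ... | z , z∈ , z≢u , z≢v = is-bridge λ a∈ b∈ → (step ⋆) (conn a∈ b∈)
      where
      B = IsBiconnectedComponent.biconnected (component-sound i)

      avoiding : ∀ {x} → (x ≡ u ⊎ x ≡ v) → ∀ {a b} → Path G (component i - x) a b → Rest-path a b
      avoiding (inj₁ refl) = Star-map λ (a∈ , b∈ , f) → ∈⊤ , ∈⊤ , f ,
        (λ (a≡u , _) → x∈p-y⇒x≢y a∈ a≡u) , (λ (_ , b≡u) → x∈p-y⇒x≢y b∈ b≡u)
      avoiding (inj₂ refl) = Star-map λ (a∈ , b∈ , f) → ∈⊤ , ∈⊤ , f ,
        (λ (_ , b≡v) → x∈p-y⇒x≢y b∈ b≡v) , (λ (a≡v , _) → x∈p-y⇒x≢y a∈ a≡v)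

      u≢v = edge-≢ G e
      v≢u = edge-≢ G (symmetric G e)

      minus : ∀ x {a b} → a ∈ component i → a ≢ x → b ∈ component i → b ≢ x →
              Path G (component i - x) a b
      minus x a∈ a≢x b∈ b≢x =
        connected-minus′ G B x (x∈p∧x≢y⇒x∈p-y a∈ a≢x) (x∈p∧x≢y⇒x∈p-y b∈ b≢x)

      u⇝v : Rest-path u v
      u⇝v = avoiding (inj₂ refl) (minus v u∈ u≢v z∈ z≢v) ◅◅ avoiding (inj₁ refl) (minus u z∈ z≢u v∈ v≢u)

      v⇝u : Rest-path v u
      v⇝u = avoiding (inj₁ refl) (minus u v∈ v≢u z∈ z≢u) ◅◅ avoiding (inj₂ refl) (minus v z∈ z≢v u∈ u≢v)

      step : ∀ {a b} → a ∈ ⊤ × b ∈ ⊤ × Edge G a b → Rest-path a b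
      step {a} {b} (_ , _ , f) with (a ≟ u) ×-dec (b ≟ v) | (a ≟ v) ×-dec (b ≟ u)
      ... | yes (refl , refl) | _                 = u⇝v
      ... | no _              | yes (refl , refl) = v⇝u
      ... | no ¬uv            | no ¬vu            = (∈⊤ , ∈⊤ , f , ¬uv , ¬vu) ◅ ε

  -- A path that avoids `head i` and starts in the nonempty class `i` never leaves the part below
  -- `i`.
  separates : ∀ {i z} → z ≢ head i → ¬ Below i z → IsArticulationPoint G (head i)
  separates {i} z≢h z∉ conn-minus with class-nonempty i
  ... | t , t∈ = z∉ (below-path (here t∈)
    (conn-minus (x∈p∧x≢y⇒x∈p-y ∈⊤ λ { refl → head∉class t∈ }) (x∈p∧x≢y⇒x∈p-y ∈⊤ z≢h)))

  ∈headed⁺ : ∀ {i v} → head i ≡ v → i ∈ headed v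
  ∈headed⁺ {i} {v} h≡v = lookup⇒[]= i _
    (trans (lookup∘tabulate (λ i → does (head i ≟ v)) i) (dec-true (head i ≟ v) h≡v))

  ∈headed⁻ : ∀ {i v} → i ∈ headed v → head i ≡ v
  ∈headed⁻ {i} {v} i∈ with head i ≟ v | trans (sym (lookup∘tabulate (λ i → does (head i ≟ v)) i)) ([]=⇒lookup i∈)
  ... | yes h≡v | _ = h≡v

  articulation-nonroot : ∀ {v} → v ≢ root → 1 ≤ ∣ headed v ∣ → IsArticulationPoint G v
  articulation-nonroot {v} v≢root 1≤ with 1≤∣p∣⇒∃ (headed v) 1≤
  ... | i , i∈ with ∈headed⁻ i∈
  ...   | refl = separates (λ r≡v → v≢root (sym r≡v)) root-not-below

  -- Take `t` in the class of a second component `j` at the root: if `t` were below `i`, so would be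
  -- `head j`, which is the root.
  articulation-root : 2 ≤ ∣ headed root ∣ → IsArticulationPoint G root
  articulation-root 2≤ with 1≤∣p∣⇒∃ (headed root) (≤-trans (s≤s z≤n) 2≤)
  ... | i , i∈ with 2≤∣p∣⇒∃≢ i∈ 2≤ | ∈headed⁻ i∈
  ...   | j , j∈ , j≢i | hi≡root with class-nonempty j
  ...     | t , t∈ = subst (IsArticulationPoint G) hi≡root (separates
            (λ t≡hi → proj₁ (∈class⁻ t∈) (trans t≡hi hi≡root))
            λ b → [ (λ i≡j → j≢i (sym i≡j)) , (λ b′ → root-not-below (subst (Below i) (∈headed⁻ j∈) b′)) ]′
                    (below-pred b t∈))

  -- A path through v enters and leaves it inside the only component containing v.
  not-articulation : ∀ {v} → (∀ {i j} → v ∈ component i → v ∈ component j → i ≡ j) →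
                     ¬ IsArticulationPoint G v
  not-articulation {v} only art = art λ a∈ b∈ → detour a∈ b∈ (conn ∈⊤ ∈⊤)
    where
    around : ∀ {a c} → Edge G a v → Edge G v c → Path G (⊤ - v) a c
    around e f with covering e | covering f
    ... | i , a∈ , v∈ | j , v∈′ , c∈ with only v∈ v∈′
    ...   | refl = Path-mono G (-⁺ˡ λ _ → ∈⊤)
            (connected-minus′ G (IsBiconnectedComponent.biconnected (component-sound i)) v
              (x∈p∧x≢y⇒x∈p-y a∈ (edge-≢ G e))
              (x∈p∧x≢y⇒x∈p-y c∈ (edge-≢ G (symmetric G f))))

    detour : ∀ {a b} → a ∈ ⊤ - v → b ∈ ⊤ - v → Path G ⊤ a b → Path G (⊤ - v) a b
    detour a∈ b∈ ε = ε
    detour a∈ b∈ (_◅_ {j = c} (_ , _ , e) path) with c ≟ v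
    ... | no c≢v = (a∈ , c∈ , e) ◅ detour c∈ b∈ path
      where c∈ = x∈p∧x≢y⇒x∈p-y ∈⊤ c≢v
    detour a∈ b∈ (_ ◅ ε) | yes refl = contradiction refl (x∈p-y⇒x≢y b∈)
    detour a∈ b∈ ((_ , _ , e) ◅ (_ , _ , f) ◅ path) | yes refl =
      around e f ◅◅ detour (x∈p∧x≢y⇒x∈p-y ∈⊤ (edge-≢ G (symmetric G f))) b∈ path

  not-articulation-nonroot : ∀ {v} → v ≢ root → ∣ headed v ∣ < 1 → ¬ IsArticulationPoint G v
  not-articulation-nonroot {v} v≢root <1 = not-articulation λ v∈i v∈j → class-unique (own v∈i) (own v∈j)
    where
    own : ∀ {i} → v ∈ component i → v ∈ class i
    own v∈ with ∈component⁻ v∈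
    ... | inj₁ v∈class = v∈class
    ... | inj₂ v≡h     = contradiction (x∈p⇒1≤∣p∣ (∈headed⁺ (sym v≡h))) (<⇒≱ <1)

  -- The root belongs only to components that it heads, while any other vertex also belongs to the
  -- one of its label. This is why the thresholds are 2 and 1.
  not-articulation-root : ∣ headed root ∣ < 2 → ¬ IsArticulationPoint G root
  not-articulation-root <2 = not-articulation λ v∈i v∈j → ∣p∣≤1⇒≡ (s≤s⁻¹ <2) (own v∈i) (own v∈j)
    where
    own : ∀ {i} → root ∈ component i → i ∈ headed root
    own v∈ with ∈component⁻ v∈
    ... | inj₁ v∈class = contradiction (here v∈class) root-not-below
    ... | inj₂ v≡h     = ∈headed⁺ (sym v≡h)

-- Running loop-free programs

Post : Set₁
Post = (ℕ → ℕ) → (ℕ → ℕ) → ℕ → Set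

Holds Fails : Test → (ℕ → ℕ) → Set
Holds (lt r s) c = c r < c s
Holds (eq r s) c = c r ≡ c s
Fails (lt r s) c = c s ≤ c r
Fails (eq r s) c = c r ≢ c s

test-holds : ∀ b {c} m → evalTest b ⟨ c , m ⟩ ≡ true → Holds b c
test-holds (lt r s) m h = <ᵇ⇒< _ _ (subst T (sym h) tt)
test-holds (eq r s) m h = ≡ᵇ⇒≡ _ _ (subst T (sym h) tt)

test-fails : ∀ b {c} m → evalTest b ⟨ c , m ⟩ ≡ false → Fails b c
test-fails (lt r s) m h = ≮⇒≥ λ lt′ → subst T h (<⇒<ᵇ lt′)
test-fails (eq r s) m h = λ eq′ → subst T h (≡⇒≡ᵇ _ _ eq′)

-- The precondition ⊥ of a loop is never used: loops are run by while-terminates.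
wp : ℕ → Program → Post → Post
wp W skip          Q c m w = Q c m w
wp W (const r k)   Q c m w = k < W × Q (c [ r ]≔ k) m w
wp W (alu ⊙ r s t) Q c m w = evalOp ⊙ (c s) (c t) < W × Q (c [ r ]≔ evalOp ⊙ (c s) (c t)) m w
wp W (load r a)    Q c m w = Q (c [ r ]≔ m (c a)) m w
wp W (store a r)   Q c m w = Q c (m [ c a ]≔ c r) (suc w)
wp W (p ⨾ q)       Q c m w = wp W p (wp W q Q) c m w
wp W (cond b p q)  Q c m w = (Holds b c → wp W p Q c m w) × (Fails b c → wp W q Q c m w)
wp W (while b p)   Q c m w = ⊥

-- The value at a loop is a dummy: `wp` is empty there, so `wp-sound` never relies on it.
time : Program → ℕ
time skip         = 0
time (const _ _)  = 1
time (alu _ _ _ _) = 1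
time (load _ _)   = 1
time (store _ _)  = 1
time (p ⨾ q)      = time p + time q
time (cond _ p q) = suc (time p ⊔ time q)
time (while _ _)  = 0

-- Writes are threaded through as a running total that postconditions may mention; operations are
-- only bounded from above.
Terminates : ℕ → Program → ℕ → Post → Post
Terminates W p t Q c m w =
  ∃[ τ ] ∃[ t′ ] ∃[ w′ ] Run W p ⟨ c , m ⟩ τ t′ w′ × t′ ≤ t × Q (cache τ) (memory τ) (w + w′)

seq-terminates : ∀ {W p q t t′ Q c m w} → Terminates W p t (Terminates W q t′ Q) c m w →
                 Terminates W (p ⨾ q) (t + t′) Q c m w
seq-terminates {Q = Q} {w = w} (_ , _ , w₁ , run , t≤ , _ , _ , w₂ , run′ , t′≤ , post) =
  _ , _ , _ , run ⨾ run′ , +-mono-≤ t≤ t′≤ , subst (Q _ _) (+-assoc w w₁ w₂) post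

weaken : ∀ {W p t t′ Q R c m w} → t ≤ t′ → (∀ {c m w} → Q c m w → R c m w) →
         Terminates W p t Q c m w → Terminates W p t′ R c m w
weaken t≤ f (_ , _ , _ , run , s≤ , post) = _ , _ , _ , run , ≤-trans s≤ t≤ , f post

wp-sound : ∀ {W} p {Q c m w} → wp W p Q c m w → Terminates W p (time p) Q c m w
wp-sound skip {Q} {w = w} post = _ , _ , _ , skip , ≤-refl , subst (Q _ _) (+-comm 0 w) post
wp-sound (const r k) {Q} {w = w} (k< , post) = _ , _ , _ , const k< , ≤-refl , subst (Q _ _) (+-comm 0 w) post
wp-sound (alu ⊙ r s t) {Q} {w = w} (x< , post) = _ , _ , _ , alu x< , ≤-refl , subst (Q _ _) (+-comm 0 w) post
wp-sound (load r a) {Q} {w = w} post = _ , _ , _ , load , ≤-refl , subst (Q _ _) (+-comm 0 w) post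
wp-sound (store a r) {Q} {w = w} post = _ , _ , _ , store , ≤-refl , subst (Q _ _) (+-comm 1 w) post
wp-sound {W} (p ⨾ q) {Q} pre =
  seq-terminates {Q = Q} (weaken {Q = wp W q Q} ≤-refl (λ {c} {m} {w} → wp-sound q {Q} {c} {m} {w}) (wp-sound p pre))
wp-sound (cond b p q) {c = c} {m} (pre , pre′) with evalTest b ⟨ c , m ⟩ in h
... | true with wp-sound p (pre (test-holds b m h))
...   | _ , _ , _ , run , t≤ , post = _ , _ , _ , cond-true h run , s≤s (≤-trans t≤ (m≤m⊔n _ _)) , post
wp-sound (cond b p q) {c = c} {m} (pre , pre′) | false with wp-sound q (pre′ (test-fails b m h))
...   | _ , _ , _ , run , t≤ , post = _ , _ , _ , cond-false h run , s≤s (≤-trans t≤ (m≤n⊔m (time p) _)) , post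

wp-mono : ∀ {W} p {Q R : Post} {c m w} → (∀ {c m w} → Q c m w → R c m w) → wp W p Q c m w → wp W p R c m w
wp-mono skip          f post       = f post
wp-mono (const r k)   f (k< , post) = k< , f post
wp-mono (alu ⊙ r s t) f (x< , post) = x< , f post
wp-mono (load r a)    f post       = f post
wp-mono (store a r)   f post       = f post
wp-mono (p ⨾ q)       f pre        = wp-mono p (wp-mono q f) pre
wp-mono (cond b p q)  f (pre , pre′) = (λ h → wp-mono p f (pre h)) , (λ h → wp-mono q f (pre′ h))

-- Queries

label-of : Reg → Program
label-of r = alu add 9 5 r ⨾ load 0 9

-- Neither end is the root. If the head belonging to the label of the first end is the second end,
-- that label is the answer; otherwise the label of the second end is.
nonroot-component-program : Program
nonroot-component-program =
  alu add 9 5 0 ⨾ load 9 9 ⨾ alu add 9 6 9 ⨾ load 9 9 ⨾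
  cond (eq 9 1) (label-of 0) (label-of 1)

component-of-program : Program
component-of-program = cond (eq 0 2) (label-of 1) (cond (eq 1 2) (label-of 0) nonroot-component-program)

one-element-class : Program
one-element-class =
  alu add 9 7 0 ⨾ load 9 9 ⨾ const 10 1 ⨾ cond (lt 10 9) (const 0 0) (const 0 1)

bridge-program : Program
bridge-program = component-of-program ⨾ one-element-class

exceeds : ℕ → Program
exceeds k = const 10 k ⨾ cond (lt 10 9) (const 0 1) (const 0 0)

articulation-program : Program
articulation-program = alu add 9 8 0 ⨾ load 9 9 ⨾ cond (eq 0 2) (exceeds 1) (exceeds 0)

module Queries {n} {G : Graph n} (conn : Connected G) {T : RootedSpanningTree G} (L : BCLabeling G T)
               {W} (1<W : 1 < W) {c m} (stored : LabelingInMemory W L ⟨ c , m ⟩) where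
  open RootedSpanningTree T
  open BCLabeling L
  open LabelingInMemory stored
  open QueryFacts conn L
  open LabelProperties labels

  cell-at : ∀ {b x y z} → x ≡ y → Cell W m (b + y) z → Cell W m (b + x) z
  cell-at refl cell = cell

  toℕ-≡ : ∀ {x y} {u v : Fin n} → x ≡ toℕ u → y ≡ toℕ v → x ≡ y → u ≡ v
  toℕ-≡ x≡ y≡ x≡y = toℕ-injective (trans (sym x≡) (trans x≡y y≡))

  toℕ-≢ : ∀ {x y} {u v : Fin n} → x ≡ toℕ u → y ≡ toℕ v → x ≢ y → u ≢ v
  toℕ-≢ x≡ y≡ x≢y refl = x≢y (trans x≡ (sym y≡))

  0<W : 0 < W
  0<W = <-trans (n<1+n 0) 1<W

  -- `Q` is arbitrary, so that the program serves as a query and as the first half of the bridge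
  -- query. The latter still needs the base of the size array, hence the statement about register 7.
  component-of-wp : ∀ {Q w u v} → Edge G u v → c 0 ≡ toℕ u → c 1 ≡ toℕ v →
    (∀ {c′} i → c′ 7 ≡ c 7 → c′ 0 ≡ toℕ i → u ∈ component i → v ∈ component i → Q c′ m w) →
    wp W component-of-program Q c m w
  component-of-wp {Q} {w} {u} {v} e c0 c1 post =
    (λ c0≡c2 → at-u (toℕ-≡ c0 root-word c0≡c2)) ,
    (λ c0≢c2 →
      (λ c1≡c2 → at-v (toℕ-≡ c1 root-word c1≡c2)) ,
      (λ c1≢c2 → elsewhere (toℕ-≢ c0 root-word c0≢c2) (toℕ-≢ c1 root-word c1≢c2)))
    where
    at-u : u ≡ root → wp W (label-of 1) Q c m w
    at-u refl with cell-at c1 (label-array v v≢root)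
      where v≢root = edge-≢ G (symmetric G e)
    ... | fits , is with edge-at-root e (edge-≢ G (symmetric G e))
    ...   | u∈ , v∈ = fits , post _ refl is u∈ v∈

    at-v : v ≡ root → wp W (label-of 0) Q c m w
    at-v refl with cell-at c0 (label-array u (edge-≢ G e))
    ... | fits , is with edge-at-root (symmetric G e) (edge-≢ G e)
    ...   | v∈ , u∈ = fits , post _ refl is u∈ v∈

    elsewhere : u ≢ root → v ≢ root → wp W nonroot-component-program Q c m w
    elsewhere u≢root v≢root
      with cell-at c0 (label-array u u≢root) | cell-at c1 (label-array v v≢root)
    ... | fits , is | fits′ , is′ with cell-at is (head-array (label u u≢root))
    ...   | fits-head , is-head = fits , fits-head ,
            (λ h≡ → let u∈ , v∈ = edge-to-head u≢root (toℕ-≡ is-head c1 h≡)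
                    in fits , post _ refl is u∈ v∈) ,
            (λ h≢ → let u∈ , v∈ = edge-elsewhere u≢root v≢root e (toℕ-≢ is-head c1 h≢)
                    in fits′ , post _ refl is′ u∈ v∈)

  answers : Set → Post
  answers P c′ _ w = w ≡ 0 × IsAnswer P (c′ 0)

  bridge-wp : ∀ {u v} → Edge G u v → c 0 ≡ toℕ u → c 1 ≡ toℕ v →
              wp W bridge-program (answers (IsBridge G u v)) c m 0
  bridge-wp e c0 c1 = component-of-wp {wp W one-element-class (answers _)} e c0 c1 λ {c′} i c7 c0 u∈ v∈ →
    let fits , is = subst (λ b → Cell W m (b + c′ 0) ∣ class i ∣) (sym c7) (cell-at c0 (size-array i))
    in fits , 1<W ,
       (λ 1< → 0<W , refl , inj₂ (refl , not-bridge e u∈ v∈ (subst (1 <_) is 1<))) ,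
       (λ ≤1 → 1<W , refl , inj₁ (refl , bridge e u∈ v∈ (subst (_≤ 1) is ≤1)))

  articulation-wp : ∀ {v} → c 0 ≡ toℕ v → wp W articulation-program (answers (IsArticulationPoint G v)) c m 0
  articulation-wp {v} c0 with cell-at c0 (headed-array v)
  ... | fits , is = fits ,
    (λ c0≡c2 → at-root (toℕ-≡ c0 root-word c0≡c2)) ,
    (λ c0≢c2 → elsewhere (toℕ-≢ c0 root-word c0≢c2))
    where
    at-root : v ≡ root → wp W (exceeds 1) (answers (IsArticulationPoint G v)) (c [ 9 ]≔ (c 8 + c 0) [ 9 ]≔ m (c 8 + c 0)) m 0
    at-root refl = 1<W ,
      (λ 1< → 1<W , refl , inj₁ (refl , articulation-root (subst (1 <_) is 1<))) ,
      (λ ≤1 → 0<W , refl , inj₂ (refl , not-articulation-root (s≤s (subst (_≤ 1) is ≤1))))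

    elsewhere : v ≢ root → wp W (exceeds 0) (answers (IsArticulationPoint G v)) (c [ 9 ]≔ (c 8 + c 0) [ 9 ]≔ m (c 8 + c 0)) m 0
    elsewhere v≢root = 0<W ,
      (λ 0< → 1<W , refl , inj₁ (refl , articulation-nonroot v≢root (subst (0 <_) is 0<))) ,
      (λ ≤0 → 0<W , refl , inj₂ (refl , not-articulation-nonroot v≢root (s≤s (subst (_≤ 0) is ≤0))))

-- The invariant is indexed by an upper bound on the iterations left. Index 0 forces the test to
-- fail, and an earlier exit is allowed. The leading 1 pays for the failing test.
while-terminates : ∀ {W b p t Q} (I : ℕ → Post) →
  (∀ {c m w} → I 0 c m w → Fails b c) →
  (∀ {k c m w} → I (suc k) c m w → Holds b c → Terminates W p t (I k) c m w) →
  (∀ {k c m w} → I k c m w → Fails b c → Q c m w) →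
  ∀ k {c m w} → I k c m w → Terminates W (while b p) (1 + k * suc t) Q c m w
while-terminates {W} {b} {p} {t} {Q} I last step stop = go
  where
  done : ∀ k {c m w t} → I k c m w → evalTest b ⟨ c , m ⟩ ≡ false → Terminates W (while b p) (1 + t) Q c m w
  done k {m = m} {w} inv h = _ , _ , _ , while-false h , m≤m+n 1 _ ,
    subst (Q _ _) (+-comm 0 w) (stop inv (test-fails b m h))

  go : ∀ k {c m w} → I k c m w → Terminates W (while b p) (1 + k * suc t) Q c m w
  go k {c} {m} inv with evalTest b ⟨ c , m ⟩ in h
  go k inv | false = done k inv h
  go zero {m = m} inv | true = contradiction (test-holds b m h) (fails⇒¬holds b (last inv))
    where
    fails⇒¬holds : ∀ b {c} → Fails b c → ¬ Holds b c
    fails⇒¬holds (lt r s) ≥′ <′ = <⇒≱ <′ ≥′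
    fails⇒¬holds (eq r s) ≢′ ≡′ = ≢′ ≡′
  go (suc k) {m = m} {w} inv | true with step inv (test-holds b m h)
  ... | _ , _ , w₁ , run , t≤ , inv′ with go k inv′
  ...   | _ , _ , w₂ , runs , ts≤ , post =
    _ , _ , _ , while-true h run runs , s≤s (≤-trans (+-mono-≤ t≤ ts≤) (≤-reflexive (+-suc t _))) ,
    subst (Q _ _) (+-assoc w w₁ w₂) post

≔-same : ∀ (f : ℕ → ℕ) {i j} x → i ≡ j → (f [ j ]≔ x) i ≡ x
≔-same f {i} x refl with i ≡ᵇ i in h
... | true  = refl
... | false = contradiction (≡⇒≡ᵇ i i refl) (subst T h)

≔-other : ∀ (f : ℕ → ℕ) {i j} x → i ≢ j → (f [ j ]≔ x) i ≡ f i
≔-other f {i} {j} x i≢j with i ≡ᵇ j in h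
... | true  = contradiction (≡ᵇ⇒≡ i j (subst T (sym h) tt)) i≢j
... | false = refl

-- Code over nine arrays indexed by vertices

Array : Set
Array = Fin 9

-- The first five are those of the stored labeling, in its order.
parentA labelA headA sizeA headedA numA orderA lowA savedA : Array
parentA = # 0
labelA  = # 1
headA   = # 2
sizeA   = # 3
headedA = # 4
numA    = # 5
orderA  = # 6
lowA    = # 7
savedA  = # 8

Var : Set
Var = ℕ

infixr 5 _⨟_

-- Loop-free code that names arrays and vertices instead of addresses, so that the algorithmic
-- proofs contain no address arithmetic. Loops are put around its compiled form.
data Code : Set where
  nop   : Code
  set   : Var → ℕ → Code
  op    : Op → Var → Var → Var → Code
  get   : Var → Array → Var → Code
  put   : Array → Var → Var → Code
  input : Var → Var → Code
  _⨟_   : Code → Code → Code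
  if    : Test → Code → Code → Code

-- Registers 0 to 3 are those of the query interface, 4 to 12 hold the addresses
-- of the arrays, and 13 is scratch.
var : Var → Reg
var x = 14 + x

var-test : Test → Test
var-test (lt x y) = lt (var x) (var y)
var-test (eq x y) = eq (var x) (var y)

compile : Code → Program
compile nop          = skip
compile (set x k)    = const (var x) k
compile (op ⊙ x y z) = alu ⊙ (var x) (var y) (var z)
compile (get x a y)  = alu add 13 (4 + toℕ a) (var y) ⨾ load (var x) 13
compile (put a y x)  = alu add 13 (4 + toℕ a) (var y) ⨾ store 13 (var x)
compile (input x y)  = load (var x) (var y)
compile (p ⨟ q)      = compile p ⨾ compile q
compile (if b p q)   = cond (var-test b) (compile p) (compile q)

-- The arrays start at address B; below it, the memory agrees with μ₀.
module Machine (W n B : ℕ) (μ₀ : ℕ → ℕ) (fits : B + 9 * n ≤ W) where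

  Arrays : Set
  Arrays = Array → Fin n → ℕ

  base : Array → ℕ
  base a = B + n * toℕ a

  address : Array → Fin n → ℕ
  address a v = base a + toℕ v

  write : Arrays → Array → Fin n → ℕ → Arrays
  write A a v x = updateAt A a λ row → updateAt row v (λ _ → x)

  -- `combine` numbers the pairs of array and vertex without gaps, so the range and the injectivity
  -- of addresses follow from its properties.
  address-combine : ∀ a v → address a v ≡ B + toℕ (combine a v)
  address-combine a v = trans (+-assoc B _ _) (cong (B +_) (sym (toℕ-combine a v)))

  address<W : ∀ a v → address a v < W
  address<W a v = ≤-trans (≤-reflexive (cong suc (address-combine a v)))
    (<-≤-trans (+-monoʳ-< B (toℕ<n (combine a v))) fits)

  B≤address : ∀ a v → B ≤ address a v
  B≤address a v = ≤-trans (m≤m+n B _) (m≤m+n (base a) _)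

  address-injective : ∀ a b u v → address a u ≡ address b v → a ≡ b × u ≡ v
  address-injective a b u v same = combine-injective a u b v (toℕ-injective (+-cancelˡ-≡ B _ _
    (trans (sym (address-combine a u)) (trans same (address-combine b v)))))

  record Represents (c m : ℕ → ℕ) (ρ : Var → ℕ) (A : Arrays) : Set where
    field
      vars   : ∀ x → c (var x) ≡ ρ x
      bases  : ∀ a → c (4 + toℕ a) ≡ base a
      inputs : ∀ x → x < B → m x ≡ μ₀ x
      arrays : ∀ a v → m (address a v) ≡ A a v
  open Represents

  APost : Set₁
  APost = (Var → ℕ) → Arrays → ℕ → Set

  -- An array access must exhibit the vertex that the index register holds. Input is read only below
  -- `B`, where no `put` can reach, so `μ₀` stays valid throughout.
  wpᶜ : Code → APost → APost
  wpᶜ nop          Q ρ A w = Q ρ A w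
  wpᶜ (set x k)    Q ρ A w = k < W × Q (ρ [ x ]≔ k) A w
  wpᶜ (op ⊙ x y z) Q ρ A w = evalOp ⊙ (ρ y) (ρ z) < W × Q (ρ [ x ]≔ evalOp ⊙ (ρ y) (ρ z)) A w
  wpᶜ (get x a y)  Q ρ A w = Σ[ v ∈ Fin n ] ρ y ≡ toℕ v × Q (ρ [ x ]≔ A a v) A w
  wpᶜ (put a y x)  Q ρ A w = Σ[ v ∈ Fin n ] ρ y ≡ toℕ v × Q ρ (write A a v (ρ x)) (suc w)
  wpᶜ (input x y)  Q ρ A w = ρ y < B × Q (ρ [ x ]≔ μ₀ (ρ y)) A w
  wpᶜ (p ⨟ q)      Q ρ A w = wpᶜ p (wpᶜ q Q) ρ A w
  wpᶜ (if b p q)   Q ρ A w = (Holds b ρ → wpᶜ p Q ρ A w) × (Fails b ρ → wpᶜ q Q ρ A w)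

  Concrete : APost → Post
  Concrete Q c m w = ∃₂ λ ρ A → Represents c m ρ A × Q ρ A w

  private
    -- The comparison of register `4 + toℕ a` with register `13 + x` reduces to this one: scratch
    -- and variables never overlap the nine bases.
    base-register : ∀ (a : Array) x → (toℕ a ≡ᵇ 9 + x) ≡ false
    base-register a x = ¬-not λ h →
      <⇒≢ (<-≤-trans (toℕ<n a) (m≤m+n 9 x)) (≡ᵇ⇒≡ _ _ (subst T (sym h) tt))

    write-var : ∀ {c m ρ A} x {y z} → y ≡ z → Represents c m ρ A →
                Represents (c [ var x ]≔ y) m (ρ [ x ]≔ z) A
    write-var {c} {ρ = ρ} x {y} refl R = record
      { vars   = λ x′ → cong (if x′ ≡ᵇ x then y else_) (vars R x′)
      ; bases  = λ a → trans (cong (if_then y else c (4 + toℕ a)) (base-register a (1 + x))) (bases R a)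
      ; inputs = inputs R
      ; arrays = arrays R
      }

    write-tmp : ∀ {c m ρ A} x → Represents c m ρ A → Represents (c [ 13 ]≔ x) m ρ A
    write-tmp {c} x R = record
      { vars   = vars R
      ; bases  = λ a → trans (cong (if_then x else c (4 + toℕ a)) (base-register a 0)) (bases R a)
      ; inputs = inputs R
      ; arrays = arrays R
      }

    write-array : ∀ {c m ρ A} a v {x y} → x ≡ y → Represents c m ρ A →
                  Represents c (m [ address a v ]≔ x) ρ (write A a v y)
    write-array {m = m} {A = A} a v {x} refl R = record
      { vars   = vars R
      ; bases  = bases R
      ; inputs = λ i i<B → trans (≔-other m x (<⇒≢ (<-≤-trans i<B (B≤address a v)))) (inputs R i i<B)
      ; arrays = cell
      }
      where
      cell : ∀ a′ v′ → (m [ address a v ]≔ x) (address a′ v′) ≡ write A a v x a′ v′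
      cell a′ v′ with a′ ≟ a
      ... | no a′≢a = trans (≔-other m x (λ same → a′≢a (proj₁ (address-injective a′ a v′ v same))))
                        (trans (arrays R a′ v′) (cong-app (sym (updateAt-minimal a′ a A a′≢a)) v′))
      ... | yes refl with v′ ≟ v
      ...   | no v′≢v = trans (≔-other m x (λ same → v′≢v (proj₂ (address-injective a a v′ v same))))
                        (trans (arrays R a v′) (trans (sym (updateAt-minimal v′ v (A a) v′≢v))
                          (cong-app (sym (updateAt-updates a A)) v′)))
      ...   | yes refl = trans (≔-same m x refl) (trans (sym (updateAt-updates v (A a)))
                          (cong-app (sym (updateAt-updates a A)) v))

    holds : ∀ b {c m ρ A} → Represents c m ρ A → Holds (var-test b) c → Holds b ρ
    holds (lt x y) R = subst₂ _<_ (vars R x) (vars R y)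
    holds (eq x y) R = subst₂ _≡_ (vars R x) (vars R y)

    fails : ∀ b {c m ρ A} → Represents c m ρ A → Fails (var-test b) c → Fails b ρ
    fails (lt x y) R = subst₂ _≤_ (vars R y) (vars R x)
    fails (eq x y) R = subst₂ _≢_ (vars R x) (vars R y)

    fails⁻¹ : ∀ b {c m ρ A} → Represents c m ρ A → Fails b ρ → Fails (var-test b) c
    fails⁻¹ (lt x y) R = subst₂ _≤_ (sym (vars R y)) (sym (vars R x))
    fails⁻¹ (eq x y) R = subst₂ _≢_ (sym (vars R x)) (sym (vars R y))

    array-address : ∀ {c m ρ A} a y {v} → Represents c m ρ A → ρ y ≡ toℕ v →
                    c (4 + toℕ a) + c (var y) ≡ address a v
    array-address a y R ≡v = cong₂ _+_ (bases R a) (trans (vars R y) ≡v)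

  wp-compile : ∀ p {Q c m w ρ A} → Represents c m ρ A → wpᶜ p Q ρ A w → wp W (compile p) (Concrete Q) c m w
  wp-compile nop R post = _ , _ , R , post
  wp-compile (set x k) R (k< , post) = k< , _ , _ , write-var x refl R , post
  wp-compile (op ⊙ x y z) R (fit , post) =
    subst (_< W) (sym same) fit , _ , _ , write-var x same R , post
    where same = cong₂ (evalOp ⊙) (vars R y) (vars R z)
  wp-compile (get x a y) {m = m} R (v , y≡v , post) =
    subst (_< W) (sym at) (address<W a v) , _ , _ ,
    write-var x (trans (cong m at) (arrays R a v)) (write-tmp _ R) , post
    where at = array-address a y R y≡v
  wp-compile (put a y x) {Q} {c} {m} {w} {ρ} {A} R (v , y≡v , post) =
    subst (_< W) (sym at) (address<W a v) , _ , _ ,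
    write-tmp _ (subst (λ i → Represents c (m [ i ]≔ c (var x)) ρ (write A a v (ρ x))) (sym at)
      (write-array a v (vars R x) R)) , post
    where at = array-address a y R y≡v
  wp-compile (input x y) {m = m} {ρ = ρ} R (y<B , post) =
    _ , _ , write-var x (trans (cong m (vars R y)) (inputs R (ρ y) y<B)) R , post
  wp-compile (p ⨟ q) {Q} {c} {m} {w} R pre =
    wp-mono (compile p) (λ (_ , _ , R′ , pre′) → wp-compile q R′ pre′) (wp-compile p R pre)
  wp-compile (if b p q) R (pre , pre′) =
    (λ h → wp-compile p R (pre (holds b R h))) , (λ h → wp-compile q R (pre′ (fails b R h)))

  code-terminates : ∀ p {Q c m w ρ A} → Represents c m ρ A → wpᶜ p Q ρ A w →
                    Terminates W (compile p) (time (compile p)) (Concrete Q) c m w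
  code-terminates p R pre = wp-sound (compile p) (wp-compile p R pre)

  loop-terminates : ∀ {b p Q} (I : ℕ → APost) →
    (∀ {ρ A w} → I 0 ρ A w → Fails b ρ) →
    (∀ {k ρ A w} → I (suc k) ρ A w → Holds b ρ → wpᶜ p (I k) ρ A w) →
    (∀ {k ρ A w} → I k ρ A w → Fails b ρ → Q ρ A w) →
    ∀ k {c m w ρ A} → Represents c m ρ A → I k ρ A w →
    Terminates W (while (var-test b) (compile p)) (1 + k * suc (time (compile p))) (Concrete Q) c m w
  loop-terminates {b} {p} {Q} I last step stop k R inv = while-terminates {Q = Concrete Q} (λ k → Concrete (I k))
    (λ (_ , _ , R , inv) → fails⁻¹ b R (last inv))
    (λ (_ , _ , R , inv) h → code-terminates p R (step inv (holds b R h)))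
    (λ (_ , _ , R , inv) h → _ , _ , R , stop inv (fails b R h))
    k (_ , _ , R , inv)

-- Sums and cardinalities

sum-suc-at : ∀ {n} (f g : Fin n → ℕ) c → f c ≡ suc (g c) → (∀ u → u ≢ c → f u ≡ g u) →
             sum f ≡ suc (sum g)
sum-suc-at f g zero    at others = cong₂ _+_ at (sum-cong-≗ λ u → others (suc u) λ ())
sum-suc-at f g (suc c) at others = trans
  (cong₂ _+_ (others zero λ ()) (sum-suc-at (f ∘ suc) (g ∘ suc) c at λ u u≢c → others (suc u) (u≢c ∘ sucᶠ-injective)))
  (+-suc (g zero) _)

sum-zero : ∀ n → sum {n} (λ _ → 0) ≡ 0
sum-zero zero    = refl
sum-zero (suc n) = sum-zero n

sum-suc : ∀ {n} (f : Fin n → ℕ) → sum (λ v → suc (f v)) ≡ n + sum f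
sum-suc {zero}  f = refl
sum-suc {suc n} f = cong suc (begin
  f zero + sum (λ v → suc (f (suc v))) ≡⟨ cong (f zero +_) (sum-suc (f ∘ suc)) ⟩
  f zero + (n + sum (f ∘ suc))         ≡⟨ +-assoc (f zero) n _ ⟨
  f zero + n + sum (f ∘ suc)           ≡⟨ cong (_+ sum (f ∘ suc)) (+-comm (f zero) n) ⟩
  n + f zero + sum (f ∘ suc)           ≡⟨ +-assoc n (f zero) _ ⟩
  n + (f zero + sum (f ∘ suc))         ∎)
  where open ≡-Reasoning

n≤sum : ∀ {n} (f : Fin n → ℕ) → (∀ v → 1 ≤ f v) → n ≤ sum f
n≤sum {zero}  f 1≤f = z≤n
n≤sum {suc n} f 1≤f = +-mono-≤ (1≤f zero) (n≤sum (f ∘ suc) (1≤f ∘ suc))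

-- The offsets telescope. `o` is defined on all naturals so that the induction can pass to
-- `o ∘ suc`.
partial-sums : ∀ {n} (o : ℕ → ℕ) (d : Fin n → ℕ) → (∀ v → o (suc (toℕ v)) ≡ o (toℕ v) + d v) →
               o n ≡ o 0 + sum d
partial-sums {zero}  o d step = sym (+-identityʳ (o 0))
partial-sums {suc n} o d step = trans (partial-sums (o ∘ suc) (d ∘ suc) (step ∘ suc))
  (trans (cong (_+ sum (d ∘ suc)) (step zero)) (+-assoc (o 0) (d zero) _))

partial-sums-mono : ∀ {n} (o : ℕ → ℕ) (d : Fin n → ℕ) → (∀ v → o (suc (toℕ v)) ≡ o (toℕ v) + d v) →
                    ∀ v → o (toℕ v) + d v ≤ o n
partial-sums-mono {suc n} o d step zero = subst (_≤ o (suc n)) (step zero)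
  (≤-trans (m≤m+n (o 1) _) (≤-reflexive (sym (partial-sums (o ∘ suc) (d ∘ suc) (step ∘ suc)))))
partial-sums-mono o d step (suc v) = partial-sums-mono (o ∘ suc) (d ∘ suc) (step ∘ suc) v

count : ∀ {n} → (Fin n → Bool) → ℕ
count f = ∣ Vec-tabulate f ∣

count-cong : ∀ {n} {f g : Fin n → Bool} → (∀ u → f u ≡ g u) → count f ≡ count g
count-cong f≗g = cong ∣_∣ (Vec-tabulate-cong f≗g)

count-suc-at : ∀ {n} (f g : Fin n → Bool) c → f c ≡ true → g c ≡ false → (∀ u → u ≢ c → f u ≡ g u) →
               count f ≡ suc (count g)
count-suc-at f g zero fc gc others rewrite fc | gc = cong suc (count-cong λ u → others (suc u) λ ())
count-suc-at f g (suc c) fc gc others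
  with f zero | g zero | others zero (λ ())
     | count-suc-at (f ∘ suc) (g ∘ suc) c fc gc (λ u u≢c → others (suc u) (u≢c ∘ sucᶠ-injective))
... | true  | _ | refl | ih = cong suc ih
... | false | _ | refl | ih = ih

count-false : ∀ {n} (f : Fin n → Bool) → (∀ u → f u ≡ false) → count f ≡ 0
count-false {zero}  f none = refl
count-false {suc n} f none rewrite none zero = count-false (f ∘ suc) (none ∘ suc)

-- Compares counts over all `n` cells of an array with counts over the labels, of which there may be
-- fewer.
count-prefix : ∀ {k n} (k≤n : k ≤ n) (f : Fin n → Bool) (g : Fin k → Bool) →
               (∀ i → g i ≡ f (inject≤ i k≤n)) → (∀ j → k ≤ toℕ j → f j ≡ false) → count f ≡ count g
count-prefix {zero} k≤n f g same rest = count-false f λ u → rest u z≤n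
count-prefix {suc k} {suc n} k≤n f g same rest
  with f zero | g zero | same zero
     | count-prefix (s≤s⁻¹ k≤n) (f ∘ suc) (g ∘ suc) (same ∘ suc) (λ j k≤j → rest (suc j) (s≤s k≤j))
... | true  | _ | refl | ih = cong suc ih
... | false | _ | refl | ih = ih

indicator : ∀ {P : Set} → Dec P → ℕ
indicator d = if does d then 1 else 0

indicator-cong : ∀ {P Q : Set} (d : Dec P) (e : Dec Q) → (P → Q) → (Q → P) → indicator d ≡ indicator e
indicator-cong (yes p) e to from = cong (if_then 1 else 0) (sym (dec-true e (to p)))
indicator-cong (no ¬p) e to from = cong (if_then 1 else 0) (sym (dec-false e (¬p ∘ from)))

module _ {n : ℕ} where
  open import Data.List.Membership.DecPropositional (_≟_ {n}) using () renaming (_∈?_ to _∈ᴸ?_)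

  -- Turns a length into a sum over all vertices, so that double counting becomes an exchange of
  -- sums.
  length-unique : ∀ {xs} → Unique xs → length xs ≡ sum (λ w → indicator (w ∈ᴸ? xs))
  length-unique {[]} [] = sym (sum-zero n)
  length-unique {x ∷ xs} (x∉ ∷ unique) = sym (trans
    (sum-suc-at _ (λ w → indicator (w ∈ᴸ? xs)) x
      (trans (cong (if_then 1 else 0) (dec-true (x ∈ᴸ? (x ∷ xs)) (here refl)))
        (cong suc (sym (cong (if_then 1 else 0) (dec-false (x ∈ᴸ? xs) λ x∈ → All-lookup x∉ x∈ refl)))))
      λ u u≢x → indicator-cong (u ∈ᴸ? (x ∷ xs)) (u ∈ᴸ? xs)
        (λ { (here u≡x) → contradiction u≡x u≢x ; (there u∈) → u∈ }) there)
    (cong suc (sym (length-unique unique))))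

length-filter-split : ∀ {A : Set} {P Q : Pred A 0ℓ} (P? : Decidable P) (Q? : Decidable Q) {xs} →
  All (λ x → (P x × ¬ Q x) ⊎ (¬ P x × Q x)) xs →
  length xs ≡ length (filter P? xs) + length (filter Q? xs)
length-filter-split P? Q? [] = refl
length-filter-split P? Q? {x ∷ xs} (split ∷ splits) with P? x | Q? x | split | length-filter-split P? Q? splits
... | yes _ | no _  | _ | ih = cong suc ih
... | no _  | yes _ | _ | ih = trans (cong suc ih) (sym (+-suc _ _))
... | yes _ | yes q | inj₁ (_ , ¬q) | _ = contradiction q ¬q
... | yes p | yes _ | inj₂ (¬p , _) | _ = contradiction p ¬p
... | no ¬p | no _  | inj₁ (p , _)  | _ = contradiction p ¬p
... | no _  | no ¬q | inj₂ (_ , q)  | _ = contradiction q ¬q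

sum-allFin : ∀ {n} (f : Fin n → ℕ) → List-sum (map f (allFin n)) ≡ sum f
sum-allFin f = trans (cong List-sum (map-tabulate (λ i → i) f)) (go f)
  where
  go : ∀ {n} (f : Fin n → ℕ) → List-sum (List-tabulate f) ≡ sum f
  go {zero}  f = refl
  go {suc n} f = cong (f zero +_) (go (f ∘ suc))

module _ {n} (G : Graph n) where
  open import Data.List.Membership.DecPropositional (_≟_ {n}) using () renaming (_∈?_ to _∈ᴸ?_)

  private
    larger smaller : Fin n → List (Fin n)
    larger u  = filter (u <ᶠ?_) (adj G u)
    smaller u = filter (_<ᶠ? u) (adj G u)

    -- Both sides count the adjacent pairs with the first vertex smaller, once from each end;
    -- symmetry of adjacency matches the two counts.
    larger≡smaller : sum (length ∘ larger) ≡ sum (length ∘ smaller)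
    larger≡smaller = begin
      sum (length ∘ larger)
        ≡⟨ sum-cong-≗ (λ u → length-unique (filter⁺ (u <ᶠ?_) (unique G u))) ⟩
      sum (λ u → sum λ w → indicator (w ∈ᴸ? larger u))
        ≡⟨ sum-cong-≗ (λ u → sum-cong-≗ λ w → indicator-cong (w ∈ᴸ? larger u) (u ∈ᴸ? smaller w)
             (λ w∈ → let e , u<w = ∈-filter⁻ (u <ᶠ?_) w∈ in ∈-filter⁺ (_<ᶠ? w) (symmetric G e) u<w)
             (λ u∈ → let e , u<w = ∈-filter⁻ (_<ᶠ? w) u∈ in ∈-filter⁺ (u <ᶠ?_) (symmetric G e) u<w)) ⟩
      sum (λ u → sum λ w → indicator (u ∈ᴸ? smaller w))
        ≡⟨ ∑-comm (λ u w → indicator (u ∈ᴸ? smaller w)) ⟩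
      sum (λ w → sum λ u → indicator (u ∈ᴸ? smaller w))
        ≡⟨ sum-cong-≗ (λ w → sym (length-unique (filter⁺ (_<ᶠ? w) (unique G w)))) ⟩
      sum (length ∘ smaller) ∎
      where open ≡-Reasoning

  handshake : sum (degree G) ≡ #edges G + #edges G
  handshake = begin
    sum (degree G)
      ≡⟨ sum-cong-≗ (λ u → length-filter-split (u <ᶠ?_) (_<ᶠ? u) (All-tabulate (split u))) ⟩
    sum (λ u → length (larger u) + length (smaller u))
      ≡⟨ ∑-distrib-+ (length ∘ larger) (length ∘ smaller) ⟩
    sum (length ∘ larger) + sum (length ∘ smaller)
      ≡⟨ cong (sum (length ∘ larger) +_) (sym larger≡smaller) ⟩
    sum (length ∘ larger) + sum (length ∘ larger)
      ≡⟨ cong₂ _+_ (sym (sum-allFin (length ∘ larger))) (sym (sum-allFin (length ∘ larger))) ⟩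
    #edges G + #edges G ∎
    where
    open ≡-Reasoning
    split : ∀ u {w} → w ∈ᴸ adj G u → (toℕ u < toℕ w × ¬ toℕ w < toℕ u) ⊎ (¬ toℕ u < toℕ w × toℕ w < toℕ u)
    split u {w} e with <-cmp u w
    ... | tri< u<w _ w≮u = inj₁ (u<w , w≮u)
    ... | tri≈ _ refl _  = contradiction e (irreflexive G)
    ... | tri> u≮w _ w<u = inj₂ (u≮w , w<u)

  1≤degree : Connected G → ∀ {u v} → u ≢ v → 1 ≤ degree G u
  1≤degree conn {u} {v} u≢v with conn {u} {v} ∈⊤ ∈⊤
  ... | ε               = contradiction refl u≢v
  ... | (_ , _ , e) ◅ _ = ∈-length e

-- With at least two vertices, connectivity makes every degree positive, so `n` is at most the
-- degree sum. The maximum with 1 accounts for the one-vertex graph.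
vertices≤ : ∀ {n} (G : Graph n) → Connected G → n ≤ 2 * (#edges G ⊔ 1)
vertices≤ {0} G conn = z≤n
vertices≤ {1} G conn = ≤-trans (m≤n⊔m (#edges G) 1) (m≤m+n _ _)
vertices≤ {suc (suc n)} G conn = ≤-trans (n≤sum (degree G) λ { zero → 1≤degree G conn {v = suc zero} (λ ())
                                                        ; (suc v) → 1≤degree G conn {v = zero} (λ ()) })
  (≤-trans (≤-reflexive (handshake G))
    (+-mono-≤ (m≤m⊔n (#edges G) 1) (≤-trans (m≤m⊔n (#edges G) 1) (m≤m+n _ _))))

-- Low points

-- The side condition stops the chain at the root, so that `par` may be a total function.
data Ancestor {n} (root : Fin n) (par : Fin n → Fin n) (a : Fin n) : Fin n → Set where
  self : Ancestor root par a a
  up   : ∀ {v} → v ≢ root → Ancestor root par a (par v) → Ancestor root par a v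

record DFSTree {n} (G : Graph n) : Set where
  field
    root       : Fin n
    par        : Fin n → Fin n
    num        : Fin n → ℕ
    num-root   : num root ≡ 0
    par-edge   : ∀ {v} → v ≢ root → Edge G v (par v)
    num-par    : ∀ {v} → v ≢ root → num (par v) < num v
    comparable : ∀ {u v} → Edge G u v → Ancestor root par u v ⊎ Ancestor root par v u

  tree : RootedSpanningTree G
  tree = record
    { root        = root
    ; parent      = λ v _ → par v
    ; parent-edge = λ v v≢root → par-edge v≢root
    ; to-root     = λ v → go v (<-wellFounded (num v))
    }
    where
    go : ∀ v → Acc _<_ (num v) → Star (λ a b → Σ[ _ ∈ a ≢ root ] par a ≡ b) v root
    go v (acc rec) with v ≟ root
    ... | yes refl   = ε
    ... | no  v≢root = (v≢root , refl) ◅ go (par v) (rec (num-par v≢root))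

  ancestor-num : ∀ {a v} → Ancestor root par a v → num a ≤ num v
  ancestor-num self          = ≤-refl
  ancestor-num (up v≢root p) = ≤-trans (ancestor-num p) (<⇒≤ (num-par v≢root))

-- Together, `low-edge` and `low-par` bound `low u` by every number adjacent to the subtree of `u`.
-- The hypothesis of `low-attained` excludes the default value, which exceeds all numbers.
record LowPoints {n} {G : Graph n} (D : DFSTree G) : Set where
  open DFSTree D
  field
    low          : Fin n → ℕ
    low-edge     : ∀ {u v} → Edge G u v → low u ≤ num v
    low-par      : ∀ {v} → v ≢ root → low (par v) ≤ low v
    low-attained : ∀ {u v} → low u < num v →
                   ∃₂ λ d a → Ancestor root par u d × Edge G d a × num a ≡ low u

module LowPointLabeling {n} {G : Graph n} (D : DFSTree G) (P : LowPoints D) (L : Labels (DFSTree.tree D)) where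
  open DFSTree D
  open LowPoints P
  open Labels L
  open LabelProperties L

  -- A class is grown from a single top, a vertex with `num (par v) ≤ low v`, by adding children
  -- that reach above their parent; its head is the parent of the top. These hypotheses say just
  -- that, without fixing how labels are computed.
  module _
    (joined : ∀ {v} (v≢root : v ≢ root) (p≢root : par v ≢ root) → low v < num (par v) →
              label v v≢root ≡ label (par v) p≢root)
    (topped : ∀ {v} (v≢root : v ≢ root) → num (par v) ≤ low v → head (label v v≢root) ≡ par v)
    (tops : ∀ i → ∃[ v ] Σ[ v≢root ∈ v ≢ root ] label v v≢root ≡ i × num (par v) ≤ low v)
    (top-unique : ∀ {u v} (u≢root : u ≢ root) (v≢root : v ≢ root) →
                  num (par u) ≤ low u → num (par v) ≤ low v →
                  label u u≢root ≡ label v v≢root → u ≡ v)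
    where

    joined-up : ∀ {i v} → v ∈ class i → low v < num (par v) → par v ∈ class i
    joined-up {v = v} v∈ lt′ with ∈class⁻ v∈
    ... | v≢root , refl = ∈class⁺ p≢root (sym (joined v≢root p≢root lt′))
      where
      -- The root has number 0, and no low point is below that.
      p≢root : par v ≢ root
      p≢root p≡root = n≮0 (subst (low v <_) (trans (cong num p≡root) num-root) lt′)

    joined-down : ∀ {i v} → v ≢ root → par v ∈ class i → low v < num (par v) → v ∈ class i
    joined-down v≢root p∈ lt′ with ∈class⁻ p∈
    ... | p≢root , refl = ∈class⁺ v≢root (joined v≢root p≢root lt′)

    class-parent : ∀ {i v} → v ∈ class i → (par v ∈ class i × low v < num (par v)) ⊎ (par v ≡ head i × num (par v) ≤ low v)
    class-parent {v = v} v∈ with low v <? num (par v)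
    ... | yes lt′ = inj₁ (joined-up v∈ lt′ , lt′)
    ... | no ≮ with ∈class⁻ v∈
    ...   | v≢root , refl = inj₂ (sym (topped v≢root (≮⇒≥ ≮)) , ≮⇒≥ ≮)

    num-par′ : ∀ {i v} → v ∈ class i → num (par v) < num v
    num-par′ v∈ = num-par (proj₁ (∈class⁻ v∈))

    par-edge′ : ∀ {i v} → v ∈ class i → Edge G v (par v)
    par-edge′ v∈ = par-edge (proj₁ (∈class⁻ v∈))

    num-head : ∀ {i v} → v ∈ class i → num (head i) < num v
    num-head {i} = go (<-wellFounded _)
      where
      go : ∀ {v} → Acc _<_ (num v) → v ∈ class i → num (head i) < num v
      go {v} (acc rec) v∈ with class-parent v∈
      ... | inj₁ (p∈ , _)  = <-trans (go (rec (num-par′ v∈)) p∈) (num-par′ v∈)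
      ... | inj₂ (p≡h , _) = subst (λ h → num h < num v) p≡h (num-par′ v∈)

    -- Climb from `d` towards `a`. As long as the parent is strictly below `a`, the low point is
    -- less than the number of the parent, so the class continues upwards; it can end only with `a`
    -- as its head.
    back-edge-component : ∀ {a d i} → d ∈ class i → Ancestor root par a (par d) → low d ≤ num a → a ∈ component i
    back-edge-component d∈ anc low≤ with class-parent d∈ | anc
    ... | inj₁ (p∈ , _)  | self          = class⊆component p∈
    ... | inj₁ (p∈ , _)  | up _ anc′     = back-edge-component p∈ anc′ (≤-trans (low-par (proj₁ (∈class⁻ d∈))) low≤)
    ... | inj₂ (p≡h , _) | self          = subst (_∈ component _) (sym p≡h) head∈component
    ... | inj₂ (_ , p≤)  | up p≢root anc′ = contradiction (≤-trans p≤ low≤)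
                                              (<⇒≱ (≤-<-trans (ancestor-num anc′) (num-par p≢root)))

    covering : Covering
    covering e with comparable e
    ... | inj₁ self = contradiction e (irreflexive G)
    ... | inj₂ self = contradiction e (irreflexive G)
    ... | inj₁ (up v≢root anc) = _ , back-edge-component v∈ anc (low-edge (symmetric G e)) , class⊆component v∈
      where v∈ = ∈class⁺ v≢root refl
    ... | inj₂ (up u≢root anc) = _ , class⊆component u∈ , back-edge-component u∈ anc (low-edge e)
      where u∈ = ∈class⁺ u≢root refl

    open Separation covering num num-head

    module _ (i : Fin C) where

      top : Fin n
      top = proj₁ (tops i)

      top∈ : top ∈ class i
      top∈ with tops i
      ... | _ , t≢root , is-i , _ = ∈class⁺ t≢root is-i

      par-top : par top ≡ head i
      par-top with tops i
      ... | _ , t≢root , refl , unjoined = sym (topped t≢root unjoined)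

      climb : ∀ {v} → v ∈ class i → v ≡ top ⊎ (par v ∈ class i × low v < num (par v))
      climb v∈ with class-parent v∈
      ... | inj₁ up′ = inj₂ up′
      ... | inj₂ (_ , unjoined) with ∈class⁻ v∈ | tops i
      ...   | v≢root , refl | t , t≢root , same , unjoined′ = inj₁ (top-unique v≢root t≢root unjoined unjoined′ (sym same))

      class⊆minus-head : ∀ {v} → v ∈ class i → v ∈ component i - head i
      class⊆minus-head v∈ = x∈p∧x≢y⇒x∈p-y (class⊆component v∈) λ { refl → head∉class v∈ }

      to-top : ∀ {v} → Acc _<_ (num v) → v ∈ class i → Path G (component i - head i) v top
      to-top (acc rec) v∈ with climb v∈
      ... | inj₁ refl     = ε
      ... | inj₂ (p∈ , _) = (class⊆minus-head v∈ , class⊆minus-head p∈ , par-edge′ v∈) ◅ to-top (rec (num-par′ v∈)) p∈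

      module _ {x} (x≢head : x ≢ head i) where

        -- Low points only grow down the tree, so every vertex between `v` and `d` has one below
        -- `num x` and joins the class of its parent. All these vertices have numbers above that of
        -- `x`, so the tree path avoids `x`.
        descend : ∀ {v d} → v ∈ class i → par v ≡ x → low d < num x → Ancestor root par v d →
                  d ∈ class i × Path G (component i - x) d v
        descend v∈ refl low< self = v∈ , ε
        descend {v} {d} v∈ refl low< (up d≢root anc) = d∈ , (d∈-x , p∈-x , par-edge d≢root) ◅ proj₂ above
          where
          above = descend v∈ refl (≤-<-trans (low-par d≢root) low<) anc
          x<p = <-≤-trans (num-par′ v∈) (ancestor-num anc)
          d∈ = joined-down d≢root (proj₁ above) (<-trans low< x<p)
          d∈-x = x∈p∧x≢y⇒x∈p-y (class⊆component d∈) λ d≡x →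
            <-irrefl (cong num (sym d≡x)) (<-trans x<p (num-par d≢root))
          p∈-x = x∈p∧x≢y⇒x∈p-y (class⊆component (proj₁ above)) λ p≡x → <-irrefl (cong num (sym p≡x)) x<p

        -- If the parent of v is the removed vertex x, then v is not the top of its
        -- class, so a back edge leads from below v to a proper ancestor of x.
        to-head : ∀ {v} → Acc _<_ (num v) → v ∈ component i → v ≢ x → Path G (component i - x) v (head i)
        to-head {v} (acc rec) v∈ v≢x with ∈component⁻ v∈
        ... | inj₂ refl = ε
        ... | inj₁ v∈class with par v ≟ x | climb v∈class
        ...   | no _    | inj₁ refl =
                (x∈p∧x≢y⇒x∈p-y v∈ v≢x ,
                 x∈p∧x≢y⇒x∈p-y (subst (_∈ component i) (sym par-top) head∈component)
                   (λ p≡x → x≢head (trans (sym p≡x) par-top)) ,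
                 par-edge′ v∈class) ◅
                subst (λ h → Path G (component i - x) h (head i)) (sym par-top) ε
        ...   | no p≢x  | inj₂ (p∈ , _) =
                (x∈p∧x≢y⇒x∈p-y v∈ v≢x , x∈p∧x≢y⇒x∈p-y (class⊆component p∈) p≢x , par-edge′ v∈class) ◅
                to-head (rec (num-par′ v∈class)) (class⊆component p∈) p≢x
        ...   | yes p≡x | inj₁ refl = contradiction (trans (sym p≡x) par-top) x≢head
        ...   | yes refl | inj₂ (p∈ , low<) with low-attained low<
        ...     | d , a , anc , e , a≡low = Path-sym G (proj₂ down) ◅◅ (d∈-x , a∈-x , e) ◅
                  to-head (rec (<-trans a<x (num-par′ v∈class))) a∈ a≢x
          where
          a<x = subst (_< num x) (sym a≡low) low<
          down = descend v∈class refl (≤-<-trans (low-edge e) a<x) anc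
          d∈-x = x∈p∧x≢y⇒x∈p-y (class⊆component (proj₁ down)) λ d≡x →
            <-irrefl (cong num (sym d≡x)) (<-≤-trans (num-par′ v∈class) (ancestor-num anc))
          a≢x = λ a≡x → <-irrefl (cong num a≡x) a<x
          a∈ : a ∈ component i
          -- If `d` carries the label of the component of this back edge, that component is `i`. It
          -- cannot be the head instead, since `a` would then have a greater number than `d`.
          a∈ with covering e
          ... | j , d∈ , a∈j with ∈component⁻ d∈ | ∈component⁻ a∈j
          ...   | inj₁ d∈j  | _         = subst (λ j → a ∈ component j) (class-unique d∈j (proj₁ down)) a∈j
          ...   | inj₂ refl | inj₂ refl = contradiction e (irreflexive G)
          ...   | inj₂ refl | inj₁ a∈j′ = contradiction (num-head a∈j′)
                  (λ d<a → <⇒≱ (<-trans d<a (<-trans a<x (num-par′ v∈class))) (ancestor-num anc))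
          a∈-x = x∈p∧x≢y⇒x∈p-y a∈ a≢x

      component-biconnected : IsBiconnected G (component i)
      component-biconnected = record
        { nontrivial      = top , head i , class⊆component top∈ , head∈component , λ t≡h → head∉class (subst (_∈ class i) t≡h top∈)
        ; connected       = hub-connected G top connect
        ; connected-minus = λ x _ → minus x
        }
        where
        connect : ∀ {v} → v ∈ component i → Path G (component i) v top
        connect v∈ with ∈component⁻ v∈
        ... | inj₁ v∈class = Path-mono G x∈p-y⇒x∈p (to-top (<-wellFounded _) v∈class)
        ... | inj₂ refl    = (v∈ , class⊆component top∈ , symmetric G (subst (Edge G top) par-top (par-edge′ top∈))) ◅ ε

        minus : ∀ x → ConnectedOn (Edge G) (component i - x)
        minus x with x ≟ head i
        ... | no x≢head = hub-connected G (head i) λ v∈ → to-head x≢head (<-wellFounded _) (x∈p-y⇒x∈p v∈) (x∈p-y⇒x≢y v∈)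
        ... | yes refl  = hub-connected G top λ v∈ → to-top (<-wellFounded _)
              ([ (λ v∈class → v∈class) , (λ v≡h → contradiction v≡h (x∈p-y⇒x≢y v∈)) ]′ (∈component⁻ (x∈p-y⇒x∈p v∈)))

    sound : ∀ i → IsBiconnectedComponent G (component i)
    sound i = record
      { biconnected = component-biconnected i
      ; maximal     = component-maximal (top i , top∈ i)
      }

    labeling : BCLabeling G tree
    labeling = record
      { labels              = L
      ; component-sound     = sound
      ; component-injective = λ {i} → component-injective (top∈ i)
      ; component-complete  = complete
      ; head-outside        = λ i → head∉class
      ; head-is-parent      = λ i → top i , proj₁ (∈class⁻ (top∈ i)) , top∈ i , par-top i
      ; head-only           = λ i v _ v∈ → [ (λ up′ → inj₁ (proj₁ up′)) , (λ h → inj₂ (proj₁ h)) ]′ (class-parent v∈)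
      }
      where
      complete : ∀ S → IsBiconnectedComponent G S → ∃[ i ] component i ≡ S
      -- One edge of `S` suffices: two maximal biconnected sets that share it are equal.
      complete S M with biconnected-edge G (IsBiconnectedComponent.biconnected M)
      ... | u , v , u∈ , v∈ , e with covering e
      ...   | i , u∈i , v∈i = i , component-unique G (sound i) M (edge-≢ G e) u∈i u∈ v∈i v∈

-- Invariants of the depth-first search

infixl 6 _[_↦_]

_[_↦_] : ∀ {n} {A : Set} → (Fin n → A) → Fin n → A → (Fin n → A)
f [ v ↦ x ] = updateAt f v (λ _ → x)

↦-at : ∀ {n} {A : Set} (f : Fin n → A) v {x} → (f [ v ↦ x ]) v ≡ x
↦-at f v = updateAt-updates v f

↦-other : ∀ {n} {A : Set} (f : Fin n → A) {u} v {x} → u ≢ v → (f [ v ↦ x ]) u ≡ f u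
↦-other f {u} v u≢v = updateAt-minimal u v f u≢v

-- Only the parents of vertices in a set closed under parents matter. Used with the visited
-- vertices, when a new vertex gets its parent.
ancestor-cong : ∀ {n} {root : Fin n} {par par′ : Fin n → Fin n} {P : Fin n → Set} →
  (∀ {v} → P v → par′ v ≡ par v) → (∀ {v} → v ≢ root → P v → P (par v)) →
  ∀ {a v} → P v → Ancestor root par a v → Ancestor root par′ a v
ancestor-cong agree closed Pv self = self
ancestor-cong agree closed Pv (up v≢root anc) =
  up v≢root (subst (Ancestor _ _ _) (sym (agree Pv)) (ancestor-cong agree closed (closed v≢root Pv) anc))

module DFS {n-1} (G : Graph (suc n-1)) (off : Fin (suc n-1) → ℕ) where

  n : ℕ
  n = suc n-1

  root : Fin n
  root = zero

  deg : Fin n → ℕ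
  deg = degree G

  Anc : (Fin n → Fin n) → Fin n → Fin n → Set
  Anc = Ancestor root

  -- The part of the invariant that outlives the search; on visited vertices, `order` is the inverse
  -- of `num`.
  record Numbering (num order parent : Fin n → ℕ) (par : Fin n → Fin n) (k : ℕ) : Set where
    field
      num-root      : num root ≡ 0
      0<k           : 0 < k
      k≤n           : k ≤ n
      ordered       : ∀ i → toℕ i < k → ∃[ v ] num v ≡ toℕ i × order i ≡ toℕ v
      num-injective : ∀ {u v} → num u < k → num u ≡ num v → u ≡ v
      parent-array  : ∀ {v} → v ≢ root → num v < k → parent v ≡ toℕ (par v)
      par-edge      : ∀ {v} → v ≢ root → num v < k → Edge G v (par v)
      num-par       : ∀ {v} → v ≢ root → num v < k → num (par v) < num v

  record Explored (num order parent : Fin n → ℕ) (par : Fin n → Fin n) (k : ℕ) : Set where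
    field
      numbering   : Numbering num order parent par k
      all-visited : ∀ v → num v < k
      comparable  : ∀ {u v} → Edge G u v → Anc par u v ⊎ Anc par v u
    open Numbering numbering public

    dfs-tree : DFSTree G
    dfs-tree = record
      { root       = root
      ; par        = par
      ; num        = num
      ; num-root   = num-root
      ; par-edge   = λ {v} v≢root → par-edge v≢root (all-visited v)
      ; num-par    = λ {v} v≢root → num-par v≢root (all-visited v)
      ; comparable = comparable
      }

  -- Vertices with number below k are visited; cur is being scanned, and of each
  -- adjacency list the first scanned entries have been inspected.  The value
  -- suc (deg u) marks a vertex that the search has left for good.
  record Search (num order parent saved : Fin n → ℕ) (par : Fin n → Fin n) (scanned : Fin n → ℕ)
                (cur : Fin n) (k : ℕ) : Set where
    field
      numbering   : Numbering num order parent par k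
      status      : ∀ u → num u < k ⊎ (num u ≡ n × scanned u ≡ 0)
      cur-visited : num cur < k
      saved-array : ∀ {u} → u ≢ cur → scanned u ≤ deg u → saved u ≡ off u + scanned u
      inspected   : ∀ u (j : Fin (deg u)) → toℕ j < scanned u → num (lookup (adj G u) j) < k
      comparable  : ∀ u (j : Fin (deg u)) → toℕ j < scanned u →
                    Anc par u (lookup (adj G u) j) ⊎ Anc par (lookup (adj G u) j) u
      on-path     : ∀ {u} → Anc par u cur → scanned u ≤ deg u
      left        : ∀ {u} → num u < k → Anc par u cur ⊎ scanned u ≡ suc (deg u)
    open Numbering numbering public

  -- Termination measure: one step for each list entry and one for leaving the vertex. Every step of
  -- the search except the final one raises one entry of `scanned` by 1.
  remaining : (Fin n → ℕ) → ℕ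
  remaining scanned = sum λ u → suc (deg u) ∸ scanned u

  remaining-advance : ∀ scanned c → scanned c ≤ deg c →
                      remaining scanned ≡ suc (remaining (scanned [ c ↦ suc (scanned c) ]))
  remaining-advance scanned c ≤deg = sum-suc-at (λ u → suc (deg u) ∸ scanned u) (λ u → suc (deg u) ∸ scanned′ u) c
    (trans (+-∸-assoc 1 ≤deg) (cong (λ s → suc (suc (deg c) ∸ s)) (sym (↦-at scanned c {suc (scanned c)}))))
    λ u u≢c → cong (suc (deg u) ∸_) (sym (↦-other scanned c u≢c))
    where scanned′ = scanned [ c ↦ suc (scanned c) ]

  neighbour-index : ∀ {u v} → Edge G u v → ∃[ j ] lookup (adj G u) j ≡ v
  neighbour-index e = index e , sym (lookup-index e)

  module _ {num order parent saved par scanned cur k} (S : Search num order parent saved par scanned cur k) where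
    open Search S

    path-num : ∀ {u v} → Anc par u v → num v < k → num u ≤ num v
    path-num self _ = ≤-refl
    path-num (up v≢root anc) v<k =
      ≤-trans (path-num anc (<-trans (num-par v≢root v<k) v<k)) (<⇒≤ (num-par v≢root v<k))

    visited-≢ : ∀ {u w} → num u < k → num w ≡ n → u ≢ w
    visited-≢ u<k w≡n refl = <⇒≱ u<k (≤-trans k≤n (≤-reflexive (sym w≡n)))

    visited⁻ : ∀ {u} → k < n → num u < suc k → num u < k
    visited⁻ {u} k<n u<1+k with status u
    ... | inj₁ u<k       = u<k
    ... | inj₂ (u≡n , _) = contradiction (subst (_≤ k) u≡n (s≤s⁻¹ u<1+k)) (<⇒≱ k<n)

    -- By the pigeonhole principle, as w differs from the k visited vertices.
    unvisited⇒k<n : ∀ {w} → num w ≡ n → k < n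
    unvisited⇒k<n {w} w≡n = injective⇒≤ {f = f} f-injective
      where
      at : ∀ (i : Fin k) → ∃[ v ] num v ≡ toℕ i
      at i with ordered (fromℕ< (<-≤-trans (toℕ<n i) k≤n)) (subst (_< k) (sym (toℕ-fromℕ< _)) (toℕ<n i))
      ... | v , v≡ , _ = v , trans v≡ (toℕ-fromℕ< _)

      f : Fin (suc k) → Fin n
      f zero    = w
      f (suc i) = proj₁ (at i)

      at-≢ : ∀ i → proj₁ (at i) ≢ w
      at-≢ i = visited-≢ (subst (_< k) (sym (proj₂ (at i))) (toℕ<n i)) w≡n

      f-injective : ∀ {i j} → f i ≡ f j → i ≡ j
      f-injective {zero}  {zero}  _ = refl
      f-injective {zero}  {suc j} h = contradiction (sym h) (at-≢ j)
      f-injective {suc i} {zero}  h = contradiction h (at-≢ i)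
      f-injective {suc i} {suc j} h = cong suc (toℕ-injective
        (trans (sym (proj₂ (at i))) (trans (cong num h) (proj₂ (at j)))))

    module _ (j : Fin (deg cur)) (j≡ : toℕ j ≡ scanned cur) where

      private
        w = lookup (adj G cur) j
        scanned′ = scanned [ cur ↦ suc (scanned cur) ]

        e : Edge G cur w
        e = ∈-lookup j

        w≢cur : w ≢ cur
        w≢cur = edge-≢ G (symmetric G e)

        scan<deg : scanned cur < deg cur
        scan<deg = subst (_< deg cur) j≡ (toℕ<n j)

        scanned-cur : scanned′ cur ≡ suc (scanned cur)
        scanned-cur = ↦-at scanned cur

        scanned-other : ∀ {u} → u ≢ cur → scanned′ u ≡ scanned u
        scanned-other = ↦-other scanned cur

        -- Advancing the scan adds just entry `j` of `cur`; this serves both invariants on inspected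
        -- entries.
        scanned-split : ∀ {P : ∀ u → Fin (deg u) → Set} → (∀ u i → toℕ i < scanned u → P u i) → P cur j →
                        ∀ u i → toℕ i < scanned′ u → P u i
        scanned-split old new u i i< with u ≟ cur
        ... | no u≢cur = old u i (subst (toℕ i <_) (scanned-other u≢cur) i<)
        ... | yes refl with m≤n⇒m<n∨m≡n (s≤s⁻¹ (subst (toℕ i <_) scanned-cur i<))
        ...   | inj₁ i<′ = old cur i i<′
        ...   | inj₂ i≡  with toℕ-injective {i = i} {j = j} (trans i≡ (sym j≡))
        ...     | refl = new

      revisit : num w < k → Search num order parent saved par scanned′ cur k
      revisit w<k = record
        { numbering   = numbering
        ; status      = status′
        ; cur-visited = cur-visited
        ; saved-array = λ u≢cur ≤deg → trans
            (saved-array u≢cur (subst (_≤ _) (scanned-other u≢cur) ≤deg))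
            (cong (off _ +_) (sym (scanned-other u≢cur)))
        ; inspected   = scanned-split inspected w<k
        ; comparable  = scanned-split comparable meets
        ; on-path     = on-path′
        ; left        = left′
        }
        where
        status′ : ∀ u → num u < k ⊎ (num u ≡ n × scanned′ u ≡ 0)
        status′ u with status u
        ... | inj₁ u<k = inj₁ u<k
        ... | inj₂ (u≡n , u≡0) = inj₂ (u≡n , trans (scanned-other (λ u≡c → visited-≢ cur-visited u≡n (sym u≡c))) u≡0)

        -- If the search has left w, then it has inspected the edge from w to cur.
        meets : Anc par cur w ⊎ Anc par w cur
        meets with left w<k
        ... | inj₁ anc = inj₂ anc
        ... | inj₂ full with neighbour-index (symmetric G e)
        ...   | i , i≡ with comparable w i (subst (toℕ i <_) (sym full) (m<n⇒m<1+n (toℕ<n i)))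
        ...     | cases = [ (λ a → inj₂ (subst (Anc par w) i≡ a)) , (λ a → inj₁ (subst (λ x → Anc par x w) i≡ a)) ]′ cases

        on-path′ : ∀ {u} → Anc par u cur → scanned′ u ≤ deg u
        on-path′ {u} anc with u ≟ cur
        ... | yes refl  = subst (_≤ deg cur) (sym scanned-cur) scan<deg
        ... | no u≢cur = subst (_≤ deg u) (sym (scanned-other u≢cur)) (on-path anc)

        left′ : ∀ {u} → num u < k → Anc par u cur ⊎ scanned′ u ≡ suc (deg u)
        left′ {u} u<k with u ≟ cur
        ... | yes refl = inj₁ self
        ... | no u≢cur = ⊎-map (λ a → a) (trans (scanned-other u≢cur)) (left u<k)

      module _ (w≡n : num w ≡ n) (i : Fin n) (i≡k : toℕ i ≡ k) where

        private
          k<n = unvisited⇒k<n w≡n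
          num′   = num [ w ↦ k ]
          par′   = par [ w ↦ cur ]
          order′ = order [ i ↦ toℕ w ]
          parent′ = parent [ w ↦ toℕ cur ]
          saved′ = saved [ cur ↦ off cur + suc (scanned cur) ]

          ≢w : ∀ {u} → num u < k → u ≢ w
          ≢w u<k = visited-≢ u<k w≡n

          num-old : ∀ {u} → num u < k → num′ u ≡ num u
          num-old u<k = ↦-other num w (≢w u<k)

          visited′ : ∀ {u} → num u < k → num′ u < suc k
          visited′ u<k = subst (_< suc k) (sym (num-old u<k)) (m<n⇒m<1+n u<k)

          split′ : ∀ {u} → num′ u < suc k → u ≡ w ⊎ (u ≢ w × num u < k)
          split′ {u} u< with u ≟ w
          ... | yes u≡w = inj₁ u≡w
          ... | no  u≢w = inj₂ (u≢w , visited⁻ k<n (subst (_< suc k) (↦-other num w u≢w) u<))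

          par-old : ∀ {u} → num u < k → par′ u ≡ par u
          par-old u<k = ↦-other par w (≢w u<k)

          par-w : par′ w ≡ cur
          par-w = ↦-at par w

          par-visited : ∀ {v} → v ≢ root → num v < k → num (par v) < k
          par-visited v≢root v<k = <-trans (num-par v≢root v<k) v<k

          anc⁺ : ∀ {a v} → num v < k → Anc par a v → Anc par′ a v
          anc⁺ = ancestor-cong {P = λ v → num v < k} par-old par-visited

          anc⁻ : ∀ {a v} → num v < k → Anc par′ a v → Anc par a v
          anc⁻ = ancestor-cong {P = λ v → num v < k} (λ v<k → sym (par-old v<k))
            λ v≢root v<k → subst (λ p → num p < k) (sym (par-old v<k)) (par-visited v≢root v<k)

          w≢root : w ≢ root
          w≢root w≡root = ≢w (subst (_< k) (sym num-root) 0<k) (sym w≡root)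

          numbering′ : Numbering num′ order′ parent′ par′ (suc k)
          numbering′ = record
            { num-root      = trans (num-old (subst (_< k) (sym num-root) 0<k)) num-root
            ; 0<k           = s≤s z≤n
            ; k≤n           = k<n
            ; ordered       = ordered′
            ; num-injective = injective′
            ; parent-array  = λ v≢root v< → parent-array′ v≢root (split′ v<)
            ; par-edge      = λ v≢root v< → par-edge′ v≢root (split′ v<)
            ; num-par       = λ v≢root v< → num-par′ v≢root (split′ v<)
            }
            where
            ordered′ : ∀ j → toℕ j < suc k → ∃[ v ] num′ v ≡ toℕ j × order′ j ≡ toℕ v
            ordered′ j j< with j ≟ i
            ... | yes refl = w , trans (↦-at num w) (sym i≡k) , ↦-at order i
            ... | no j≢i with ordered j (≤∧≢⇒< (s≤s⁻¹ j<) λ j≡k → j≢i (toℕ-injective (trans j≡k (sym i≡k))))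
            ...   | v , v≡ , at = v ,
                    trans (num-old (subst (_< k) (sym v≡) (≤∧≢⇒< (s≤s⁻¹ j<) λ j≡k → j≢i (toℕ-injective (trans j≡k (sym i≡k)))))) v≡ ,
                    trans (↦-other order i j≢i) at

            only-w : ∀ {v} → k ≡ num′ v → v ≡ w
            only-w {v} k≡ with v ≟ w
            ... | yes v≡w = v≡w
            ... | no v≢w with trans k≡ (↦-other num w v≢w) | status v
            ...   | k≡v | inj₁ v<k       = contradiction (sym k≡v) (<⇒≢ v<k)
            ...   | k≡v | inj₂ (v≡n , _) = contradiction (trans k≡v v≡n) (<⇒≢ k<n)

            injective′ : ∀ {u v} → num′ u < suc k → num′ u ≡ num′ v → u ≡ v
            injective′ {u} {v} u< same with split′ u<
            ... | inj₁ refl = sym (only-w (trans (sym (↦-at num w)) same))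
            ... | inj₂ (_ , u<k) with v ≟ w
            ...   | yes refl = contradiction (trans (sym (num-old u<k)) (trans same (↦-at num w))) (<⇒≢ u<k)
            ...   | no v≢w   = num-injective u<k (trans (sym (num-old u<k)) (trans same (↦-other num w v≢w)))

            parent-array′ : ∀ {v} → v ≢ root → v ≡ w ⊎ (v ≢ w × num v < k) → parent′ v ≡ toℕ (par′ v)
            parent-array′ v≢root (inj₁ refl) = trans (↦-at parent w) (cong toℕ (sym par-w))
            parent-array′ v≢root (inj₂ (v≢w , v<k)) = trans (↦-other parent w v≢w)
              (trans (parent-array v≢root v<k) (cong toℕ (sym (par-old v<k))))

            par-edge′ : ∀ {v} → v ≢ root → v ≡ w ⊎ (v ≢ w × num v < k) → Edge G v (par′ v)
            par-edge′ v≢root (inj₁ refl) = subst (Edge G w) (sym par-w) (symmetric G e)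
            par-edge′ v≢root (inj₂ (_ , v<k)) = subst (Edge G _) (sym (par-old v<k)) (par-edge v≢root v<k)

            num-par′ : ∀ {v} → v ≢ root → v ≡ w ⊎ (v ≢ w × num v < k) → num′ (par′ v) < num′ v
            num-par′ v≢root (inj₁ refl) = subst₂ _<_
              (sym (trans (cong num′ par-w) (num-old cur-visited))) (sym (↦-at num w)) cur-visited
            num-par′ v≢root (inj₂ (_ , v<k)) = subst₂ _<_
              (sym (trans (cong num′ (par-old v<k)) (num-old (par-visited v≢root v<k)))) (sym (num-old v<k))
              (num-par v≢root v<k)

        scanned-w : scanned w ≡ 0
        scanned-w with status w
        ... | inj₁ w<k       = contradiction w≡n (<⇒≢ (<-≤-trans w<k k≤n))
        ... | inj₂ (_ , w≡0) = w≡0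

        discover : Search num′ order′ parent′ saved′ par′ scanned′ w (suc k)
        discover = record
          { numbering   = numbering′
          ; status      = status′
          ; cur-visited = subst (_< suc k) (sym (↦-at num w)) ≤-refl
          ; saved-array = saved-array′
          ; inspected   = scanned-split (λ u i i< → visited′ (inspected u i i<))
                            (subst (_< suc k) (sym (↦-at num w)) ≤-refl)
          ; comparable  = scanned-split
              (λ u i i< → ⊎-map (anc⁺ (inspected u i i<)) (anc⁺ (scanned⇒visited i<)) (comparable u i i<))
              (inj₁ (up w≢root (subst (Anc par′ cur) (sym par-w) self)))
          ; on-path     = on-path′
          ; left        = λ u< → left′ (split′ u<)
          }
          where
          scanned⇒visited : ∀ {u m} → m < scanned u → num u < k
          scanned⇒visited {u} m< with status u
          ... | inj₁ u<k       = u<k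
          ... | inj₂ (_ , u≡0) = contradiction (subst (_ <_) u≡0 m<) n≮0

          scanned′-w : scanned′ w ≡ 0
          scanned′-w = trans (scanned-other w≢cur) scanned-w

          status′ : ∀ u → num′ u < suc k ⊎ (num′ u ≡ n × scanned′ u ≡ 0)
          status′ u with u ≟ w
          ... | yes refl = inj₁ (subst (_< suc k) (sym (↦-at num w)) ≤-refl)
          ... | no u≢w with status u
          ...   | inj₁ u<k         = inj₁ (visited′ u<k)
          ...   | inj₂ (u≡n , u≡0) = inj₂ (trans (↦-other num w u≢w) u≡n ,
                  trans (scanned-other (λ u≡c → visited-≢ cur-visited u≡n (sym u≡c))) u≡0)

          saved-array′ : ∀ {u} → u ≢ w → scanned′ u ≤ deg u → saved′ u ≡ off u + scanned′ u
          saved-array′ {u} u≢w ≤deg with u ≟ cur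
          ... | yes refl = trans (↦-at saved cur) (cong (off cur +_) (sym scanned-cur))
          ... | no u≢cur = trans (↦-other saved cur u≢cur)
                (trans (saved-array u≢cur (subst (_≤ deg u) (scanned-other u≢cur) ≤deg))
                  (cong (off u +_) (sym (scanned-other u≢cur))))

          on-path′ : ∀ {u} → Anc par′ u w → scanned′ u ≤ deg u
          on-path′ self = subst (_≤ deg w) (sym scanned′-w) z≤n
          on-path′ {u} (up _ anc) with u ≟ cur
          ... | yes refl = subst (_≤ deg cur) (sym scanned-cur) scan<deg
          ... | no u≢cur = subst (_≤ deg u) (sym (scanned-other u≢cur))
                (on-path (anc⁻ cur-visited (subst (Anc par′ u) par-w anc)))

          left′ : ∀ {u} → u ≡ w ⊎ (u ≢ w × num u < k) → Anc par′ u w ⊎ scanned′ u ≡ suc (deg u)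
          left′ (inj₁ refl) = inj₁ self
          left′ {u} (inj₂ (_ , u<k)) with left u<k
          ... | inj₁ anc  = inj₁ (up w≢root (subst (Anc par′ u) (sym par-w) (anc⁺ cur-visited anc)))
          ... | inj₂ full = inj₂ (trans (scanned-other λ { refl → <-irrefl full (s≤s (<⇒≤ scan<deg)) }) full)

        -- The saved position of a new vertex is still the initial one, the start of its list. So
        -- the reload that resumes an interrupted scan also begins a new one.
        discover-saved : saved′ w ≡ off w + scanned′ w
        discover-saved = trans (↦-other saved cur w≢cur)
          (trans (saved-array w≢cur (subst (_≤ deg w) (sym scanned-w) z≤n))
            (cong (off w +_) (sym (scanned-other w≢cur))))

    module _ (cur≢root : cur ≢ root) (full : scanned cur ≡ deg cur) where

      private
        scanned′ = scanned [ cur ↦ suc (scanned cur) ]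

        scanned-cur : scanned′ cur ≡ suc (deg cur)
        scanned-cur = trans (↦-at scanned cur) (cong suc full)

        scanned-other : ∀ {u} → u ≢ cur → scanned′ u ≡ scanned u
        scanned-other = ↦-other scanned cur

        par<cur = num-par cur≢root cur-visited

        scanned⁻ : ∀ {u} (i : Fin (deg u)) → toℕ i < scanned′ u → toℕ i < scanned u
        scanned⁻ {u} i i< with u ≟ cur
        ... | yes refl = subst (toℕ i <_) (sym full) (toℕ<n i)
        ... | no u≢cur = subst (toℕ i <_) (scanned-other u≢cur) i<

      par≢cur : par cur ≢ cur
      par≢cur same = <-irrefl (cong num same) par<cur

      retreat : Search num order parent saved par scanned′ (par cur) k
      retreat = record
        { numbering   = numbering
        ; status      = status′
        ; cur-visited = <-trans par<cur cur-visited
        ; saved-array = λ _ → saved-array′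
        ; inspected   = λ u i i< → inspected u i (scanned⁻ i i<)
        ; comparable  = λ u i i< → comparable u i (scanned⁻ i i<)
        ; on-path     = on-path′
        ; left        = left′
        }
        where
        status′ : ∀ u → num u < k ⊎ (num u ≡ n × scanned′ u ≡ 0)
        status′ u with status u
        ... | inj₁ u<k = inj₁ u<k
        ... | inj₂ (u≡n , u≡0) = inj₂ (u≡n , trans (scanned-other (λ u≡c → visited-≢ cur-visited u≡n (sym u≡c))) u≡0)

        saved-array′ : ∀ {u} → scanned′ u ≤ deg u → saved u ≡ off u + scanned′ u
        saved-array′ {u} ≤deg with u ≟ cur
        ... | yes refl = contradiction (subst (_≤ deg cur) scanned-cur ≤deg) (<⇒≱ ≤-refl)
        ... | no u≢cur = trans (saved-array u≢cur (subst (_≤ deg u) (scanned-other u≢cur) ≤deg))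
                           (cong (off u +_) (sym (scanned-other u≢cur)))

        on-path′ : ∀ {u} → Anc par u (par cur) → scanned′ u ≤ deg u
        on-path′ {u} anc = subst (_≤ deg u) (sym (scanned-other u≢cur)) (on-path (up cur≢root anc))
          where
          u≢cur : u ≢ cur
          u≢cur refl = <⇒≱ par<cur (path-num anc (<-trans par<cur cur-visited))

        left′ : ∀ {u} → num u < k → Anc par u (par cur) ⊎ scanned′ u ≡ suc (deg u)
        left′ {u} u<k with u ≟ cur
        ... | yes refl = inj₂ scanned-cur
        ... | no u≢cur with left u<k
        ...   | inj₁ self       = contradiction refl u≢cur
        ...   | inj₁ (up _ anc) = inj₁ anc
        ...   | inj₂ done       = inj₂ (trans (scanned-other u≢cur) done)

      retreat-saved : saved (par cur) ≡ off (par cur) + scanned′ (par cur)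
      retreat-saved = trans (saved-array par≢cur (on-path (up cur≢root self)))
        (cong (off (par cur) +_) (sym (scanned-other par≢cur)))

    module _ (conn : Connected G) (cur≡root : cur ≡ root) (full : scanned cur ≡ deg cur) where

      private
        -- Every visited vertex is either the root, whose list is exhausted, or has been left. Hence
        -- the visited set is closed under edges, and connectivity makes it everything.
        all-inspected : ∀ {u v} → num u < k → Edge G u v → num v < k × (Anc par u v ⊎ Anc par v u)
        all-inspected {u} u<k e with neighbour-index e
        ... | j , refl = inspected u j j< , comparable u j j<
          where
          anc-root : ∀ {u} → Anc par u root → u ≡ root
          anc-root self       = refl
          anc-root (up r≢r _) = contradiction refl r≢r

          j< : toℕ j < scanned u
          j< with left u<k
          ... | inj₂ done = subst (toℕ j <_) (sym done) (m<n⇒m<1+n (toℕ<n j))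
          ... | inj₁ anc with trans (anc-root (subst (Anc par u) cur≡root anc)) (sym cur≡root)
          ...   | refl = subst (toℕ j <_) (sym full) (toℕ<n j)

      reaches-all : ∀ v → num v < k
      reaches-all v = go cur-visited (conn ∈⊤ ∈⊤)
        where
        go : ∀ {u} → num u < k → Path G ⊤ u v → num v < k
        go u<k ε = u<k
        go u<k ((_ , _ , e) ◅ path) = go (proj₁ (all-inspected u<k e)) path

      finish : Explored num order parent par k
      finish = record
        { numbering   = numbering
        ; all-visited = reaches-all
        ; comparable  = λ {u} e → proj₂ (all-inspected (reaches-all u) e)
        }

  start : ∀ {num order parent saved} → num root ≡ 0 → (∀ {u} → u ≢ root → num u ≡ n) → order root ≡ 0 →
          (∀ u → saved u ≡ off u) → Search num order parent saved (λ v → v) (λ _ → 0) root 1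
  start {num} {order} {parent} {saved} num-root others order-root saved≡ = record
    { numbering   = record
      { num-root      = num-root
      ; 0<k           = ≤-refl
      ; k≤n           = s≤s z≤n
      ; ordered       = λ { zero _ → root , num-root , order-root ; (suc i) (s≤s ()) }
      ; num-injective = λ {u} {v} u<1 same →
          trans (is-root u<1) (sym (is-root (subst (_< 1) same u<1)))
      ; parent-array  = λ v≢root v<1 → contradiction (is-root v<1) v≢root
      ; par-edge      = λ v≢root v<1 → contradiction (is-root v<1) v≢root
      ; num-par       = λ v≢root v<1 → contradiction (is-root v<1) v≢root
      }
    ; status      = status′
    ; cur-visited = subst (_< 1) (sym num-root) ≤-refl
    ; saved-array = λ {u} _ _ → trans (saved≡ u) (sym (+-identityʳ (off u)))
    ; inspected   = λ _ _ ()
    ; comparable  = λ _ _ ()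
    ; on-path     = λ _ → z≤n
    ; left        = λ {u} u<1 → inj₁ (subst (λ r → Anc (λ v → v) r root) (sym (is-root u<1)) self)
    }
    where
    status′ : ∀ u → num u < 1 ⊎ (num u ≡ n × 0 ≡ 0)
    status′ u with u ≟ root
    ... | yes refl  = inj₁ (subst (_< 1) (sym num-root) ≤-refl)
    ... | no u≢root = inj₂ (others u≢root , refl)

    is-root : ∀ {v} → num v < 1 → v ≡ root
    is-root {v} v<1 with v ≟ root
    ... | yes v≡root = v≡root
    ... | no v≢root  = contradiction (subst (_< 1) (others v≢root) v<1) λ { (s≤s ()) }

-- Invariants of the two passes that compute low points and labels

ancestor-trans : ∀ {n} {root : Fin n} {par a b c} → Ancestor root par a b → Ancestor root par b c → Ancestor root par a c
ancestor-trans anc self          = anc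
ancestor-trans anc (up v≢root q) = up v≢root (ancestor-trans anc q)

module Phases {n-1} (G : Graph (suc n-1)) (off : Fin (suc n-1) → ℕ) where
  open DFS G off

  module _ {num order parent par k} (X : Explored num order parent par k) where
    open Explored X

    same-num : ∀ {u v} → num u ≡ num v → u ≡ v
    same-num {u} = num-injective (all-visited u)

    nonroot : ∀ {v} → 0 < num v → v ≢ root
    nonroot 0<v refl = <-irrefl (sym num-root) 0<v

    num-par-all : ∀ {v} → v ≢ root → num (par v) < num v
    num-par-all {v} v≢root = num-par v≢root (all-visited v)

    -- The value `n` is the minimum of an empty list; no vertex has this number.
    Attained : (Fin n → ℕ) → Fin n → Set
    Attained low u = low u ≡ n ⊎ (∃₂ λ d a → Anc par u d × Edge G d a × num a ≡ low u)

    -- The state of the bottom-up pass once the vertices numbered i and above are done.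
    record Lowering (low : Fin n → ℕ) (i : ℕ) : Set where
      field
        low-edge : ∀ {u v} → Edge G u v → low u ≤ num v
        low-par  : ∀ {v} → v ≢ root → i ≤ num v → low (par v) ≤ low v
        attained : ∀ u → Attained low u

    module _ {low i v} (S : Lowering low (suc i)) (v≡i : num v ≡ i) (v≢root : v ≢ root) where
      open Lowering S

      private
        later : ∀ {u} → u ≢ v → i ≤ num u → suc i ≤ num u
        later u≢v i≤u = ≤∧≢⇒< i≤u λ i≡u → u≢v (same-num (trans (sym i≡u) (sym v≡i)))

      keep : low (par v) ≤ low v → Lowering low i
      keep p≤v = record { low-edge = low-edge ; low-par = low-par′ ; attained = attained }
        where
        low-par′ : ∀ {u} → u ≢ root → i ≤ num u → low (par u) ≤ low u
        low-par′ {u} u≢root i≤u with u ≟ v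
        ... | yes refl = p≤v
        ... | no u≢v   = low-par u≢root (later u≢v i≤u)

      -- A witness for `v` is one for its parent, since descendants of `v` are descendants of
      -- `par v`.
      lower : low v < low (par v) → Lowering (low [ par v ↦ low v ]) i
      lower v<p = record { low-edge = low-edge′ ; low-par = low-par′ ; attained = attained′ }
        where
        low′ = low [ par v ↦ low v ]

        low′≤low : ∀ u → low′ u ≤ low u
        low′≤low u with u ≟ par v
        ... | yes refl = ≤-trans (≤-reflexive (↦-at low (par v))) (<⇒≤ v<p)
        ... | no u≢p   = ≤-reflexive (↦-other low (par v) u≢p)

        low-edge′ : ∀ {u w} → Edge G u w → low′ u ≤ num w
        low-edge′ {u} e = ≤-trans (low′≤low u) (low-edge e)

        low-par′ : ∀ {u} → u ≢ root → i ≤ num u → low′ (par u) ≤ low′ u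
        low-par′ {u} u≢root i≤u = subst (low′ (par u) ≤_) (sym (↦-other low (par v) u≢p)) bound
          where
          -- The parent has a number below `i`, so lowering its entry does not disturb the vertices
          -- already done.
          u≢p : u ≢ par v
          u≢p refl = <⇒≱ (subst (num (par v) <_) v≡i (num-par-all v≢root)) i≤u

          bound : low′ (par u) ≤ low u
          bound with u ≟ v
          ... | yes refl = ≤-reflexive (↦-at low (par v))
          ... | no u≢v   = ≤-trans (low′≤low (par u)) (low-par u≢root (later u≢v i≤u))

        attained′ : ∀ u → Attained low′ u
        attained′ u with u ≟ par v
        ... | no u≢p = subst (λ l → l ≡ n ⊎ (∃₂ λ d a → Anc par u d × Edge G d a × num a ≡ l))
              (sym (↦-other low (par v) u≢p)) (attained u)
        ... | yes refl = subst (λ l → l ≡ n ⊎ (∃₂ λ d a → Anc par u d × Edge G d a × num a ≡ l))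
              (sym (↦-at low (par v)))
              ([ inj₁ , (λ (d , a , anc , rest) → inj₂ (d , a , ancestor-trans (up v≢root self) anc , rest)) ]′ (attained v))

    low-points : ∀ {low} → Lowering low 1 → LowPoints dfs-tree
    low-points {low} S = record
      { low          = low
      ; low-edge     = low-edge
      ; low-par      = λ v≢root → low-par v≢root (≤-trans (s≤s z≤n) (num-par-all v≢root))
      ; low-attained = attained′
      }
      where
      open Lowering S
      attained′ : ∀ {u v} → low u < num v → ∃₂ λ d a → Anc par u d × Edge G d a × num a ≡ low u
      attained′ {u} {v} u<v with attained u
      ... | inj₂ found = found
      ... | inj₁ u≡n   = contradiction (subst (_< num v) u≡n u<v) (λ n<v →
              <⇒≱ n<v (≤-trans (<⇒≤ (all-visited v)) k≤n))

    module Labelling (low : Fin n → ℕ) where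

      -- The state of the top-down pass once the vertices numbered below i are done.
      record Labelled (lab hd : Fin n → ℕ) (C i : ℕ) : Set where
        field
          C<i        : C < i
          lab<C      : ∀ {v} → v ≢ root → num v < i → lab v < C
          joined     : ∀ {v} → v ≢ root → num v < i → low v < num (par v) → lab v ≡ lab (par v)
          topped     : ∀ {v} → v ≢ root → num v < i → num (par v) ≤ low v →
                       ∀ {j} → toℕ j ≡ lab v → hd j ≡ toℕ (par v)
          tops       : ∀ {j} → j < C → ∃[ v ] v ≢ root × num v < i × lab v ≡ j × num (par v) ≤ low v
          top-unique : ∀ {u v} → u ≢ root → v ≢ root → num u < i → num v < i →
                       num (par u) ≤ low u → num (par v) ≤ low v → lab u ≡ lab v → u ≡ v

      -- The arrays of labels and heads are not initialised, so only entries assigned so far are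
      -- counted.
      In : (Fin n → ℕ) → ℕ → Fin n → Fin n → Set
      In lab i j v = v ≢ root × num v < i × lab v ≡ toℕ j

      in? : ∀ lab i j v → Dec (In lab i j v)
      in? lab i j v = ¬? (v ≟ root) ×-dec ((num v <? i) ×-dec (lab v ≟ℕ toℕ j))

      Headed : (Fin n → ℕ) → ℕ → Fin n → Fin n → Set
      Headed hd C u j = toℕ j < C × hd j ≡ toℕ u

      headed? : ∀ hd C u j → Dec (Headed hd C u j)
      headed? hd C u j = (toℕ j <? C) ×-dec (hd j ≟ℕ toℕ u)

      Sizes : (lab size : Fin n → ℕ) → ℕ → Set
      Sizes lab size i = ∀ j → size j ≡ count (λ v → does (in? lab i j v))

      HeadCounts : (hd headeds : Fin n → ℕ) → ℕ → Set
      HeadCounts hd headeds C = ∀ u → headeds u ≡ count (λ j → does (headed? hd C u j))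

      module _ {lab hd C i} (S : Labelled lab hd C i) {v} (v≡i : num v ≡ i) (v≢root : v ≢ root) where
        open Labelled S

        private
          at-v : ∀ {u} → num u < suc i → u ≡ v ⊎ (u ≢ v × num u < i)
          at-v {u} u≤i with m≤n⇒m<n∨m≡n (s≤s⁻¹ u≤i)
          ... | inj₁ u<i = inj₂ ((λ { refl → <⇒≢ u<i v≡i }) , u<i)
          ... | inj₂ u≡i = inj₁ (same-num (trans u≡i (sym v≡i)))

          v≤i : num v < suc i
          v≤i = s≤s (≤-reflexive v≡i)

          ≢v : ∀ {u} → num u < i → u ≢ v
          ≢v u<i refl = <⇒≢ u<i v≡i

          par<i : ∀ {u} → u ≢ root → num u < suc i → num (par u) < i
          par<i u≢root u≤i = <-≤-trans (num-par-all u≢root) (s≤s⁻¹ u≤i)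

        parent-nonroot : low v < num (par v) → par v ≢ root
        parent-nonroot v<p p≡root = n≮0 (subst (low v <_) (trans (cong num p≡root) num-root) v<p)

        parent-done : num (par v) < i
        parent-done = par<i v≢root v≤i

        label-joined : low v < num (par v) → Labelled (lab [ v ↦ lab (par v) ]) hd C (suc i)
        label-joined v<p = record
          { C<i        = m<n⇒m<1+n C<i
          ; lab<C      = λ u≢root u≤i → lab<C′ u≢root (at-v u≤i)
          ; joined     = λ u≢root u≤i → joined′ u≢root (at-v u≤i)
          ; topped     = λ u≢root u≤i → topped′ u≢root (at-v u≤i)
          ; tops       = tops′
          ; top-unique = λ u≢root w≢root u≤i w≤i → unique′ u≢root w≢root (at-v u≤i) (at-v w≤i)
          }
          where
          lab′ = lab [ v ↦ lab (par v) ]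

          lab′-v : lab′ v ≡ lab (par v)
          lab′-v = ↦-at lab v

          old : ∀ {u} → u ≢ v → lab′ u ≡ lab u
          old = ↦-other lab v

          lab<C′ : ∀ {u} → u ≢ root → u ≡ v ⊎ (u ≢ v × num u < i) → lab′ u < C
          lab<C′ _ (inj₁ refl) = subst (_< C) (sym lab′-v) (lab<C (parent-nonroot v<p) parent-done)
          lab<C′ u≢root (inj₂ (u≢v , u<i)) = subst (_< C) (sym (old u≢v)) (lab<C u≢root u<i)

          joined′ : ∀ {u} → u ≢ root → u ≡ v ⊎ (u ≢ v × num u < i) → low u < num (par u) → lab′ u ≡ lab′ (par u)
          joined′ _ (inj₁ refl) _ = trans lab′-v (sym (old (≢v parent-done)))
          joined′ u≢root (inj₂ (u≢v , u<i)) u<p = trans (old u≢v)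
            (trans (joined u≢root u<i u<p) (sym (old (≢v (<-trans (num-par-all u≢root) u<i)))))

          topped′ : ∀ {u} → u ≢ root → u ≡ v ⊎ (u ≢ v × num u < i) → num (par u) ≤ low u →
                    ∀ {j} → toℕ j ≡ lab′ u → hd j ≡ toℕ (par u)
          topped′ _ (inj₁ refl) p≤v = contradiction p≤v (<⇒≱ v<p)
          topped′ u≢root (inj₂ (u≢v , u<i)) p≤u j≡ = topped u≢root u<i p≤u (trans j≡ (old u≢v))

          tops′ : ∀ {j} → j < C → ∃[ u ] u ≢ root × num u < suc i × lab′ u ≡ j × num (par u) ≤ low u
          tops′ j<C with tops j<C
          ... | u , u≢root , u<i , u≡j , p≤u = u , u≢root , m<n⇒m<1+n u<i , trans (old (≢v u<i)) u≡j , p≤u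

          unique′ : ∀ {u w} → u ≢ root → w ≢ root → u ≡ v ⊎ (u ≢ v × num u < i) → w ≡ v ⊎ (w ≢ v × num w < i) →
                    num (par u) ≤ low u → num (par w) ≤ low w → lab′ u ≡ lab′ w → u ≡ w
          unique′ _ _ (inj₁ refl) _ p≤u _ _ = contradiction p≤u (<⇒≱ v<p)
          unique′ _ _ (inj₂ _) (inj₁ refl) _ p≤w _ = contradiction p≤w (<⇒≱ v<p)
          unique′ u≢root w≢root (inj₂ (u≢v , u<i)) (inj₂ (w≢v , w<i)) p≤u p≤w same =
            top-unique u≢root w≢root u<i w<i p≤u p≤w (trans (sym (old u≢v)) (trans same (old w≢v)))

        module _ (c : Fin n) (c≡C : toℕ c ≡ C) where

          label-top : num (par v) ≤ low v → Labelled (lab [ v ↦ C ]) (hd [ c ↦ toℕ (par v) ]) (suc C) (suc i)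
          label-top p≤v = record
            { C<i        = s≤s C<i
            ; lab<C      = λ u≢root u≤i → lab<C′ u≢root (at-v u≤i)
            ; joined     = λ u≢root u≤i → joined′ u≢root (at-v u≤i)
            ; topped     = λ u≢root u≤i → topped′ u≢root (at-v u≤i)
            ; tops       = λ j≤C → tops′ (m≤n⇒m<n∨m≡n (s≤s⁻¹ j≤C))
            ; top-unique = λ u≢root w≢root u≤i w≤i → unique′ u≢root w≢root (at-v u≤i) (at-v w≤i)
            }
            where
            lab′ = lab [ v ↦ C ]
            hd′ = hd [ c ↦ toℕ (par v) ]

            lab′-v : lab′ v ≡ C
            lab′-v = ↦-at lab v

            old : ∀ {u} → u ≢ v → lab′ u ≡ lab u
            old = ↦-other lab v

            lab<C′ : ∀ {u} → u ≢ root → u ≡ v ⊎ (u ≢ v × num u < i) → lab′ u < suc C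
            lab<C′ _ (inj₁ refl) = s≤s (≤-reflexive lab′-v)
            lab<C′ u≢root (inj₂ (u≢v , u<i)) = subst (_< suc C) (sym (old u≢v)) (m<n⇒m<1+n (lab<C u≢root u<i))

            joined′ : ∀ {u} → u ≢ root → u ≡ v ⊎ (u ≢ v × num u < i) → low u < num (par u) → lab′ u ≡ lab′ (par u)
            joined′ _ (inj₁ refl) v<p = contradiction p≤v (<⇒≱ v<p)
            joined′ u≢root (inj₂ (u≢v , u<i)) u<p = trans (old u≢v)
              (trans (joined u≢root u<i u<p) (sym (old (≢v (<-trans (num-par-all u≢root) u<i)))))

            topped′ : ∀ {u} → u ≢ root → u ≡ v ⊎ (u ≢ v × num u < i) → num (par u) ≤ low u →
                      ∀ {j} → toℕ j ≡ lab′ u → hd′ j ≡ toℕ (par u)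
            topped′ _ (inj₁ refl) _ {j} j≡ with toℕ-injective {i = j} {j = c} (trans j≡ (trans lab′-v (sym c≡C)))
            ... | refl = ↦-at hd c
            topped′ u≢root (inj₂ (u≢v , u<i)) p≤u {j} j≡ = trans (↦-other hd c j≢c) (topped u≢root u<i p≤u j≡′)
              where
              j≡′ = trans j≡ (old u≢v)
              -- Older labels are less than `C`, so the new head cell is none of theirs.
              j≢c : j ≢ c
              j≢c refl = <⇒≢ (lab<C u≢root u<i) (trans (sym j≡′) c≡C)

            tops′ : ∀ {j} → j < C ⊎ j ≡ C → ∃[ u ] u ≢ root × num u < suc i × lab′ u ≡ j × num (par u) ≤ low u
            tops′ (inj₂ refl) = v , v≢root , v≤i , lab′-v , p≤v
            tops′ (inj₁ j<C) with tops j<C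
            ... | u , u≢root , u<i , u≡j , p≤u = u , u≢root , m<n⇒m<1+n u<i , trans (old (≢v u<i)) u≡j , p≤u

            unique′ : ∀ {u w} → u ≢ root → w ≢ root → u ≡ v ⊎ (u ≢ v × num u < i) → w ≡ v ⊎ (w ≢ v × num w < i) →
                      num (par u) ≤ low u → num (par w) ≤ low w → lab′ u ≡ lab′ w → u ≡ w
            unique′ _ _ (inj₁ refl) (inj₁ refl) _ _ _ = refl
            unique′ _ w≢root (inj₁ refl) (inj₂ (w≢v , w<i)) _ _ same =
              contradiction (trans (sym (old w≢v)) (trans (sym same) lab′-v)) (<⇒≢ (lab<C w≢root w<i))
            unique′ u≢root _ (inj₂ (u≢v , u<i)) (inj₁ refl) _ _ same =
              contradiction (trans (sym (old u≢v)) (trans same lab′-v)) (<⇒≢ (lab<C u≢root u<i))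
            unique′ u≢root w≢root (inj₂ (u≢v , u<i)) (inj₂ (w≢v , w<i)) p≤u p≤w same =
              top-unique u≢root w≢root u<i w<i p≤u p≤w (trans (sym (old u≢v)) (trans same (old w≢v)))

          head-counts : ∀ {headeds} → HeadCounts hd headeds C →
                        HeadCounts (hd [ c ↦ toℕ (par v) ]) (headeds [ par v ↦ suc (headeds (par v)) ]) (suc C)
          head-counts {headeds} H u with u ≟ par v
          ... | yes refl = trans (↦-at headeds (par v)) (trans (cong suc (H (par v))) (sym (count-suc-at _ _ c
                (dec-true (headed? hd′ (suc C) (par v) c) (s≤s (≤-reflexive c≡C) , ↦-at hd c))
                (dec-false (headed? hd C (par v) c) λ (c<C , _) → <⇒≢ c<C c≡C)
                (others (par v)))))
            where
            hd′ = hd [ c ↦ toℕ (par v) ]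
            others : ∀ u j → j ≢ c → does (headed? hd′ (suc C) u j) ≡ does (headed? hd C u j)
            others u j j≢c = does-⇔ (mk⇔
              (λ (j≤C , is) → ≤∧≢⇒< (s≤s⁻¹ j≤C) (λ j≡C → j≢c (toℕ-injective (trans j≡C (sym c≡C)))) ,
                              trans (sym (↦-other hd c j≢c)) is)
              (λ (j<C , is) → m<n⇒m<1+n j<C , trans (↦-other hd c j≢c) is)) (headed? hd′ (suc C) u j) (headed? hd C u j)
          ... | no u≢p = trans (↦-other headeds (par v) u≢p) (trans (H u) (count-cong λ j →
                does-⇔ (mk⇔ (to j) (from j)) (headed? hd C u j) (headed? hd′ (suc C) u j)))
            where
            hd′ = hd [ c ↦ toℕ (par v) ]
            to : ∀ j → Headed hd C u j → Headed hd′ (suc C) u j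
            to j (j<C , is) = m<n⇒m<1+n j<C , trans (↦-other hd c λ { refl → <⇒≢ j<C c≡C }) is
            from : ∀ j → Headed hd′ (suc C) u j → Headed hd C u j
            from j (j≤C , is) with j ≟ c
            ... | yes refl = contradiction (toℕ-injective (trans (sym is) (↦-at hd c))) u≢p
            ... | no j≢c = ≤∧≢⇒< (s≤s⁻¹ j≤C) (λ j≡C → j≢c (toℕ-injective (trans j≡C (sym c≡C)))) ,
                           trans (sym (↦-other hd c j≢c)) is

        module _ (j : Fin n) where

          sizes : ∀ {size} → Sizes lab size i → Sizes (lab [ v ↦ toℕ j ]) (size [ j ↦ suc (size j) ]) (suc i)
          sizes {size} H j′ with j′ ≟ j
          ... | yes refl = trans (↦-at size j) (trans (cong suc (H j)) (sym (count-suc-at _ _ v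
                (dec-true (in? lab′ (suc i) j v) (v≢root , v≤i , ↦-at lab v))
                (dec-false (in? lab i j v) λ (_ , v<i , _) → <⇒≢ v<i v≡i)
                (others j))))
            where
            lab′ = lab [ v ↦ toℕ j ]
            others : ∀ j u → u ≢ v → does (in? lab′ (suc i) j u) ≡ does (in? lab i j u)
            others j u u≢v = does-⇔ (mk⇔
              (λ (u≢root , u≤i , is) → u≢root , ≤∧≢⇒< (s≤s⁻¹ u≤i) (λ u≡i → u≢v (same-num (trans u≡i (sym v≡i)))) ,
                                       trans (sym (↦-other lab v u≢v)) is)
              (λ (u≢root , u<i , is) → u≢root , m<n⇒m<1+n u<i , trans (↦-other lab v u≢v) is))
              (in? lab′ (suc i) j u) (in? lab i j u)
          ... | no j′≢j = trans (↦-other size j j′≢j) (trans (H j′) (count-cong λ u →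
                does-⇔ (mk⇔ (to u) (from u)) (in? lab i j′ u) (in? lab′ (suc i) j′ u)))
            where
            lab′ = lab [ v ↦ toℕ j ]
            to : ∀ u → In lab i j′ u → In lab′ (suc i) j′ u
            to u (u≢root , u<i , is) = u≢root , m<n⇒m<1+n u<i , trans (↦-other lab v (≢v u<i)) is
            from : ∀ u → In lab′ (suc i) j′ u → In lab i j′ u
            from u (u≢root , u≤i , is) with u ≟ v
            ... | yes refl = contradiction (toℕ-injective (trans (sym is) (↦-at lab v))) j′≢j
            ... | no u≢v = u≢root , ≤∧≢⇒< (s≤s⁻¹ u≤i) (λ u≡i → u≢v (same-num (trans u≡i (sym v≡i)))) ,
                           trans (sym (↦-other lab v u≢v)) is

      initially-labelled : ∀ {lab hd} → Labelled lab hd 0 1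
      initially-labelled = record
        { C<i        = s≤s z≤n
        ; lab<C      = λ v≢root v<1 → contradiction v<1 (late v≢root)
        ; joined     = λ v≢root v<1 → contradiction v<1 (late v≢root)
        ; topped     = λ v≢root v<1 → contradiction v<1 (late v≢root)
        ; tops       = λ ()
        ; top-unique = λ u≢root _ u<1 → contradiction u<1 (late u≢root)
        }
        where
        late : ∀ {v} → v ≢ root → ¬ num v < 1
        late v≢root v<1 = <⇒≱ v<1 (≤-trans (s≤s z≤n) (num-par-all v≢root))

      initial-sizes : ∀ {lab size} → (∀ j → size j ≡ 0) → Sizes lab size 1
      initial-sizes {lab} zeros j = trans (zeros j) (sym (count-false _ λ u → dec-false (in? lab 1 j u)
        λ (u≢root , u<1 , _) → <⇒≱ u<1 (≤-trans (s≤s z≤n) (num-par-all u≢root))))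

      initial-head-counts : ∀ {hd headeds} → (∀ u → headeds u ≡ 0) → HeadCounts hd headeds 0
      initial-head-counts {hd} zeros u = trans (zeros u) (sym (count-false _ λ j → dec-false (headed? hd 0 u j) λ ()))

      module _ {lab hd C} (S : Labelled lab hd C k) (lowering : Lowering low 1) where
        open Labelled S

        -- `head` is the parent of a top rather than the stored word, which is not given as a
        -- vertex; `stored-head` shows that the two agree.
        labels : Labels (DFSTree.tree dfs-tree)
        labels = record
          { C     = C
          ; label = λ v v≢root → fromℕ< (lab<C v≢root (all-visited v))
          ; head  = λ i → par (proj₁ (tops (toℕ<n i)))
          }

        open Labels labels using (label; head; class; headed)
        open LabelProperties labels using (∈class⁺; ∈class⁻)

        toℕ-label : ∀ {v} (v≢root : v ≢ root) → toℕ (label v v≢root) ≡ lab v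
        toℕ-label v≢root = toℕ-fromℕ< (lab<C v≢root (all-visited _))

        C≤n : C ≤ n
        C≤n = ≤-trans (<⇒≤ C<i) k≤n

        cell : Fin C → Fin n
        cell i = inject≤ i C≤n

        stored-head : ∀ i → hd (cell i) ≡ toℕ (head i)
        stored-head i with tops (toℕ<n i)
        ... | v , v≢root , v<k , v≡i , p≤v = topped v≢root v<k p≤v (trans (toℕ-inject≤ i C≤n) (sym v≡i))

        bc-labeling : BCLabeling G (DFSTree.tree dfs-tree)
        bc-labeling = LowPointLabeling.labeling dfs-tree (low-points lowering) labels
          (λ {v} v≢root p≢root v<p → toℕ-injective (trans (toℕ-label v≢root)
            (trans (joined v≢root (all-visited v) v<p) (sym (toℕ-label p≢root)))))
          (λ {v} v≢root p≤v → toℕ-injective (trans (sym (stored-head (label v v≢root)))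
            (topped v≢root (all-visited v) p≤v (trans (toℕ-inject≤ _ C≤n) (toℕ-label v≢root)))))
          (λ i → let v , v≢root , _ , v≡i , p≤v = tops (toℕ<n i)
                 in v , v≢root , toℕ-injective (trans (toℕ-label v≢root) v≡i) , p≤v)
          (λ {u} {v} u≢root v≢root p≤u p≤v same → top-unique u≢root v≢root (all-visited u) (all-visited v) p≤u p≤v
            (trans (sym (toℕ-label u≢root)) (trans (cong toℕ same) (toℕ-label v≢root))))

        stored-size : ∀ {size} → Sizes lab size k → ∀ i → size (cell i) ≡ ∣ class i ∣
        stored-size H i = trans (H (cell i)) (count-cong member)
          where
          member : ∀ v → does (in? lab k (cell i) v) ≡ Labels.has-label labels i v
          member v with v ≟ root
          ... | yes _     = refl
          ... | no v≢root = does-⇔ {A = num v < k × lab v ≡ toℕ (cell i)} (mk⇔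
            (λ (_ , is) → toℕ-injective (trans (toℕ-label v≢root) (trans is (toℕ-inject≤ i C≤n))))
            (λ is → all-visited v , trans (sym (toℕ-label v≢root)) (trans (cong toℕ is) (sym (toℕ-inject≤ i C≤n)))))
            ((num v <? k) ×-dec (lab v ≟ℕ toℕ (cell i))) (label v v≢root ≟ i)

        stored-headed : ∀ {headeds} → HeadCounts hd headeds C → ∀ u → headeds u ≡ ∣ headed u ∣
        stored-headed H u = trans (H u) (count-prefix C≤n _ _
          (λ i → does-⇔ (mk⇔
            (λ is → subst (_< C) (sym (toℕ-inject≤ i C≤n)) (toℕ<n i) , trans (stored-head i) (cong toℕ is))
            (λ (_ , is) → toℕ-injective (trans (sym (stored-head i)) is)))
            (head i ≟ u) (headed? hd C u (cell i)))
          (λ j C≤j → dec-false (headed? hd C u j) λ (j<C , _) → <⇒≱ j<C C≤j))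

-- The program that builds the labeling

zeroV oneV twoV threeV sizeV curV ptrV endV countV wV xV yV parV runV compV : Var
zeroV  = 0
oneV   = 1
twoV   = 2
threeV = 3
sizeV  = 4
curV   = 5
ptrV   = 6
endV   = 7
countV = 8
wV     = 9
xV     = 10
yV     = 11
parV   = 12
runV   = 13
compV  = 14

mov : Var → Var → Code
mov x y = op add x y zeroV

inc : Var → Code
inc x = op add x x oneV

initialise : Code
initialise =
  put numA curV sizeV ⨟
  op add xV curV twoV ⨟ input xV xV ⨟ put savedA curV xV ⨟
  put sizeA curV zeroV ⨟ put headedA curV zeroV ⨟
  inc curV

search-setup : Code
search-setup =
  set curV 0 ⨟ put numA curV zeroV ⨟ put orderA curV zeroV ⨟
  input ptrV twoV ⨟ set countV 1 ⨟ set runV 1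

read-end : Code
read-end = op add xV curV threeV ⨟ input endV xV

read-neighbour : Code
read-neighbour = input wV ptrV ⨟ inc ptrV ⨟ get xV numA wV

leave : Code
leave = if (eq curV zeroV) (set runV 0) (get curV parentA curV ⨟ get ptrV savedA curV)

-- All writes of the search loop happen here, four per discovered vertex. Other inspected entries
-- change registers only.
enter : Code
enter =
  put parentA wV curV ⨟ put numA wV countV ⨟ put orderA countV wV ⨟ put savedA curV ptrV ⨟
  inc countV ⨟ mov curV wV ⨟ get ptrV savedA curV

inspect : Code
inspect = read-neighbour ⨟ if (eq xV sizeV) enter nop

search : Code
search = read-end ⨟ if (eq ptrV endV) leave inspect

own-low-setup : Code
own-low-setup = set curV 0 ⨟ input ptrV twoV ⨟ mov yV sizeV

store-low : Code
store-low = put lowA curV yV ⨟ inc curV ⨟ mov yV sizeV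

compare-low : Code
compare-low = read-neighbour ⨟ if (lt xV yV) (mov yV xV) nop

-- One pointer runs through all adjacency lists, which are contiguous, so the end of one list is the
-- start of the next. The running minimum stays in `yV` until the list ends.
own-low : Code
own-low = read-end ⨟ if (eq ptrV endV) store-low compare-low

propagate-setup : Code
propagate-setup = mov curV countV

-- Decreasing numbers: all children of a vertex have passed on their low points before the vertex
-- passes on its own.
propagate : Code
propagate =
  op sub curV curV oneV ⨟ get wV orderA curV ⨟ get parV parentA wV ⨟
  get xV lowA wV ⨟ get yV lowA parV ⨟
  if (lt xV yV) (put lowA parV xV) nop

assign-setup : Code
assign-setup = set curV 1 ⨟ set compV 0

assign-label : Code
assign-label =
  put labelA wV xV ⨟ get yV sizeA xV ⨟ inc yV ⨟ put sizeA xV yV ⨟ inc curV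

new-label : Code
new-label =
  put headA compV parV ⨟ get yV headedA parV ⨟ inc yV ⨟ put headedA parV yV ⨟
  mov xV compV ⨟ inc compV

assign : Code
assign =
  get wV orderA curV ⨟ get parV parentA wV ⨟ get xV lowA wV ⨟ get yV numA parV ⨟
  if (lt xV yV) (get xV labelA parV) new-label ⨟
  assign-label

loop : Test → Code → Program
loop b p = while (var-test b) (compile p)

locate : ℕ → Program
locate zero    = skip
locate (suc a) = locate a ⨾ alu add (5 + a) (4 + a) (var sizeV)

constants : Program
constants =
  const (var zeroV) 0 ⨾ const (var oneV) 1 ⨾ const (var twoV) 2 ⨾ const (var threeV) 3 ⨾
  -- The last offset, at address `n + 2`, marks the end of the input; the arrays start at its
  -- successor.
  load (var sizeV) (var zeroV) ⨾ alu add 13 (var sizeV) (var twoV) ⨾ load 4 13 ⨾ alu add 4 4 (var oneV)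

prelude : Program
prelude = constants ⨾ locate 8 ⨾ const (var curV) 0

postlude : Program
postlude = const 2 0 ⨾ alu add 3 (var compV) (var zeroV)

labelling-program : Program
labelling-program =
  compile own-low-setup ⨾ loop (lt curV sizeV) own-low ⨾
  compile propagate-setup ⨾ loop (lt oneV curV) propagate ⨾
  compile assign-setup ⨾ loop (lt curV countV) assign ⨾
  postlude

build-program : Program
build-program =
  prelude ⨾ loop (lt curV sizeV) initialise ⨾
  compile search-setup ⨾ loop (lt zeroV runV) search ⨾
  labelling-program

-- Write counts are bounded by invariants of the form `w ≤ a + b * i`: an iteration that raises `i`
-- by 1 may add up to `b` writes.
budget : ∀ {a b i j w} c → c ≤ b → w ≤ a + b * i → j ≡ suc i → c + w ≤ a + b * j
budget {a} {b} {i} {_} {w} c c≤b w≤ refl = begin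
  c + w           ≤⟨ +-mono-≤ c≤b w≤ ⟩
  b + (a + b * i) ≡⟨ +-assoc b a _ ⟨
  b + a + b * i   ≡⟨ cong (_+ b * i) (+-comm b a) ⟩
  a + b + b * i   ≡⟨ +-assoc a b _ ⟩
  a + (b + b * i) ≡⟨ cong (a +_) (*-suc b i) ⟨
  a + b * suc i   ∎
  where open ≤-Reasoning

-- Correctness and cost of the program

module Construction {n-1} (G : Graph (suc n-1)) (conn : Connected G) {ω W} (μ₀ : ℕ → ℕ)
                    (stored : GraphInMemory G ω μ₀) (fits : suc (μ₀ (3 + n-1)) + 9 * suc n-1 ≤ W) where
  open GraphInMemory stored

  private
    E B : ℕ
    E = μ₀ (3 + n-1)
    B = suc E

    off : Fin (suc n-1) → ℕ
    off v = μ₀ (2 + toℕ v)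

  open DFS G off hiding (root)
  open Phases G off
  open Machine W n B μ₀ fits

  ≤B⇒<W : ∀ {x} → x ≤ B → x < W
  ≤B⇒<W x≤B = <-≤-trans (s≤s x≤B) (≤-trans (≤-trans (≤-reflexive (+-comm 1 B)) (+-monoʳ-≤ B (s≤s z≤n))) fits)

  off+deg≤E : ∀ v → off v + deg v ≤ E
  off+deg≤E = partial-sums-mono (λ i → μ₀ (2 + i)) deg next-offset

  E≡ : E ≡ 3 + n + sum deg
  E≡ = trans (partial-sums (λ i → μ₀ (2 + i)) deg next-offset) (cong (_+ sum deg) first-offset)

  3+n≤E : 3 + n ≤ E
  3+n≤E = subst (3 + n ≤_) (sym E≡) (m≤m+n _ _)

  n<W : n < W
  n<W = ≤B⇒<W (≤-trans (m≤n+m n 3) (m≤n⇒m≤1+n 3+n≤E))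

  Constants : (Var → ℕ) → Set
  Constants ρ = ρ zeroV ≡ 0 × ρ oneV ≡ 1 × ρ twoV ≡ 2 × ρ threeV ≡ 3 × ρ sizeV ≡ n

  vertex : ∀ {x} → x < n → ∃[ v ] x ≡ toℕ v
  vertex x<n = fromℕ< x<n , sym (toℕ-fromℕ< x<n)

  plus-one : ∀ {x y} → y ≡ 1 → x + y ≡ suc x
  plus-one {x} refl = +-comm x 1

  plus-zero : ∀ {x y} → y ≡ 0 → x + y ≡ x
  plus-zero {x} refl = +-identityʳ x

  -- Initialisation

  Fresh : Arrays → ℕ → Set
  Fresh A i = ∀ v → toℕ v < i → A numA v ≡ n × A savedA v ≡ off v × A sizeA v ≡ 0 × A headedA v ≡ 0

  Initialising : ℕ → APost
  Initialising μ ρ A w = Constants ρ × ρ curV + μ ≡ n × Fresh A (ρ curV) × w ≤ 0 + 4 * ρ curV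

  initialise-step : ∀ {μ ρ A w} → Initialising (suc μ) ρ A w → ρ curV < ρ sizeV →
                    wpᶜ initialise (Initialising μ) ρ A w
  initialise-step {μ} {ρ} {A} {w} (K@(z , o , t , h , s) , measure , fresh , w≤) cur<size
    with vertex (subst (ρ curV <_) s cur<size)
  ... | v , cur≡v =
    v , cur≡v , ≤B⇒<W (<⇒≤ addr<B) , addr<B , v , cur≡v , v , cur≡v , v , cur≡v ,
    subst (_< W) (sym next) (≤B⇒<W (≤-trans cur<n (≤-trans (m≤n+m n 3) (m≤n⇒m≤1+n 3+n≤E)))) ,
    K , trans (cong (_+ μ) next) (trans (sym (+-suc _ μ)) measure) , fresh′ , budget {0} {4} 4 ≤-refl w≤ next
    where
    cur<n = subst (ρ curV <_) s cur<size
    next : ρ curV + ρ oneV ≡ suc (ρ curV)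
    next = plus-one o

    addr≡ : ρ curV + ρ twoV ≡ 2 + toℕ v
    addr≡ = trans (cong₂ _+_ cur≡v t) (+-comm (toℕ v) 2)

    addr<B : ρ curV + ρ twoV < B
    addr<B = subst (_< B) (sym addr≡) (s≤s (≤-trans (+-monoʳ-≤ 2 (<⇒≤ (toℕ<n v))) (<⇒≤ 3+n≤E)))

    fresh′ : ∀ u → toℕ u < ρ curV + ρ oneV → _
    fresh′ u u< with u ≟ v
    ... | yes refl = trans (↦-at (A numA) v) s , trans (↦-at (A savedA) v) (cong μ₀ addr≡) ,
                     trans (↦-at (A sizeA) v) z , trans (↦-at (A headedA) v) z
    ... | no u≢v with fresh u (≤∧≢⇒< (s≤s⁻¹ (subst (toℕ u <_) next u<)) λ u≡ → u≢v (toℕ-injective (trans u≡ cur≡v)))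
    ...   | a , b , c , d = trans (↦-other (A numA) v u≢v) a , trans (↦-other (A savedA) v u≢v) b ,
                            trans (↦-other (A sizeA) v u≢v) c , trans (↦-other (A headedA) v u≢v) d

  Initialised : APost
  Initialised ρ A w = Constants ρ × Fresh A n × w ≤ 4 * n

  initialise-stop : ∀ {μ ρ A w} → Initialising μ ρ A w → ρ sizeV ≤ ρ curV → Initialised ρ A w
  initialise-stop {μ} {ρ} {A} {w} (K@(z , o , t , h , s) , measure , fresh , w≤) size≤cur =
    K , subst (Fresh A) cur≡n fresh , subst (λ i → w ≤ 4 * i) cur≡n w≤
    where
    cur≡n : ρ curV ≡ n
    cur≡n = ≤-antisym (subst (ρ curV ≤_) measure (m≤m+n _ μ)) (subst (_≤ ρ curV) s size≤cur)

  initialise-last : ∀ {ρ A w} → Initialising 0 ρ A w → ρ sizeV ≤ ρ curV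
  initialise-last ((_ , _ , _ , _ , s) , measure , _) =
    ≤-reflexive (trans s (trans (sym measure) (+-identityʳ _)))

  -- Depth-first search

  Zeroed : Arrays → Set
  Zeroed A = (∀ v → A sizeA v ≡ 0) × (∀ v → A headedA v ≡ 0)

  -- `par` and `scanned` are ghosts. The machine knows the scan positions only through `ptrV` for
  -- the current vertex and `savedA` for the others.
  record Running (a μ : ℕ) (ρ : Var → ℕ) (A : Arrays) (w : ℕ) : Set where
    field
      {par}     : Fin n → Fin n
      {scanned} : Fin n → ℕ
      {cur}     : Fin n
      {k}       : ℕ
      cur≡      : ρ curV ≡ toℕ cur
      ptr≡      : ρ ptrV ≡ off cur + scanned cur
      count≡    : ρ countV ≡ k
      run≡      : ρ runV ≡ 1
      searching : Search (A numA) (A orderA) (A parentA) (A savedA) par scanned cur k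
      measure   : remaining scanned ≡ μ
      writes    : w ≤ a + 4 * k

  Finished : ℕ → APost
  Finished a ρ A w = Σ[ k ∈ ℕ ] Σ[ par ∈ (Fin n → Fin n) ]
    ρ countV ≡ k × Explored (A numA) (A orderA) (A parentA) par k × w ≤ a + 4 * k

  Searching : ℕ → ℕ → APost
  Searching a μ ρ A w = Constants ρ × Zeroed A × (Running a μ ρ A w ⊎ (ρ runV ≡ 0 × Finished a ρ A w))

  -- The current vertex has not been left, so a running search has positive measure.
  search-last : ∀ {a ρ A w} → Searching a 0 ρ A w → ρ runV ≤ ρ zeroV
  search-last (_ , _ , inj₂ (run≡0 , _)) = ≤-trans (≤-reflexive run≡0) z≤n
  search-last (_ , _ , inj₁ R) = contradiction
    (trans (sym measure) (remaining-advance scanned cur (Search.on-path searching self))) λ ()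
    where open Running R

  search-stop : ∀ {a μ ρ A w} → Searching a μ ρ A w → ρ runV ≤ ρ zeroV →
                Constants ρ × Zeroed A × Finished a ρ A w
  search-stop (K , Z , inj₂ (_ , F)) _ = K , Z , F
  search-stop (K@(z , _) , _ , inj₁ R) run≤ with subst₂ _≤_ (Running.run≡ R) z run≤
  ... | ()

  end-address : ∀ {ρ v} → Constants ρ → ρ curV ≡ toℕ v → ρ curV + ρ threeV < B
  end-address {v = v} (_ , _ , _ , h , _) cur≡ =
    subst (_< B) (sym (trans (cong₂ _+_ cur≡ h) (+-comm (toℕ v) 3))) (s≤s (≤-trans (+-monoʳ-≤ 3 (<⇒≤ (toℕ<n v))) 3+n≤E))

  end≡ : ∀ {ρ v} → Constants ρ → ρ curV ≡ toℕ v → μ₀ (ρ curV + ρ threeV) ≡ off v + deg v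
  end≡ {v = v} (_ , _ , _ , h , _) cur≡ =
    trans (cong μ₀ (trans (cong₂ _+_ cur≡ h) (+-comm (toℕ v) 3))) (next-offset v)

  neighbour : ∀ {x v s} (s<deg : s < deg v) → x ≡ off v + s →
              x < B × μ₀ x ≡ toℕ (lookup (adj G v) (fromℕ< s<deg))
  neighbour {v = v} s<deg refl = m≤n⇒m≤1+n (<-≤-trans (+-monoʳ-< (off v) s<deg) (off+deg≤E v)) ,
    trans (cong (λ i → μ₀ (off v + i)) (sym (toℕ-fromℕ< s<deg))) (neighbours v (fromℕ< s<deg))

  search-step : ∀ {a μ ρ A w} → Searching a (suc μ) ρ A w → ρ zeroV < ρ runV → wpᶜ search (Searching a μ) ρ A w
  search-step {ρ = ρ} (_ , _ , inj₂ (run≡0 , _)) 0<run = contradiction (subst (ρ zeroV <_) run≡0 0<run) n≮0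
  search-step {a} {μ} {ρ} {A} {w} (K@(z , o , t , h , s) , Z , inj₁ R) _ =
    ≤B⇒<W (<⇒≤ addr<B) , addr<B ,
    (λ ptr≡end → at-end (+-cancelˡ-≡ (off cur) _ _ (trans (sym ptr≡) (trans ptr≡end end)))) ,
    (λ ptr≢end → scan (≤∧≢⇒< (on-path self) λ full → ptr≢end (trans ptr≡ (trans (cong (off cur +_) full) (sym end)))))
    where
    open Running R
    open Search searching using (on-path; k≤n; cur-visited; parent-array; status)
    addr<B = end-address {ρ} K cur≡
    end = end≡ {ρ} K cur≡
    ρ₁ = ρ [ xV ]≔ (ρ curV + ρ threeV) [ endV ]≔ μ₀ (ρ curV + ρ threeV)
    scanned′ = scanned [ cur ↦ suc (scanned cur) ]

    measure′ : remaining scanned′ ≡ μ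
    measure′ = suc-injective (trans (sym (remaining-advance scanned cur (on-path self))) measure)

    at-end : scanned cur ≡ deg cur →
             wpᶜ leave (Searching a μ) ρ₁ A w
    at-end full =
      (λ cur≡0 → ≤-<-trans z≤n n<W , K , Z , inj₂ (refl , k , par , count≡ ,
        finish searching conn (toℕ-injective (trans (sym cur≡) (trans cur≡0 z))) full , writes)) ,
      (λ cur≢0 → let cur≢root = λ cur≡root → cur≢0 (trans cur≡ (trans (cong toℕ cur≡root) (sym z)))
                     parent≡ = parent-array cur≢root cur-visited
                 in cur , cur≡ , par cur , parent≡ , K , Z , inj₁ (record
                   { cur≡      = parent≡
                   ; ptr≡      = retreat-saved searching cur≢root full
                   ; count≡    = count≡
                   ; run≡      = run≡
                   ; searching = retreat searching cur≢root full
                   ; measure   = measure′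
                   ; writes    = writes
                   }))

    scan : scanned cur < deg cur → wpᶜ inspect (Searching a μ) ρ₁ A w
    scan s<deg = proj₁ found , inc<W , v , proj₂ found ,
      (λ new → discovered (trans new s)) ,
      (λ old → K , Z , inj₁ (record
        { cur≡      = cur≡
        ; ptr≡      = ptr′≡
        ; count≡    = count≡
        ; run≡      = run≡
        ; searching = revisit searching j (toℕ-fromℕ< s<deg) (visited λ v≡n → old (trans v≡n (sym s)))
        ; measure   = measure′
        ; writes    = writes
        }))
      where
      found = neighbour s<deg ptr≡
      j = fromℕ< s<deg
      v = lookup (adj G cur) j

      ptr+1≡ : ρ ptrV + ρ oneV ≡ off cur + suc (scanned cur)
      ptr+1≡ = trans (plus-one o) (trans (cong suc ptr≡) (sym (+-suc (off cur) _)))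

      ptr′≡ : ρ ptrV + ρ oneV ≡ off cur + scanned′ cur
      ptr′≡ = trans ptr+1≡ (cong (off cur +_) (sym (↦-at scanned cur)))

      inc<W : ρ ptrV + ρ oneV < W
      inc<W = ≤B⇒<W (≤-trans (≤-reflexive (plus-one o)) (proj₁ found))

      visited : A numA v ≢ n → A numA v < k
      visited v≢n with status v
      ... | inj₁ v<k       = v<k
      ... | inj₂ (v≡n , _) = contradiction v≡n v≢n

      ρ₂ = ρ₁ [ wV ]≔ μ₀ (ρ ptrV) [ ptrV ]≔ (ρ ptrV + ρ oneV) [ xV ]≔ A numA v

      discovered : A numA v ≡ n → wpᶜ enter (Searching a μ) ρ₂ A w
      discovered v≡n with vertex (unvisited⇒k<n searching v≡n)
      ... | i , k≡i = v , proj₂ found , v , proj₂ found , i , trans count≡ k≡i , cur , cur≡ ,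
          ≤B⇒<W (≤-trans (≤-reflexive count+1≡) (≤-trans (unvisited⇒k<n searching v≡n) (≤-trans (m≤n+m n 3) (m≤n⇒m≤1+n 3+n≤E)))) ,
          subst (_< W) (sym mov≡) (≤B⇒<W (≤-trans (<⇒≤ (toℕ<n v)) (≤-trans (m≤n+m n 3) (m≤n⇒m≤1+n 3+n≤E)))) ,
          v , mov≡ , K , Z , inj₁ (record
            { cur≡      = mov≡
            ; ptr≡      = proj₂ (cast count≡ (proj₂ found) cur≡ ptr+1≡)
            ; count≡    = count+1≡
            ; run≡      = run≡
            ; searching = proj₁ (cast count≡ (proj₂ found) cur≡ ptr+1≡)
            ; measure   = measure′
            ; writes    = budget 4 ≤-refl writes refl
            })
        where
        count+1≡ : ρ countV + ρ oneV ≡ suc k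
        count+1≡ = trans (plus-one o) (cong suc count≡)

        mov≡ : μ₀ (ρ ptrV) + ρ zeroV ≡ toℕ v
        mov≡ = trans (plus-zero z) (proj₂ found)

        -- The invariant speaks of vertices and counts, the machine of register contents.
        -- Generalising the contents lets the equations be matched with `refl`.
        cast : ∀ {x y p q} → x ≡ k → y ≡ toℕ v → p ≡ toℕ cur → q ≡ off cur + suc (scanned cur) →
          Search (A numA [ v ↦ x ]) (A orderA [ i ↦ y ]) (A parentA [ v ↦ p ]) (A savedA [ cur ↦ q ])
                 (par [ v ↦ cur ]) scanned′ v (suc k) ×
          (A savedA [ cur ↦ q ]) v ≡ off v + scanned′ v
        cast refl refl refl refl = discover searching j (toℕ-fromℕ< s<deg) v≡n i (sym k≡i) ,
                                   discover-saved searching j (toℕ-fromℕ< s<deg) v≡n i (sym k≡i)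

  LowUpTo : (Fin n → ℕ) → ∀ u → ℕ → ℕ → Set
  LowUpTo num u s l = (∀ j → toℕ j < s → l ≤ num (lookup (adj G u) j)) × (l ≡ n ⊎ ∃[ j ] num (lookup (adj G u) j) ≡ l)

  -- Each iteration advances exactly one of `curV` and `ptrV` by 1, which gives the measure. The
  -- clause on the current vertex is vacuous once `curV` has reached `n`.
  OwnLow : ℕ → ℕ → (Fin n → Fin n) → ℕ → APost
  OwnLow a k par μ ρ A w =
    Constants ρ × Zeroed A × ρ countV ≡ k × Explored (A numA) (A orderA) (A parentA) par k ×
    (∀ u → toℕ u < ρ curV → LowUpTo (A numA) u (deg u) (A lowA u)) ×
    (∀ v → ρ curV ≡ toℕ v → ∃[ s ] s ≤ deg v × ρ ptrV ≡ off v + s × LowUpTo (A numA) v s (ρ yV)) ×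
    ρ curV ≤ n × μ + (ρ curV + ρ ptrV) ≡ n + E × w ≤ a + 1 * ρ curV

  own-low-last : ∀ {a k par ρ A w} → OwnLow a k par 0 ρ A w → ρ sizeV ≤ ρ curV
  own-low-last {ρ = ρ} ((_ , _ , _ , _ , size) , _ , _ , _ , _ , current , _ , measure , _) =
    ≮⇒≥ λ cur<size → past-end (subst (ρ curV <_) size cur<size)
    where
    past-end : ¬ ρ curV < n
    past-end cur<n with vertex cur<n
    ... | v , cur≡v with current v cur≡v
    ...   | s , s≤ , ptr≡ , _ = <-irrefl measure (+-mono-<-≤ cur<n
            (≤-trans (≤-reflexive ptr≡) (≤-trans (+-monoʳ-≤ (off v) s≤) (off+deg≤E v))))

  own-low-step : ∀ {a k par μ ρ A w} → OwnLow a k par (suc μ) ρ A w → ρ curV < ρ sizeV →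
                 wpᶜ own-low (OwnLow a k par μ) ρ A w
  own-low-step {a} {k} {par} {μ} {ρ} {A} {w}
    (K@(z , o , t , h , size) , Z , count≡ , X , done , current , _ , measure , writes) cur<size
    with vertex (subst (ρ curV <_) size cur<size)
  ... | v , cur≡v with current v cur≡v
  ...   | s , s≤deg , ptr≡ , (below , attained) =
    ≤B⇒<W (<⇒≤ addr<B) , addr<B ,
    (λ ptr≡end → next (+-cancelˡ-≡ (off v) _ _ (trans (sym ptr≡) (trans ptr≡end end))) ptr≡end) ,
    (λ ptr≢end → scan (≤∧≢⇒< s≤deg λ full → ptr≢end (trans ptr≡ (trans (cong (off v +_) full) (sym end)))))
    where
    addr<B = end-address {ρ} K cur≡v
    end = end≡ {ρ} K cur≡v
    cur<n = subst (ρ curV <_) size cur<size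
    ρ₁ = ρ [ xV ]≔ (ρ curV + ρ threeV) [ endV ]≔ μ₀ (ρ curV + ρ threeV)

    cur+1≡ : ρ curV + ρ oneV ≡ suc (ρ curV)
    cur+1≡ = plus-one o

    size+0≡ : ρ sizeV + ρ zeroV ≡ n
    size+0≡ = trans (plus-zero z) size

    next : s ≡ deg v → ρ ptrV ≡ μ₀ (ρ curV + ρ threeV) → wpᶜ store-low (OwnLow a k par μ) ρ₁ A w
    next refl ptr≡end = v , cur≡v ,
      ≤-<-trans (≤-reflexive cur+1≡) (≤-<-trans cur<n n<W) ,
      subst (_< W) (sym size+0≡) n<W ,
      K , Z , count≡ , X , done′ , current′ , ≤-trans (≤-reflexive cur+1≡) cur<n ,
      trans (cong (λ c → μ + (c + ρ ptrV)) cur+1≡) (trans (+-suc μ _) measure) ,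
      budget {a} {1} 1 ≤-refl writes cur+1≡
      where
      done′ : ∀ u → toℕ u < ρ curV + ρ oneV → LowUpTo (A numA) u (deg u) ((A lowA [ v ↦ ρ yV ]) u)
      done′ u u< with u ≟ v
      ... | yes refl = subst (LowUpTo (A numA) v (deg v)) (sym (↦-at (A lowA) v)) (below , attained)
      ... | no u≢v = subst (LowUpTo (A numA) u (deg u)) (sym (↦-other (A lowA) v u≢v))
            (done u (≤∧≢⇒< (s≤s⁻¹ (subst (toℕ u <_) cur+1≡ u<)) λ u≡ → u≢v (toℕ-injective (trans u≡ cur≡v))))

      current′ : ∀ v′ → ρ curV + ρ oneV ≡ toℕ v′ →
                 ∃[ s ] s ≤ deg v′ × ρ ptrV ≡ off v′ + s × LowUpTo (A numA) v′ s (ρ sizeV + ρ zeroV)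
      current′ v′ cur′≡v′ = 0 , z≤n ,
        trans ptr≡end (trans (cong μ₀ (trans (cong (ρ curV +_) h) (trans (+-comm (ρ curV) 3)
          (cong (2 +_) (trans (sym cur+1≡) cur′≡v′))))) (sym (+-identityʳ _))) ,
        (λ _ ()) , inj₁ size+0≡

    scan : s < deg v → wpᶜ compare-low (OwnLow a k par μ) ρ₁ A w
    scan s<deg = proj₁ found , inc<W , u , proj₂ found ,
      (λ x<y → subst (_< W) (sym x+0≡) (<-trans (Explored.all-visited X u) (≤-<-trans (Explored.k≤n X) n<W)) ,
        K , Z , count≡ , X , done ,
        current′ (λ i i< → ≤-trans (≤-reflexive x+0≡) (≤-trans (<⇒≤ x<y) (below i i<)))
                 (≤-reflexive x+0≡) (inj₂ (j , sym x+0≡)) ,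
        <⇒≤ cur<n , measure′ , writes) ,
      (λ y≤x → K , Z , count≡ , X , done , current′ below y≤x attained , <⇒≤ cur<n , measure′ , writes)
      where
      found = neighbour s<deg ptr≡
      j = fromℕ< s<deg
      u = lookup (adj G v) j

      x+0≡ : A numA u + ρ zeroV ≡ A numA u
      x+0≡ = plus-zero z

      inc<W : ρ ptrV + ρ oneV < W
      inc<W = ≤B⇒<W (≤-trans (≤-reflexive (plus-one o)) (proj₁ found))

      measure′ : μ + (ρ curV + (ρ ptrV + ρ oneV)) ≡ n + E
      measure′ = trans (cong (λ p → μ + (ρ curV + p)) (plus-one o))
        (trans (cong (μ +_) (+-suc (ρ curV) (ρ ptrV))) (trans (+-suc μ _) measure))

      current′ : ∀ {l} → (∀ i → toℕ i < s → l ≤ A numA (lookup (adj G v) i)) → l ≤ A numA u →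
                 (l ≡ n ⊎ ∃[ i ] A numA (lookup (adj G v) i) ≡ l) → ∀ v′ → ρ curV ≡ toℕ v′ →
                 ∃[ s ] s ≤ deg v′ × ρ ptrV + ρ oneV ≡ off v′ + s × LowUpTo (A numA) v′ s l
      current′ below′ l≤u attained′ v′ cur≡v′ with toℕ-injective (trans (sym cur≡v) cur≡v′)
      ... | refl = suc s , s<deg , trans (plus-one o) (trans (cong suc ptr≡) (sym (+-suc (off v) s))) ,
                   below″ , attained′
        where
        below″ : ∀ i → toℕ i < suc s → _ ≤ A numA (lookup (adj G v) i)
        below″ i i≤s with m≤n⇒m<n∨m≡n (s≤s⁻¹ i≤s)
        ... | inj₁ i<s = below′ i i<s
        ... | inj₂ i≡s with toℕ-injective {i = i} {j = j} (trans i≡s (sym (toℕ-fromℕ< s<deg)))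
        ...   | refl = l≤u

  Lowered : ℕ → (Fin n → Fin n) → ℕ → (Var → ℕ) → Arrays → Set
  Lowered k par i ρ A = Constants ρ × Zeroed A × ρ countV ≡ k ×
    Σ[ X ∈ Explored (A numA) (A orderA) (A parentA) par k ] Lowering X (A lowA) i

  own-low-stop : ∀ {a k par μ ρ A w} → OwnLow a k par μ ρ A w → ρ sizeV ≤ ρ curV →
                 Lowered k par k ρ A × w ≤ a + 1 * n
  own-low-stop {a} {k} {ρ = ρ} {A} {w} (K@(_ , _ , _ , _ , size) , Z , count≡ , X , done , _ , cur≤n , _ , writes) size≤cur =
    (K , Z , count≡ , X , record
      { low-edge = λ {u} e → low-edge u (neighbour-index e)
      ; low-par  = λ {v} _ k≤v → contradiction k≤v (<⇒≱ (Explored.all-visited X v))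
      ; attained = λ u → attained (proj₂ (low u))
      }) ,
    subst (λ i → w ≤ a + 1 * i) cur≡n writes
    where
    cur≡n : ρ curV ≡ n
    cur≡n = ≤-antisym cur≤n (subst (_≤ ρ curV) size size≤cur)

    low : ∀ u → LowUpTo (A numA) u (deg u) (A lowA u)
    low u = done u (subst (toℕ u <_) (sym cur≡n) (toℕ<n u))

    low-edge : ∀ u {v} → ∃[ j ] lookup (adj G u) j ≡ v → A lowA u ≤ A numA v
    low-edge u (j , refl) = proj₁ (low u) j (toℕ<n j)

    attained : ∀ {u} → (A lowA u ≡ n ⊎ ∃[ j ] A numA (lookup (adj G u) j) ≡ A lowA u) → Attained X (A lowA) u
    attained (inj₁ low≡n)         = inj₁ low≡n
    attained {u} (inj₂ (j , low≡)) = inj₂ (u , lookup (adj G u) j , self , ∈-lookup j , low≡)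

  -- `curV` is decremented before use, so it holds the number of the last vertex done. The sum of
  -- writes and `curV` never grows, as an iteration writes at most once.
  Propagating : ℕ → ℕ → (Fin n → Fin n) → ℕ → APost
  Propagating a k par μ ρ A w =
    Lowered k par (suc μ) ρ A × ρ curV ≡ suc μ × suc μ ≤ k × w + suc μ ≤ a + k

  propagate-last : ∀ {a k par ρ A w} → Propagating a k par 0 ρ A w → ρ curV ≤ ρ oneV
  propagate-last (((_ , o , _) , _) , cur≡ , _) = ≤-reflexive (trans cur≡ (sym o))

  propagate-stop : ∀ {a k par μ ρ A w} → Propagating a k par μ ρ A w → ρ curV ≤ ρ oneV →
                   Lowered k par 1 ρ A × w ≤ a + k
  propagate-stop {μ = μ} (L@((_ , o , _) , _) , cur≡ , _ , writes) cur≤1 with subst₂ _≤_ cur≡ o cur≤1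
  propagate-stop {μ = zero} (L , _ , _ , writes) _ | _ = L , ≤-trans (m≤m+n _ 1) writes
  propagate-stop {μ = suc μ} _ _ | s≤s ()

  propagate-step : ∀ {a k par μ ρ A w} → Propagating a k par (suc μ) ρ A w → ρ oneV < ρ curV →
                   wpᶜ propagate (Propagating a k par μ) ρ A w
  propagate-step {a} {k} {par} {μ} {ρ} {A} {w}
    ((K@(z , o , t , h , size) , Z , count≡ , X , S) , cur≡ , i≤k , writes) _
    with vertex (≤-trans i≤k (Explored.k≤n X))
  ... | i , i≡ with Explored.ordered X i (subst (_< k) i≡ i≤k)
  ...   | v , v≡i , order≡ =
    subst (_< W) (sym cur-1≡) (<-trans i≤k (≤-<-trans (Explored.k≤n X) n<W)) ,
    i , trans cur-1≡ i≡ , v , order≡ , v , order≡ , par v , parent≡ ,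
    (λ v<p → par v , parent≡ ,
      (K , Z , count≡ , X , lower X S v≡μ v≢root v<p) , cur-1≡ , <⇒≤ i≤k ,
      ≤-trans (≤-reflexive (sym (+-suc w (suc μ)))) writes) ,
    (λ p≤v → (K , Z , count≡ , X , keep X S v≡μ v≢root p≤v) , cur-1≡ , <⇒≤ i≤k ,
      ≤-trans (+-monoʳ-≤ w (n≤1+n (suc μ))) writes)
    where
    cur-1≡ : ρ curV ∸ ρ oneV ≡ suc μ
    cur-1≡ = cong₂ _∸_ cur≡ o

    v≡μ : A numA v ≡ suc μ
    v≡μ = trans v≡i (sym i≡)

    v≢root : v ≢ zero
    v≢root = nonroot X (subst (0 <_) (sym v≡μ) (s≤s z≤n))

    parent≡ : A parentA v ≡ toℕ (par v)
    parent≡ = Explored.parent-array X v≢root (Explored.all-visited X v)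

  -- Labels

  Assigning : ℕ → ℕ → (Fin n → Fin n) → ℕ → APost
  Assigning a k par μ ρ A w =
    Constants ρ × ρ countV ≡ k × ρ curV + μ ≡ k ×
    Σ[ X ∈ Explored (A numA) (A orderA) (A parentA) par k ] Lowering X (A lowA) 1 ×
    Σ[ C ∈ ℕ ] ρ compV ≡ C ×
    Labelling.Labelled X (A lowA) (A labelA) (A headA) C (ρ curV) ×
    Labelling.Sizes X (A lowA) (A labelA) (A sizeA) (ρ curV) ×
    Labelling.HeadCounts X (A lowA) (A headA) (A headedA) C ×
    w ≤ a + 4 * ρ curV

  -- The counters are cardinalities of sets of vertices or of label cells, so they are at most `n`
  -- and their increments fit in a word.
  count+1<W : ∀ {x y} (f : Fin n → Bool) → x ≡ count f → y ≡ 1 → x + y < W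
  count+1<W f refl refl =
    ≤B⇒<W (≤-trans (≤-reflexive (+-comm _ 1)) (≤-trans (s≤s (∣p∣≤n (Vec-tabulate f))) (s≤s (≤-trans (m≤n+m n 3) 3+n≤E))))

  assign-last : ∀ {a k par ρ A w} → Assigning a k par 0 ρ A w → ρ countV ≤ ρ curV
  assign-last (_ , count≡ , measure , _) = ≤-reflexive (trans count≡ (trans (sym measure) (+-identityʳ _)))

  -- Common tail of both branches. `S` describes the labels before `v` gets its own, with the heads
  -- `hd` of that moment, and feeds the size counts; `S′` uses the current heads, to which the new
  -- one may have been added.
  assign-label-step : ∀ {a k par μ ρ A w v j C C′ hd} (X : Explored (A numA) (A orderA) (A parentA) par k) →
    Constants ρ → ρ countV ≡ k → ρ curV + suc μ ≡ k → Lowering X (A lowA) 1 →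
    A numA v ≡ ρ curV → v ≢ zero → ρ wV ≡ toℕ v → ρ xV ≡ toℕ j → ρ compV ≡ C →
    Labelling.Labelled X (A lowA) (A labelA) hd C′ (ρ curV) →
    Labelling.Labelled X (A lowA) (A labelA [ v ↦ ρ xV ]) (A headA) C (suc (ρ curV)) →
    Labelling.Sizes X (A lowA) (A labelA) (A sizeA) (ρ curV) →
    Labelling.HeadCounts X (A lowA) (A headA) (A headedA) C →
    2 + w ≤ a + 4 * suc (ρ curV) → wpᶜ assign-label (Assigning a k par μ) ρ A w
  assign-label-step {a} {k} {par} {μ} {ρ} {A} {w} {v} {j} {C} X K@(z , o , _) count≡ measure low
    v≡cur v≢root w≡v x≡j comp≡ S S′ sizes heads writes =
    v , w≡v , j , x≡j , count+1<W (λ u → does (Labelling.in? X (A lowA) (A labelA) (ρ curV) j u)) (sizes j) o , j , x≡j ,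
    ≤-<-trans (≤-reflexive cur+1≡) (≤-<-trans cur<k (≤-<-trans (Explored.k≤n X) n<W)) ,
    K , count≡ , trans (cong (_+ μ) cur+1≡) (trans (sym (+-suc _ μ)) measure) , X , low , C , comp≡ ,
    subst (Labelling.Labelled X (A lowA) (A labelA [ v ↦ ρ xV ]) (A headA) C) (sym cur+1≡) S′ ,
    cast x≡j (plus-one o) cur+1≡ , heads ,
    subst (λ i → 2 + w ≤ a + 4 * i) (sym cur+1≡) writes
    where
    cur+1≡ : ρ curV + ρ oneV ≡ suc (ρ curV)
    cur+1≡ = plus-one o

    cur<k : suc (ρ curV) ≤ k
    cur<k = ≤-trans (m≤m+n (suc (ρ curV)) μ) (≤-reflexive (trans (sym (+-suc _ μ)) measure))

    cast : ∀ {x y i} → x ≡ toℕ j → y ≡ suc (A sizeA j) → i ≡ suc (ρ curV) →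
           Labelling.Sizes X (A lowA) (A labelA [ v ↦ x ]) (A sizeA [ j ↦ y ]) i
    cast refl refl refl = Labelling.sizes X (A lowA) S v≡cur v≢root j sizes

  assign-step : ∀ {a k par μ ρ A w} → Assigning a k par (suc μ) ρ A w → ρ curV < ρ countV →
                wpᶜ assign (Assigning a k par μ) ρ A w
  assign-step {a} {k} {par} {μ} {ρ} {A} {w}
    (K@(z , o , t , h , size) , count≡ , measure , X , low , C , comp≡ , S , sizes , heads , writes) cur<count
    with vertex (<-≤-trans (subst (ρ curV <_) count≡ cur<count) (Explored.k≤n X))
  ... | i , cur≡i with Explored.ordered X i (subst₂ _<_ cur≡i count≡ cur<count)
  ...   | v , v≡i , order≡ =
    i , cur≡i , v , order≡ , v , order≡ , par v , parent≡ ,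
    join ,
    new
    where
    open Explored X using (k≤n; parent-array; all-visited)
    module Lab = Labelling X (A lowA)

    v≡cur : A numA v ≡ ρ curV
    v≡cur = trans v≡i (sym cur≡i)

    v≢root : v ≢ zero
    v≢root = nonroot X (subst (0 <_) (sym v≡cur) (≤-trans (s≤s z≤n) (Lab.Labelled.C<i S)))

    parent≡ : A parentA v ≡ toℕ (par v)
    parent≡ = parent-array v≢root (all-visited v)

    cur<n : ρ curV < n
    cur<n = <-≤-trans (subst (ρ curV <_) count≡ cur<count) k≤n

    ρ₁ = ρ [ wV ]≔ A orderA i [ parV ]≔ A parentA v [ xV ]≔ A lowA v [ yV ]≔ A numA (par v)

    join : A lowA v < A numA (par v) → wpᶜ (get xV labelA parV ⨟ assign-label) (Assigning a k par μ) ρ₁ A w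
    join v<p with vertex (<-trans (Lab.Labelled.lab<C S (Lab.parent-nonroot S v≡cur v≢root v<p) (Lab.parent-done S v≡cur v≢root))
                           (<-trans (Lab.Labelled.C<i S) cur<n))
    ... | j , lab≡j = par v , parent≡ ,
      assign-label-step {a} {ρ = ρ₁ [ xV ]≔ A labelA (par v)} {A} X K count≡ measure low v≡cur v≢root order≡ lab≡j comp≡ S
        (Lab.label-joined S v≡cur v≢root v<p) sizes heads (budget {a} {4} 2 (s≤s (s≤s z≤n)) writes refl)

    new : A numA (par v) ≤ A lowA v → wpᶜ (new-label ⨟ assign-label) (Assigning a k par μ) ρ₁ A w
    new p≤v with vertex (<-trans (Lab.Labelled.C<i S) cur<n)
    ... | c , C≡c = c , trans comp≡ C≡c , par v , parent≡ ,
      count+1<W (λ b → does (Lab.headed? (A headA) C (par v) b)) (heads (par v)) o , par v , parent≡ ,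
      subst (_< W) (sym comp+0≡) C<W ,
      ≤-<-trans (≤-reflexive comp+1≡) (<-trans (≤-<-trans (Lab.Labelled.C<i S) cur<n) n<W) ,
      assign-label-step {a} {ρ = ρ₂} {A₂} X K count≡ measure low v≡cur v≢root order≡ (trans comp+0≡ C≡c) comp+1≡ S
        (proj₁ (cast comp+0≡ parent≡ (plus-one o))) sizes (proj₂ (cast comp+0≡ parent≡ (plus-one o)))
        (budget {a} {4} 4 ≤-refl writes refl)
      where
      ρ₂ = ρ₁ [ yV ]≔ A headedA (par v) [ yV ]≔ (A headedA (par v) + ρ oneV)
              [ xV ]≔ (ρ compV + ρ zeroV) [ compV ]≔ (ρ compV + ρ oneV)
      A₂ = write (write A headA c (A parentA v)) headedA (par v) (A headedA (par v) + ρ oneV)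

      comp+0≡ : ρ compV + ρ zeroV ≡ C
      comp+0≡ = trans (plus-zero z) comp≡

      comp+1≡ : ρ compV + ρ oneV ≡ suc C
      comp+1≡ = trans (plus-one o) (cong suc comp≡)

      C<W : C < W
      C<W = <-trans (Lab.Labelled.C<i S) (<-trans cur<n n<W)

      cast : ∀ {x p y} → x ≡ C → p ≡ toℕ (par v) → y ≡ suc (A headedA (par v)) →
             Lab.Labelled (A labelA [ v ↦ x ]) (A headA [ c ↦ p ]) (suc C) (suc (ρ curV)) ×
             Lab.HeadCounts (A headA [ c ↦ p ]) (A headedA [ par v ↦ y ]) (suc C)
      cast refl refl refl = Lab.label-top S v≡cur v≢root c (sym C≡c) p≤v ,
                            Lab.head-counts S v≡cur v≢root c (sym C≡c) heads

  Assigned : ℕ → ℕ → (Fin n → Fin n) → APost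
  Assigned a k par ρ A w =
    ρ zeroV ≡ 0 ×
    Σ[ X ∈ Explored (A numA) (A orderA) (A parentA) par k ] Lowering X (A lowA) 1 ×
    Labelling.Labelled X (A lowA) (A labelA) (A headA) (ρ compV) k ×
    Labelling.Sizes X (A lowA) (A labelA) (A sizeA) k ×
    Labelling.HeadCounts X (A lowA) (A headA) (A headedA) (ρ compV) ×
    w ≤ a + 4 * k

  assign-stop : ∀ {a k par μ ρ A w} → Assigning a k par μ ρ A w → ρ countV ≤ ρ curV → Assigned a k par ρ A w
  assign-stop {μ = μ} {ρ} ((z , _) , refl , measure , X , low , _ , refl , S , sizes , heads , writes) count≤cur
    with ≤-antisym (subst (ρ curV ≤_) measure (m≤m+n _ μ)) count≤cur
  ... | cur≡count rewrite cur≡count = z , X , low , S , sizes , heads , writes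

  N : ℕ
  N = n + sum deg

  -- Operation counts are kept affine in `N`, which bounds the iterations of every loop. Sequencing
  -- then adds both coefficients, and a loop contributes its body to the second.
  record Bounded (p : Program) (x y : ℕ) (Q : Post) (c m : ℕ → ℕ) (w : ℕ) : Set where
    constructor bounded
    field terminates : Terminates W p (x + N * y) Q c m w

  infixr 4 _andThen_

  _andThen_ : ∀ {p q x x′ y y′ Q R c m w} → Bounded p x y (Concrete Q) c m w →
    (∀ {c m w ρ A} → Represents c m ρ A → Q ρ A w → Bounded q x′ y′ R c m w) →
    Bounded (p ⨾ q) (x + x′) (y + y′) R c m w
  _andThen_ {p} {q} {x} {x′} {y} {y′} {Q} {R} (bounded run) rest = bounded
    (weaken {t = x + N * y + (x′ + N * y′)} {Q = R} {R} (≤-reflexive time≡) (λ post → post)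
      (seq-terminates {Q = R} (weaken {Q = Concrete Q} {Terminates W q (x′ + N * y′) R} ≤-refl
        (λ (_ , _ , S , post) → Bounded.terminates (rest S post)) run)))
    where
    time≡ : x + N * y + (x′ + N * y′) ≡ x + x′ + N * (y + y′)
    time≡ = begin
      x + N * y + (x′ + N * y′)   ≡⟨ +-assoc x _ _ ⟩
      x + (N * y + (x′ + N * y′)) ≡⟨ cong (x +_) (sym (+-assoc (N * y) x′ _)) ⟩
      x + (N * y + x′ + N * y′)   ≡⟨ cong (λ s → x + (s + N * y′)) (+-comm (N * y) x′) ⟩
      x + (x′ + N * y + N * y′)   ≡⟨ cong (x +_) (+-assoc x′ _ _) ⟩
      x + (x′ + (N * y + N * y′)) ≡⟨ sym (+-assoc x x′ _) ⟩
      x + x′ + (N * y + N * y′)   ≡⟨ cong (x + x′ +_) (sym (*-distribˡ-+ N y y′)) ⟩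
      x + x′ + N * (y + y′)       ∎
      where open ≡-Reasoning

  straight : ∀ p {Q c m w ρ A} → Represents c m ρ A → wpᶜ p Q ρ A w →
             Bounded (compile p) (time (compile p)) 0 (Concrete Q) c m w
  straight p {Q} R pre = bounded (weaken {Q = Concrete Q} {Concrete Q} (m≤m+n _ _) (λ post → post) (code-terminates p R pre))

  looping : ∀ {b p Q} (I : ℕ → APost) →
    (∀ {ρ A w} → I 0 ρ A w → Fails b ρ) →
    (∀ {k ρ A w} → I (suc k) ρ A w → Holds b ρ → wpᶜ p (I k) ρ A w) →
    (∀ {k ρ A w} → I k ρ A w → Fails b ρ → Q ρ A w) →
    ∀ k {c m w ρ A} → k ≤ N → Represents c m ρ A → I k ρ A w →
    Bounded (loop b p) 1 (suc (time (compile p))) (Concrete Q) c m w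
  looping {b} {p} {Q} I last step stop k k≤N R inv =
    bounded (weaken {Q = Concrete Q} {Concrete Q} (+-monoʳ-≤ 1 (*-monoˡ-≤ _ k≤N)) (λ post → post)
      (loop-terminates {b} {p} {Q} I last step stop k R inv))

  small : ∀ {x} → x ≤ 3 → x < W
  small x≤3 = ≤B⇒<W (≤-trans x≤3 (≤-trans (m≤m+n 3 n) (m≤n⇒m≤1+n 3+n≤E)))

  n≤N : n ≤ N
  n≤N = m≤m+n n _

  Located : ℕ → Post
  Located j c m w =
    Constants (λ x → c (var x)) × (∀ {a} → a ≤ j → c (4 + a) ≡ B + n * a) × m ≡ μ₀ × w ≡ 0

  locate-wp : ∀ j → j ≤ 8 → ∀ c m w → Located 0 c m w → wp W (locate j) (Located j) c m w
  locate-wp zero    _ c m w found = found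
  locate-wp (suc j) j<8 c m w found = wp-mono (locate j) {Located j} {wp W (alu add (5 + j) (4 + j) (var sizeV)) (Located (suc j))}
    (λ {c} {m} {w} → next c m w) (locate-wp j (<⇒≤ j<8) c m w found)
    where
    next : ∀ c m w → Located j c m w → wp W (alu add (5 + j) (4 + j) (var sizeV)) (Located (suc j)) c m w
    next c m w ((z , o , t , h , size) , at , m≡ , w≡) = subst (_< W) (sym sum≡) fit ,
      (unchanged z , unchanged o , unchanged t , unchanged h , unchanged size) , at′ , m≡ , w≡
      where
      x = c (4 + j) + c (var sizeV)

      sum≡ : x ≡ B + n * suc j
      sum≡ = trans (cong₂ _+_ (at ≤-refl) size)
        (trans (+-assoc B (n * j) n) (cong (B +_) (trans (+-comm (n * j) n) (sym (*-suc n j)))))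

      fit : B + n * suc j < W
      fit = <-≤-trans (+-monoʳ-< B (<-≤-trans (*-monoʳ-< n (s≤s j<8)) (≤-reflexive (*-comm n 9)))) fits

      -- The register written is at most 12, while the variables start at 14.
      unchanged : ∀ {i y} → c (var i) ≡ y → (c [ 5 + j ]≔ x) (var i) ≡ y
      unchanged {i} = trans (≔-other c x λ same → <⇒≢ (+-monoʳ-≤ 5 (≤-trans j<8 (m≤m+n 8 (suc i)))) (sym same))

      at′ : ∀ {a} → a ≤ suc j → (c [ 5 + j ]≔ x) (4 + a) ≡ B + n * a
      at′ a≤ with m≤n⇒m<n∨m≡n a≤
      ... | inj₁ a<   = trans (≔-other c x λ same → <⇒≢ (+-monoʳ-≤ 4 a<) same) (at (s≤s⁻¹ a<))
      ... | inj₂ refl = trans (≔-same c x refl) sum≡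

  constants-wp : ∀ c → wp W constants (Located 0) c μ₀ 0
  constants-wp c =
    small z≤n , small (s≤s z≤n) , small (s≤s (s≤s z≤n)) , small ≤-refl ,
    ≤B⇒<W (≤-trans (≤-reflexive size+2≡) (≤-trans (n≤1+n _) (m≤n⇒m≤1+n 3+n≤E))) ,
    subst (_< W) (sym base≡) (≤-<-trans (+-monoʳ-≤ B (≤-reflexive (*-zeroʳ n))) (≤B⇒<W (≤-reflexive (+-identityʳ B)))) ,
    (refl , refl , refl , refl , vertex-count) , (λ { z≤n → base≡ }) , refl , refl
    where
    size+2≡ : μ₀ 0 + 2 ≡ 2 + n
    size+2≡ = trans (cong (_+ 2) vertex-count) (+-comm n 2)

    base≡ : μ₀ (μ₀ 0 + 2) + 1 ≡ B + n * 0
    base≡ = trans (cong (λ i → μ₀ i + 1) size+2≡)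
      (trans (+-comm E 1) (sym (trans (cong (B +_) (*-zeroʳ n)) (+-identityʳ B))))

  initial : ∀ c m w → Located 8 c m w → wp W (const (var curV) 0) (Concrete (Initialising n)) c m w
  initial c m w (K , at , refl , refl) = small z≤n , (λ x → c′ (var x)) , (λ a v → m (address a v)) ,
    record { vars = λ _ → refl ; bases = bases ; inputs = λ _ _ → refl ; arrays = λ _ _ → refl } ,
    K , refl , (λ _ ()) , z≤n
    where
    c′ = c [ var curV ]≔ 0
    bases : ∀ a → c′ (4 + toℕ a) ≡ base a
    bases a = trans (≔-other c 0 (<⇒≢ (+-monoʳ-≤ 5 (≤-trans (s≤s⁻¹ (toℕ<n a)) (m≤m+n 8 6))))) (at (s≤s⁻¹ (toℕ<n a)))

  prelude-terminates : ∀ c → Terminates W prelude 17 (Concrete (Initialising n)) c μ₀ 0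
  prelude-terminates c =
    seq-terminates {Q = Concrete (Initialising n)} (weaken {Q = Located 0}
      {R = Terminates W (locate 8 ⨾ const (var curV) 0) 9 (Concrete (Initialising n))} ≤-refl
      (λ {c} {m} {w} found → seq-terminates {Q = Concrete (Initialising n)}
        (weaken {Q = Located 8} {R = Terminates W (const (var curV) 0) 1 (Concrete (Initialising n))} ≤-refl
        (λ {c} {m} {w} found → wp-sound (const (var curV) 0) {Concrete (Initialising n)} (initial c m w found))
        (wp-sound (locate 8) {Located 8} (locate-wp 8 ≤-refl c m w found))))
      (wp-sound constants {Located 0} (constants-wp c)))

  root-offset≤ : ∀ {x} → x ≡ 2 → x < B
  root-offset≤ refl = s≤s (≤-trans (s≤s (s≤s z≤n)) 3+n≤E)

  search-setup-wp : ∀ {ρ A w} → Initialised ρ A w →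
                    wpᶜ search-setup (Searching (4 * n) (remaining λ _ → 0)) ρ A w
  search-setup-wp {ρ} {A} {w} (K@(z , o , t , h , size) , fresh , writes) =
    small z≤n , zero , refl , zero , refl , root-offset≤ t , small (s≤s z≤n) , small (s≤s z≤n) ,
    K , (zeros , λ v → proj₂ (proj₂ (proj₂ (fresh v (toℕ<n v))))) , inj₁ (record
      { cur≡      = refl
      ; ptr≡      = trans (cong μ₀ t) (sym (+-identityʳ _))
      ; count≡    = refl
      ; run≡      = refl
      ; searching = start z (λ {u} u≢root → trans (↦-other (A numA) zero u≢root) (proj₁ (fresh u (toℕ<n u))))
                      z (λ u → proj₁ (proj₂ (fresh u (toℕ<n u))))
      ; measure   = refl
      ; writes    = ≤-trans (+-mono-≤ {2} {4} (s≤s (s≤s z≤n)) writes) (≤-reflexive (+-comm 4 (4 * n)))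
      })
    where
    zeros : ∀ v → A sizeA v ≡ 0
    zeros v = proj₁ (proj₂ (proj₂ (fresh v (toℕ<n v))))

  own-low-setup-wp : ∀ {a k par ρ A w} → Constants ρ → Zeroed A → ρ countV ≡ k →
    Explored (A numA) (A orderA) (A parentA) par k → w ≤ a → wpᶜ own-low-setup (OwnLow a k par N) ρ A w
  own-low-setup-wp {a} {ρ = ρ} {A} K@(z , o , t , h , size) Z count≡ X writes =
    small z≤n , root-offset≤ t , subst (_< W) (sym size+0≡) n<W ,
    K , Z , count≡ , X , (λ _ ()) , current , z≤n , measure ,
    ≤-trans writes (m≤m+n a _)
    where
    size+0≡ : ρ sizeV + ρ zeroV ≡ n
    size+0≡ = trans (plus-zero z) size

    current : ∀ v → 0 ≡ toℕ v → ∃[ s ] s ≤ deg v × μ₀ (ρ twoV) ≡ off v + s × LowUpTo (A numA) v s (ρ sizeV + ρ zeroV)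
    current zero _ = 0 , z≤n , trans (cong μ₀ t) (sym (+-identityʳ _)) , (λ _ ()) , inj₁ size+0≡

    measure : N + μ₀ (ρ twoV) ≡ n + E
    measure = begin
      n + sum deg + μ₀ (ρ twoV)  ≡⟨ cong (λ x → n + sum deg + x) (trans (cong μ₀ t) first-offset) ⟩
      n + sum deg + (3 + n)      ≡⟨ +-assoc n (sum deg) (3 + n) ⟩
      n + (sum deg + (3 + n))    ≡⟨ cong (n +_) (+-comm (sum deg) (3 + n)) ⟩
      n + (3 + n + sum deg)      ≡⟨ cong (n +_) (sym E≡) ⟩
      n + E                      ∎
      where open ≡-Reasoning

  propagate-setup-wp : ∀ {a μ par ρ A w} → Lowered (suc μ) par (suc μ) ρ A → w ≤ a →
                       wpᶜ propagate-setup (Propagating a (suc μ) par μ) ρ A w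
  propagate-setup-wp {ρ = ρ} L@((z , _) , _ , count≡ , X , _) writes =
    subst (_< W) (sym count+0≡) (≤-<-trans (Explored.k≤n X) n<W) , L , count+0≡ , ≤-refl , +-monoˡ-≤ _ writes
    where
    count+0≡ : ρ countV + ρ zeroV ≡ _
    count+0≡ = trans (plus-zero z) count≡

  assign-setup-wp : ∀ {a μ par ρ A w} → Lowered (suc μ) par 1 ρ A → w ≤ a →
                    wpᶜ assign-setup (Assigning a (suc μ) par μ) ρ A w
  assign-setup-wp {a} {ρ = ρ} {A} (K , (sizes , heads) , count≡ , X , low) writes =
    small (s≤s z≤n) , small z≤n , K , count≡ , refl , X , low , 0 , refl ,
    Lab.initially-labelled {A labelA} {A headA} , Lab.initial-sizes {A labelA} sizes , Lab.initial-head-counts {A headA} heads ,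
    ≤-trans writes (m≤m+n a 4)
    where module Lab = Labelling X (A lowA)

  Result : Post
  Result c m w = w ≤ 14 * n ×
    Σ[ T ∈ RootedSpanningTree G ] Σ[ L ∈ BCLabeling G T ] LabelingInMemory W L ⟨ c , m ⟩

  cell : ∀ {c m ρ A} → Represents c m ρ A → ∀ a v {x} → A a v ≡ x → Cell W m (c (4 + toℕ a) + toℕ v) x
  cell {m = m} R a v stored≡ =
    subst (_< W) (sym at) (address<W a v) , trans (cong m at) (trans (Represents.arrays R a v) stored≡)
    where at = cong (_+ toℕ v) (Represents.bases R a)

  cell-inject : ∀ {c m ρ A} → Represents c m ρ A → ∀ a {k} (i : Fin k) (k≤n : k ≤ n) {x} →
                A a (inject≤ i k≤n) ≡ x → Cell W m (c (4 + toℕ a) + toℕ i) x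
  cell-inject {c} {m} R a i k≤n {x} stored≡ =
    subst (λ j → Cell W m (c (4 + toℕ a) + j) x) (toℕ-inject≤ i k≤n) (cell R a (inject≤ i k≤n) stored≡)

  postlude-terminates : ∀ {a k par c m ρ A w} → a + 4 * n ≤ 14 * n → Represents c m ρ A →
                        Assigned a k par ρ A w → Bounded postlude 2 0 Result c m w
  postlude-terminates {a} {c = c} {m} {ρ} {A} {w} a≤ R (z , X , low , S , sizes , heads , writes) =
    bounded (weaken {Q = Result} {Result} (m≤m+n 2 _) (λ post → post) (wp-sound postlude {Result}
      ( small z≤n , subst (_< W) (sym comp≡) (≤-<-trans C≤n n<W)
      , ≤-trans writes (≤-trans (+-monoʳ-≤ a (*-monoʳ-≤ 4 (Explored.k≤n X))) a≤)
      , _ , bc-labeling , record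
        { root-word    = refl
        ; count-word   = comp≡
        ; parent-array = λ v v≢root → cell R parentA v (Explored.parent-array X v≢root (Explored.all-visited X v))
        ; label-array  = λ v v≢root → cell R labelA v (sym (toℕ-label v≢root))
        ; head-array   = λ i → cell-inject R headA i C≤n (stored-head i)
        ; size-array   = λ i → cell-inject R sizeA i C≤n (stored-size sizes i)
        ; headed-array = λ v → cell R headedA v (stored-headed heads v)
        })))
    where
    module Final = Labelling X (A lowA)
    bc-labeling  = Final.bc-labeling S low
    C≤n          = Final.C≤n S low
    toℕ-label    = λ {v} → Final.toℕ-label S low {v}
    stored-head  = Final.stored-head S low
    stored-size  = λ {size} → Final.stored-size S low {size}
    stored-headed = λ {headeds} → Final.stored-headed S low {headeds}

    comp≡ : c (var compV) + c (var zeroV) ≡ ρ compV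
    comp≡ = trans (cong₂ _+_ (Represents.vars R compV) (trans (Represents.vars R zeroV) z)) (+-identityʳ _)

  remaining≤N : remaining (λ _ → 0) ≤ N
  remaining≤N = ≤-reflexive (sum-suc deg)

  -- Running write bounds: `4 * n` for the initialisation and again for the search, `n` for the own
  -- low points, `n` for passing them on. The assignment of labels adds another `4 * n`.
  8n 9n 10n : ℕ
  8n  = 4 * n + 4 * n
  9n  = 8n + 1 * n
  10n = 9n + n

  total-writes : 10n + 4 * n ≤ 14 * n
  total-writes = ≤-reflexive (begin
    4 * n + 4 * n + 1 * n + n + 4 * n ≡⟨ cong (λ x → 4 * n + 4 * n + 1 * n + x + 4 * n) (sym (*-identityˡ n)) ⟩
    4 * n + 4 * n + 1 * n + 1 * n + 4 * n ≡⟨ cong (λ x → x + 1 * n + 1 * n + 4 * n) (sym (*-distribʳ-+ n 4 4)) ⟩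
    8 * n + 1 * n + 1 * n + 4 * n ≡⟨ cong (λ x → x + 1 * n + 4 * n) (sym (*-distribʳ-+ n 8 1)) ⟩
    9 * n + 1 * n + 4 * n ≡⟨ cong (_+ 4 * n) (sym (*-distribʳ-+ n 9 1)) ⟩
    10 * n + 4 * n ≡⟨ sym (*-distribʳ-+ n 10 4) ⟩
    14 * n ∎)
    where open ≡-Reasoning


  Searched : APost
  Searched ρ A w = Constants ρ × Zeroed A × Finished (4 * n) ρ A w

  module _ {c m ρ A} {w : ℕ} (R : Represents c m ρ A) where

    initialise-loop : Initialising n ρ A w →
      Bounded (loop (lt curV sizeV) initialise) 1 (suc (time (compile initialise))) (Concrete Initialised) c m w
    initialise-loop = looping {lt curV sizeV} {initialise} {Initialised} Initialising
      (λ {ρ} {A} {w} → initialise-last {ρ} {A} {w})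
      (λ {k} {ρ} {A} {w} → initialise-step {k} {ρ} {A} {w})
      (λ {k} {ρ} {A} {w} → initialise-stop {k} {ρ} {A} {w})
      n n≤N R

    search-start : Initialised ρ A w →
      Bounded (compile search-setup) (time (compile search-setup)) 0 (Concrete (Searching (4 * n) (remaining λ _ → 0))) c m w
    search-start init = straight search-setup {Searching (4 * n) (remaining λ _ → 0)} R (search-setup-wp {ρ} {A} {w} init)

    search-loop : Searching (4 * n) (remaining λ _ → 0) ρ A w →
      Bounded (loop (lt zeroV runV) search) 1 (suc (time (compile search))) (Concrete Searched) c m w
    search-loop = looping {lt zeroV runV} {search} {Searched} (Searching (4 * n))
      (λ {ρ} {A} {w} → search-last {4 * n} {ρ} {A} {w})
      (λ {k} {ρ} {A} {w} → search-step {4 * n} {k} {ρ} {A} {w})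
      (λ {k} {ρ} {A} {w} → search-stop {4 * n} {k} {ρ} {A} {w})
      (remaining λ _ → 0) remaining≤N R

    module _ {par : Fin n → Fin n} where

      own-low-start : ∀ {k} → Constants ρ → Zeroed A → ρ countV ≡ k →
        Explored (A numA) (A orderA) (A parentA) par k → w ≤ 8n →
        Bounded (compile own-low-setup) (time (compile own-low-setup)) 0 (Concrete (OwnLow 8n k par N)) c m w
      own-low-start {k} K Z count≡ X writes = straight own-low-setup {OwnLow 8n k par N} R
        (own-low-setup-wp {8n} {k} {par} {ρ} {A} {w} K Z count≡ X writes)

      own-low-loop : ∀ {k} → OwnLow 8n k par N ρ A w →
        Bounded (loop (lt curV sizeV) own-low) 1 (suc (time (compile own-low)))
          (Concrete (λ ρ A w → Lowered k par k ρ A × w ≤ 9n)) c m w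
      own-low-loop {k} = looping {lt curV sizeV} {own-low} {λ ρ A w → Lowered k par k ρ A × w ≤ 9n} (OwnLow 8n k par)
        (λ {ρ} {A} {w} → own-low-last {8n} {k} {par} {ρ} {A} {w})
        (λ {i} {ρ} {A} {w} → own-low-step {8n} {k} {par} {i} {ρ} {A} {w})
        (λ {i} {ρ} {A} {w} → own-low-stop {8n} {k} {par} {i} {ρ} {A} {w})
        N ≤-refl R

      module _ {μ} (μ≤n : suc μ ≤ n) where

        propagate-start : Lowered (suc μ) par (suc μ) ρ A → w ≤ 9n →
          Bounded (compile propagate-setup) (time (compile propagate-setup)) 0
            (Concrete (Propagating 9n (suc μ) par μ)) c m w
        propagate-start low writes = straight propagate-setup {Propagating 9n (suc μ) par μ} R
          (propagate-setup-wp {9n} {μ} {par} {ρ} {A} {w} low writes)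

        propagate-loop : Propagating 9n (suc μ) par μ ρ A w →
          Bounded (loop (lt oneV curV) propagate) 1 (suc (time (compile propagate)))
            (Concrete (λ ρ A w → Lowered (suc μ) par 1 ρ A × w ≤ 9n + suc μ)) c m w
        propagate-loop = looping {lt oneV curV} {propagate} {λ ρ A w → Lowered (suc μ) par 1 ρ A × w ≤ 9n + suc μ}
          (Propagating 9n (suc μ) par)
          (λ {ρ} {A} {w} → propagate-last {9n} {suc μ} {par} {ρ} {A} {w})
          (λ {i} {ρ} {A} {w} → propagate-step {9n} {suc μ} {par} {i} {ρ} {A} {w})
          (λ {i} {ρ} {A} {w} → propagate-stop {9n} {suc μ} {par} {i} {ρ} {A} {w})
          μ (≤-trans (<⇒≤ μ≤n) n≤N) R

        assign-start : Lowered (suc μ) par 1 ρ A → w ≤ 10n →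
          Bounded (compile assign-setup) (time (compile assign-setup)) 0 (Concrete (Assigning 10n (suc μ) par μ)) c m w
        assign-start low writes = straight assign-setup {Assigning 10n (suc μ) par μ} R
          (assign-setup-wp {10n} {μ} {par} {ρ} {A} {w} low writes)

        assign-loop : Assigning 10n (suc μ) par μ ρ A w →
          Bounded (loop (lt curV countV) assign) 1 (suc (time (compile assign))) (Concrete (Assigned 10n (suc μ) par)) c m w
        assign-loop = looping {lt curV countV} {assign} {Assigned 10n (suc μ) par} (Assigning 10n (suc μ) par)
          (λ {ρ} {A} {w} → assign-last {10n} {suc μ} {par} {ρ} {A} {w})
          (λ {i} {ρ} {A} {w} → assign-step {10n} {suc μ} {par} {i} {ρ} {A} {w})
          (λ {i} {ρ} {A} {w} → assign-stop {10n} {suc μ} {par} {i} {ρ} {A} {w})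
          μ (≤-trans (<⇒≤ μ≤n) n≤N) R

  after-search : ∀ {c m w ρ A} k {par} → Represents c m ρ A → Constants ρ → Zeroed A → ρ countV ≡ k →
    Explored (A numA) (A orderA) (A parentA) par k → w ≤ 8n → Bounded labelling-program 11 50 Result c m w
  -- The root is always counted, so `k` is positive and both later passes take `k` minus 1
  -- iterations.
  after-search zero    R K Z count≡ X writes = contradiction (Explored.0<k X) n≮0
  after-search {c} {m} {w} {ρ} {A} (suc μ) {par} R K Z count≡ X writes =
    own-low-start R {par} K Z count≡ X writes andThen λ R init →
    own-low-loop R {par} init andThen λ R (low , writes) →
    propagate-start R {par} k≤n low writes andThen λ R init →
    propagate-loop R {par} k≤n init andThen λ R (low , writes) →
    assign-start R {par} k≤n low (≤-trans writes (+-monoʳ-≤ 9n k≤n)) andThen λ R init →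
    assign-loop R {par} k≤n init andThen λ R done →
    postlude-terminates {10n} {suc μ} {par} total-writes R done
    where k≤n = Explored.k≤n X

  prelude-bounded : ∀ c → Bounded prelude 17 0 (Concrete (Initialising n)) c μ₀ 0
  prelude-bounded c = bounded (weaken {Q = Concrete (Initialising n)} {Concrete (Initialising n)}
    (m≤m+n 17 (N * 0)) (λ post → post) (prelude-terminates c))

  build-bounded : ∀ c → Bounded build-program 38 83 Result c μ₀ 0
  build-bounded c =
    prelude-bounded c andThen λ R init →
    initialise-loop R init andThen λ R done →
    search-start R done andThen λ R init →
    search-loop R init andThen λ R (K , Z , k , par , count≡ , X , writes) →
    after-search k R K Z count≡ X (≤-trans writes (+-monoʳ-≤ (4 * n) (*-monoʳ-≤ 4 (Explored.k≤n X))))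

-- Absorbing the constants, and the final statement

space-bound : ∀ {n m c} → 1 ≤ n → 14 ≤ c → suc (3 + n + (m + m)) + 9 * n ≤ c * (n + m)
space-bound {n} {m} {c} 1≤n 14≤c = begin
  -- The constant 4 is at most `4 * n` since there is a vertex, and `2 * m` is padded to `14 * m`.
  4 + n + (m + m) + 9 * n       ≤⟨ +-monoˡ-≤ (9 * n) (+-mono-≤ (+-monoˡ-≤ n (*-monoʳ-≤ 4 1≤n)) (+-monoʳ-≤ m (m≤n*m m 13))) ⟩
  4 * n + n + (m + 13 * m) + 9 * n ≡⟨ cong (λ x → x + 14 * m + 9 * n) (+-comm (4 * n) n) ⟩
  5 * n + 14 * m + 9 * n        ≡⟨ +-assoc (5 * n) (14 * m) (9 * n) ⟩
  5 * n + (14 * m + 9 * n)      ≡⟨ cong (5 * n +_) (+-comm (14 * m) (9 * n)) ⟩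
  5 * n + (9 * n + 14 * m)      ≡⟨ +-assoc (5 * n) (9 * n) (14 * m) ⟨
  5 * n + 9 * n + 14 * m        ≡⟨ cong (_+ 14 * m) (*-distribʳ-+ n 5 9) ⟨
  14 * n + 14 * m               ≡⟨ *-distribˡ-+ 14 n m ⟨
  14 * (n + m)                  ≤⟨ *-monoˡ-≤ (n + m) 14≤c ⟩
  c * (n + m)                   ∎
  where open ≤-Reasoning

-- Both `n` and the degree sum are at most twice `m ⊔ 1`, which is where the factor 4 comes from;
-- `x` is absorbed because `m ⊔ 1` is at least 1.
time-bound : ∀ n m s {c} x y → s ≡ m + m → n ≤ 2 * (m ⊔ 1) → x + 4 * y ≤ c → x + (n + s) * y ≤ c * (m ⊔ 1)
time-bound n m s {c} x y refl n≤ fits = begin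
  x + (n + (m + m)) * y ≤⟨ +-monoʳ-≤ x (*-monoˡ-≤ y (+-mono-≤ n≤ (+-mono-≤ m≤M m≤M))) ⟩
  x + (2 * M + (M + M)) * y ≡⟨ cong (λ s → x + (2 * M + (M + s)) * y) (+-identityʳ M) ⟨
  x + (2 * M + 2 * M) * y ≡⟨ cong (λ s → x + s * y) (*-distribʳ-+ M 2 2) ⟨
  x + 4 * M * y         ≡⟨ cong (λ s → x + s * y) (*-comm 4 M) ⟩
  x + M * 4 * y         ≡⟨ cong (x +_) (*-assoc M 4 y) ⟩
  x + M * (4 * y)       ≤⟨ +-monoˡ-≤ _ (≤-trans (≤-reflexive (sym (*-identityˡ x))) (*-monoˡ-≤ x (m≤n⊔m m 1))) ⟩
  M * x + M * (4 * y)   ≡⟨ *-distribˡ-+ M x (4 * y) ⟨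
  M * (x + 4 * y)       ≤⟨ *-monoʳ-≤ M fits ⟩
  M * c                 ≡⟨ *-comm M c ⟩
  c * M                 ∎
  where
  open ≤-Reasoning
  M = m ⊔ 1
  m≤M = m≤m⊔n m 1

write-bound : ∀ n m {c w} → 14 ≤ c → w ≤ 14 * n → w ≤ c * (n + m)
write-bound n m {c} 14≤c w≤ = ≤-trans w≤ (≤-trans (*-monoˡ-≤ n 14≤c) (*-monoʳ-≤ c (m≤m+n n m)))

-- At most 38 + 83 (n + 2m) operations and 14 n writes.
build-correct : ∀ {c} → 370 ≤ c → ∀ {n} .{{_ : NonZero n}} (G : Graph n) → Connected G →
  ∀ ω .{{_ : NonZero ω}} W → c * (n + #edges G) ≤ W →
  ∀ σ → GraphInMemory G ω (memory σ) →
  ∃[ τ ] ∃[ t ] ∃[ w ]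
    ( Run W build-program σ τ t w
    × t ≤ c * (#edges G ⊔ 1)
    × w ≤ c * (n + #edges G / ω)
    × Σ[ T ∈ RootedSpanningTree G ] Σ[ L ∈ BCLabeling G T ] LabelingInMemory W L τ )
build-correct {c} 370≤c {suc n-1} G conn ω W space ⟨ r , m ⟩ stored = conclude
  (Construction.Bounded.terminates (Construction.build-bounded G conn m stored fits r))
  where
  open GraphInMemory stored
  open Construction using (Result)

  14≤c : 14 ≤ c
  14≤c = ≤-trans (≤ᵇ⇒≤ 14 370 _) 370≤c

  end≡ : m (3 + n-1) ≡ 3 + suc n-1 + (#edges G + #edges G)
  end≡ = trans (partial-sums (λ i → m (2 + i)) (degree G) next-offset) (cong₂ _+_ first-offset (handshake G))

  fits : suc (m (3 + n-1)) + 9 * suc n-1 ≤ W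
  fits = ≤-trans (subst (λ e → suc e + 9 * suc n-1 ≤ c * (suc n-1 + #edges G)) (sym end≡)
    (space-bound {suc n-1} {#edges G} {c} (s≤s z≤n) 14≤c)) space

  conclude : Terminates W build-program (38 + (suc n-1 + sum (degree G)) * 83) (Result G conn m stored fits) r m 0 →
    ∃[ τ ] ∃[ t ] ∃[ w ]
      ( Run W build-program ⟨ r , m ⟩ τ t w
      × t ≤ c * (#edges G ⊔ 1)
      × w ≤ c * (suc n-1 + #edges G / ω)
      × Σ[ T ∈ RootedSpanningTree G ] Σ[ L ∈ BCLabeling G T ] LabelingInMemory W L τ )
  conclude (τ , t , w , run , t≤ , w≤ , T , L , result) =
    τ , t , w , run ,
    ≤-trans t≤ (time-bound (suc n-1) (#edges G) (sum (degree G)) {c} 38 83 (handshake G) (vertices≤ G conn) 370≤c) ,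
    write-bound (suc n-1) (#edges G / ω) {c} 14≤c w≤ ,
    T , L , result

1<word : ∀ {c n W} m → 2 ≤ c → Fin n → c * (n + m) ≤ W → 1 < W
1<word {c} {suc n} m 2≤c _ space = ≤-trans (≤-trans 2≤c
  (≤-trans (≤-reflexive (sym (*-identityʳ c))) (*-monoʳ-≤ c {1} {suc n + m} (s≤s z≤n)))) space

lemma5p1 : Σ[ c ∈ ℕ ] Σ[ build ∈ Program ] Σ[ bridge? ∈ Program ] Σ[ articulation? ∈ Program ] Σ[ component-of ∈ Program ]
    ( (∀ {n} .{{_ : NonZero n}} (G : Graph n) → Connected G →
    ∀ ω .{{_ : NonZero ω}} W → c * (n + #edges G) ≤ W → ω < W →
    ∀ σ → IsWordState W σ → GraphInMemory G ω (memory σ) →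
    ∃[ τ ] ∃[ t ] ∃[ w ]
    ( Run W build σ τ t w
    × t ≤ c * (#edges G ⊔ 1)
    × w ≤ c * (n + #edges G / ω)
    × Σ[ T ∈ RootedSpanningTree G ] Σ[ L ∈ BCLabeling G T ] LabelingInMemory W L τ ))
    × (∀ {n} (G : Graph n) → Connected G →
    ∀ (T : RootedSpanningTree G) (L : BCLabeling G T) W → c * (n + #edges G) ≤ W →
    ∀ σ → IsWordState W σ → LabelingInMemory W L σ →
    (∀ u v → Edge G u v → cache σ 0 ≡ toℕ u → cache σ 1 ≡ toℕ v →
    ∃[ τ ] ∃[ t ]
    ( Run W bridge? σ τ t 0 × t ≤ c
    × IsAnswer (IsBridge G u v) (cache τ 0) ))
    × (∀ v → cache σ 0 ≡ toℕ v →
    ∃[ τ ] ∃[ t ]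
    ( Run W articulation? σ τ t 0 × t ≤ c
    × IsAnswer (IsArticulationPoint G v) (cache τ 0) ))
    × (∀ u v → Edge G u v → cache σ 0 ≡ toℕ u → cache σ 1 ≡ toℕ v →
    ∃[ τ ] ∃[ t ]
    ( Run W component-of σ τ t 0 × t ≤ c
    × ∃[ i ] ( cache τ 0 ≡ toℕ i
    × u ∈ BCLabeling.component L i
    × v ∈ BCLabeling.component L i ) ))))
lemma5p1 = c , build-program , bridge-program , articulation-program , component-of-program ,
  (λ G conn ω W space _ σ _ stored → build-correct {c} (≤ᵇ⇒≤ 370 400 _) G conn ω W space σ stored) ,
  λ G conn T L W space σ _ stored →
    (λ u v e u≡ v≡ → read-only bridge-program (≤ᵇ⇒≤ _ 400 _) W σ (λ r → IsAnswer (IsBridge G u v) (r 0))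
      (Queries.bridge-wp conn L (1<word (#edges G) 2≤c u space) stored {u} {v} e u≡ v≡)) ,
    (λ v v≡ → read-only articulation-program (≤ᵇ⇒≤ _ 400 _) W σ (λ r → IsAnswer (IsArticulationPoint G v) (r 0))
      (Queries.articulation-wp conn L (1<word (#edges G) 2≤c v space) stored {v} v≡)) ,
    (λ u v e u≡ v≡ → read-only component-of-program (≤ᵇ⇒≤ _ 400 _) W σ (Contains L u v)
      (Queries.component-of-wp conn L (1<word (#edges G) 2≤c u space) stored {λ r _ w → w ≡ 0 × Contains L u v r} {0} {u} {v} e u≡ v≡
        λ i _ is u∈ v∈ → refl , i , is , u∈ , v∈))
  where
  -- Any constant from 38 + 4 * 83 = 370 upwards would do for the construction; the loop-free
  -- queries are far shorter.
  c = 400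

  2≤c : 2 ≤ c
  2≤c = ≤ᵇ⇒≤ 2 400 _

  Contains : ∀ {n} {G : Graph n} {T : RootedSpanningTree G} → BCLabeling G T → Fin n → Fin n → (ℕ → ℕ) → Set
  Contains L u v r = ∃[ i ] (r 0 ≡ toℕ i × u ∈ BCLabeling.component L i × v ∈ BCLabeling.component L i)

  -- The postcondition fixes the final write count to 0, and matching on it makes the run itself one
  -- with 0 writes.
  read-only : ∀ p → time p ≤ c → ∀ W σ (Q : (ℕ → ℕ) → Set) →
    wp W p (λ r _ w → w ≡ 0 × Q r) (cache σ) (memory σ) 0 → ∃[ τ ] ∃[ t ] (Run W p σ τ t 0 × t ≤ c × Q (cache τ))
  read-only p p≤ W σ Q pre with wp-sound p {λ r _ w → w ≡ 0 × Q r} pre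
  ... | τ , t , _ , run , t≤ , refl , post = τ , t , run , ≤-trans t≤ p≤ , post
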